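{- Almost all feasible instances of 2-TSP with Vertex Requisitions (2-TSPVR) are solvable in $O(n)$ time. Precisely: let $\chi_n$ be the set of all bipartite graphs $\bar G=(X_n,X,\bar U)$ that correspond to feasible instances of 2-TSPVR with $n$ vertices. There exist an algorithm that solves 2-TSPVR to optimality and a constant $C$ such that, if $\chi_n^{*}\subseteq\chi_n$ denotes the set of graphs $\bar G\in\chi_n$ such that the algorithm solves every instance with bipartite graph $\bar G$ (i.e. for every choice of non-negative arc weights) in time at most $Cn$, then $|\chi_n^{*}|/|\chi_n|\to 1$ as $n\to\infty$.
   Context: 2-TSPVR. An instance consists of a set $X=\{x_1,\dots,x_n\}$ of vertices of a complete digraph with non-negative arc weights $\rho(x,y)$, $x\ne y$, and subsets (requisitions) $X^1,\dots,X^n\subseteq X$ with $1\le |X^i|\le 2$ for all $i$. $F$ is the set of bijections $f:\{1,\dots,n\}\to X$ with $f(i)\in X^i$ for all $i$; the instance is feasible if $F\neq\emptyset$. The cost of $f\in F$ is $\rho(f)=\sum_{i=1}^{n-1}\rho(f(i),f(i+1))+\rho(f(n),f(1))$; solving the instance means finding $f^*\in F$ with $\rho(f^*)=\min_{f\in F}\rho(f)$. Indices are cyclic ($n+1:=1$). Only the arcs that start in $X^i$ and end in $X^{i+1}$ for some $i\in\{1,\dots,n\}$ are given in the input (so the input has size $O(n)$; the weights $\rho(x,y)$ with $x\in X^i$, $y\in X^{i+1}$ are accessible in constant time from $i$). Time is counted with arithmetic operations and comparisons on weights taking unit time (standard unit-cost random access machine). Bipartite graph. For $X_n=\{1,\dots,n\}$,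 the bipartite graph of an instance is $\bar G=(X_n,X,\bar U)$ with edge set $\bar U=\{\{i,x\}: i\in X_n,\ x\in X^i\}$. It is determined by the requisitions $X^1,\dots,X^n$ alone, and the instance is feasible if and only if $\bar G$ has a perfect matching. Thus $\chi_n$ is the set of (labelled) bipartite graphs with parts $X_n$ and $X$ in which each vertex of $X_n$ has degree 1 or 2 and which have a perfect matching. -}

module Defs where

open import Level using (Level; 0ℓ)
open import Algebra.Bundles using (AbelianGroup)
open import Algebra.Structures using (IsAbelianGroup)
import Algebra.Properties.CommutativeMonoid.Sum as Sum
open import Data.Bool.Base using (Bool; true; false; if_then_else_; not; _∧_)
open import Data.Fin.Base using (Fin; toℕ; fromℕ<)
open import Data.Fin.Properties using (nonZeroIndex)
open import Data.Fin.Subset using (Subset; _∈_; ∣_∣)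
import Data.Integer.Base as ℤ
open import Data.List.Base using (List; length)
import Data.List.Membership.Propositional as List
open import Data.List.Relation.Unary.All using (All)
open import Data.List.Relation.Unary.Unique.Propositional using (Unique)
open import Data.Nat.Base using (ℕ; suc; _+_; _*_; _∸_; _≤_; NonZero)
open import Data.Nat.DivMod using (_mod_)
open import Data.Nat.Properties using (_≟_; _<?_)
import Data.Rational.Base as ℚ
open import Data.Product.Base using (Σ; ∃; ∃₂; _×_)
open import Data.Sum.Base using (_⊎_)
open import Data.Vec.Base using (Vec; lookup)
open import Function.Bundles using (_⇔_)
open import Function.Definitions using (Bijective)
open import Relation.Binary.PropositionalEquality.Core using (_≡_; _≢_)
open import Relation.Binary.Structures using (IsDecTotalOrder)
open import Relation.Nullary.Decidable.Core using (does; yes; no)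
open import Relation.Unary using (Pred)

------------------------------------------------------------------------
-- Arc weights

-- There are no real numbers here, so weights range over an arbitrary
-- (decidably) linearly ordered abelian group: only sums, differences and comparisons
-- of weights occur in the problem or in the machine below.

record WeightDomain : Set₁ where
  infix  8 -_
  infixl 6 _∙_
  infix  4 _≈_ _≼_
  field
    Carrier         : Set
    _≈_             : Carrier → Carrier → Set
    _≼_             : Carrier → Carrier → Set
    _∙_             : Carrier → Carrier → Carrier
    0#              : Carrier
    -_              : Carrier → Carrier
    isAbelianGroup  : IsAbelianGroup _≈_ _∙_ 0# -_
    isDecTotalOrder : IsDecTotalOrder _≈_ _≼_
    ∙-monoˡ-≼       : ∀ x y z → x ≼ y → x ∙ z ≼ y ∙ z

  abelianGroup : AbelianGroup 0ℓ 0ℓ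
  abelianGroup = record { isAbelianGroup = isAbelianGroup }

  open AbelianGroup abelianGroup public using (commutativeMonoid)
  open IsDecTotalOrder isDecTotalOrder public using (_≤?_)

------------------------------------------------------------------------
-- Bipartite graphs of instances

-- Both X_n and X are labelled by Fin n; entry i of the vector is the
-- requisition Xⁱ, that is, the neighbourhood of i ∈ X_n.

BipartiteGraph : ℕ → Set
BipartiteGraph n = Vec (Subset n) n

module _ {n : ℕ} (G : BipartiteGraph n) where

  -- The set F of the instance, i.e. the perfect matchings of G.
  IsFeasibleSolution : (Fin n → Fin n) → Set
  IsFeasibleSolution f = Bijective _≡_ _≡_ f × (∀ i → f i ∈ lookup G i)

χ : ∀ n → Pred (BipartiteGraph n) 0ℓ
χ n G = (∀ i → 1 ≤ ∣ lookup G i ∣ × ∣ lookup G i ∣ ≤ 2)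
      × ∃ (IsFeasibleSolution G)

-- An order in which the elements of each Xⁱ are written down in the input;
-- fst i ≡ snd i exactly when Xⁱ is a singleton.
record Listing {n : ℕ} (G : BipartiteGraph n) : Set where
  field
    fst snd : Fin n → Fin n
    lists   : ∀ i x → x ∈ lookup G i ⇔ (x ≡ fst i ⊎ x ≡ snd i)

-- The cyclic successor: n + 1 := 1.
next : ∀ {n} → Fin n → Fin n
next {n} i = _mod_ (suc (toℕ i)) n {{nonZeroIndex i}}

------------------------------------------------------------------------
-- Programs of a random access machine
--
-- A unit-cost RAM with structured control flow.  It has a bank of scalar
-- registers and a bank of unbounded, indirectly addressed arrays for
-- natural numbers, and another such pair of banks for weights.  Registers
-- and arrays are named by constants of the program, so a program uses
-- finitely many of them.

Name : Set
Name = ℕ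

infix  10 _at_
infixl 9 _⊕_ _⊖_
infix  8 _==_ _<'_ _≤ʷ_
infix  8 !_
infixr 7 _&&_
infix  6 _:=_ _:=ʷ_ _[_]:=_ _[_]:=ʷ_
infixr 5 _⨟_

data Expr : Set where
  const   : ℕ → Expr
  reg     : Name → Expr
  _at_    : Name → Expr → Expr
  _⊕_ _⊖_ : Expr → Expr → Expr

data WExpr : Set where
  reg     : Name → WExpr
  _at_    : Name → Expr → WExpr
  _⊕_ _⊖_ : WExpr → WExpr → WExpr

data Test : Set where
  _==_ _<'_ : Expr → Expr → Test
  _≤ʷ_      : WExpr → WExpr → Test
  !_        : Test → Test
  _&&_      : Test → Test → Test

data Program : Set where
  skip    : Program
  _:=_    : Name → Expr → Program
  _:=ʷ_   : Name → WExpr → Program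
  _[_]:=_  : Name → Expr → Expr → Program
  _[_]:=ʷ_ : Name → Expr → WExpr → Program
  _⨟_     : Program → Program → Program
  branch  : Test → Program → Program → Program
  while   : Test → Program → Program

-- One time unit per operation, i.e. per node of the expression.

costᵉ : Expr → ℕ
costᵉ (const _) = 1
costᵉ (reg _)   = 1
costᵉ (_ at e)  = 1 + costᵉ e
costᵉ (d ⊕ e)   = 1 + (costᵉ d + costᵉ e)
costᵉ (d ⊖ e)   = 1 + (costᵉ d + costᵉ e)

costʷ : WExpr → ℕ
costʷ (reg _)  = 1
costʷ (_ at e) = 1 + costᵉ e
costʷ (d ⊕ e)  = 1 + (costʷ d + costʷ e)
costʷ (d ⊖ e)  = 1 + (costʷ d + costʷ e)

costᵗ : Test → ℕ
costᵗ (d == e) = 1 + (costᵉ d + costᵉ e)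
costᵗ (d <' e) = 1 + (costᵉ d + costᵉ e)
costᵗ (d ≤ʷ e) = 1 + (costʷ d + costʷ e)
costᵗ (! b)  = 1 + costᵗ b
costᵗ (b && c) = 1 + (costᵗ b + costᵗ c)

_[_↦_] : {A : Set} → (ℕ → A) → ℕ → A → (ℕ → A)
(m [ k ↦ v ]) j = if does (j ≟ k) then v else m j

padded : {A : Set} {n : ℕ} → A → (Fin n → A) → (ℕ → A)
padded {n = n} z v j with j <? n
... | yes j<n = v (fromℕ< j<n)
... | no  _   = z

module _ (W : WeightDomain) where
  open WeightDomain W

  ----------------------------------------------------------------------
  -- Execution

  record State : Set where
    constructor state
    field
      regs  : Name → ℕ
      arrs  : Name → ℕ → ℕ
      wregs : Name → Carrier
      warrs : Name → ℕ → Carrier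

  open State

  ⟦_⟧ᵉ : Expr → State → ℕ
  ⟦ const k ⟧ᵉ s = k
  ⟦ reg x ⟧ᵉ   s = regs s x
  ⟦ a at e ⟧ᵉ  s = arrs s a (⟦ e ⟧ᵉ s)
  ⟦ d ⊕ e ⟧ᵉ   s = ⟦ d ⟧ᵉ s + ⟦ e ⟧ᵉ s
  ⟦ d ⊖ e ⟧ᵉ   s = ⟦ d ⟧ᵉ s ∸ ⟦ e ⟧ᵉ s

  ⟦_⟧ʷ : WExpr → State → Carrier
  ⟦ reg x ⟧ʷ  s = wregs s x
  ⟦ a at e ⟧ʷ s = warrs s a (⟦ e ⟧ᵉ s)
  ⟦ d ⊕ e ⟧ʷ  s = ⟦ d ⟧ʷ s ∙ ⟦ e ⟧ʷ s
  ⟦ d ⊖ e ⟧ʷ  s = ⟦ d ⟧ʷ s ∙ (- ⟦ e ⟧ʷ s)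

  ⟦_⟧ᵗ : Test → State → Bool
  ⟦ d == e ⟧ᵗ s = does (⟦ d ⟧ᵉ s ≟ ⟦ e ⟧ᵉ s)
  ⟦ d <' e ⟧ᵗ s = does (⟦ d ⟧ᵉ s <? ⟦ e ⟧ᵉ s)
  ⟦ d ≤ʷ e ⟧ᵗ s = does (⟦ d ⟧ʷ s ≤? ⟦ e ⟧ʷ s)
  ⟦ ! b ⟧ᵗ  s = not (⟦ b ⟧ᵗ s)
  ⟦ b && c ⟧ᵗ s = ⟦ b ⟧ᵗ s ∧ ⟦ c ⟧ᵗ s

  -- p , s ⇓[ t ] s′ : started in s, the program p halts in s′ after time t.

  infix 4 _,_⇓[_]_

  data _,_⇓[_]_ : Program → State → ℕ → State → Set where
    skip : ∀ {s} → skip , s ⇓[ 1 ] s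
    assign : ∀ {x e s} →
      x := e , s ⇓[ 1 + costᵉ e ]
        record s { regs = regs s [ x ↦ ⟦ e ⟧ᵉ s ] }
    assignʷ : ∀ {x e s} →
      x :=ʷ e , s ⇓[ 1 + costʷ e ]
        record s { wregs = wregs s [ x ↦ ⟦ e ⟧ʷ s ] }
    store : ∀ {a d e s} →
      a [ d ]:= e , s ⇓[ 1 + (costᵉ d + costᵉ e) ]
        record s { arrs = arrs s [ a ↦ arrs s a [ ⟦ d ⟧ᵉ s ↦ ⟦ e ⟧ᵉ s ] ] }
    storeʷ : ∀ {a d e s} →
      a [ d ]:=ʷ e , s ⇓[ 1 + (costᵉ d + costʷ e) ]
        record s { warrs = warrs s [ a ↦ warrs s a [ ⟦ d ⟧ᵉ s ↦ ⟦ e ⟧ʷ s ] ] }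
    seq : ∀ {p q s s′ s″ t u} →
      p , s ⇓[ t ] s′ → q , s′ ⇓[ u ] s″ → p ⨟ q , s ⇓[ t + u ] s″
    branch-true : ∀ {b p q s s′ t} → ⟦ b ⟧ᵗ s ≡ true →
      p , s ⇓[ t ] s′ → branch b p q , s ⇓[ 1 + (costᵗ b + t) ] s′
    branch-false : ∀ {b p q s s′ t} → ⟦ b ⟧ᵗ s ≡ false →
      q , s ⇓[ t ] s′ → branch b p q , s ⇓[ 1 + (costᵗ b + t) ] s′
    while-true : ∀ {b p s s′ s″ t u} → ⟦ b ⟧ᵗ s ≡ true →
      p , s ⇓[ t ] s′ → while b p , s′ ⇓[ u ] s″ →
      while b p , s ⇓[ 1 + (costᵗ b + (t + u)) ] s″
    while-false : ∀ {b p s} → ⟦ b ⟧ᵗ s ≡ false →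
      while b p , s ⇓[ 1 + costᵗ b ] s

  ----------------------------------------------------------------------
  -- Instances and their solution

  -- The diagonal of ρ is meaningless: no arc x → x exists, and for n ≥ 2 no
  -- tour uses it.
  record Weights (n : ℕ) : Set where
    field
      ρ    : Fin n → Fin n → Carrier
      ρ≽0# : ∀ x y → x ≢ y → 0# ≼ ρ x y

  module _ {n : ℕ} (w : Weights n) where
    open Weights w

    cost : (Fin n → Fin n) → Carrier
    cost f = Sum.sum commutativeMonoid (λ i → ρ (f i) (f (next i)))

    IsOptimal : BipartiteGraph n → (Fin n → Fin n) → Set
    IsOptimal G f = IsFeasibleSolution G f
                  × (∀ g → IsFeasibleSolution G g → cost f ≼ cost g)

    -- Indices are 0-based in memory.  Register 0 holds n; arrays 0 and 1 hold
    -- the listed elements of Xⁱ; the four weight arrays hold the weights of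
    -- the arcs from Xⁱ to Xⁱ⁺¹.  All other cells are zero.  When the start
    -- and the end of such an arc coincide, the cell holds a meaningless
    -- diagonal value of ρ.
    initial : {G : BipartiteGraph n} → Listing G → State
    initial L = state regs₀ arrs₀ (λ _ → 0#) warrs₀
      where
      open Listing L

      regs₀ : Name → ℕ
      regs₀ 0 = n
      regs₀ _ = 0

      arrs₀ : Name → ℕ → ℕ
      arrs₀ 0 = padded 0 (λ i → toℕ (fst i))
      arrs₀ 1 = padded 0 (λ i → toℕ (snd i))
      arrs₀ _ = λ _ → 0

      warrs₀ : Name → ℕ → Carrier
      warrs₀ 0 = padded 0# (λ i → ρ (fst i) (fst (next i)))
      warrs₀ 1 = padded 0# (λ i → ρ (fst i) (snd (next i)))
      warrs₀ 2 = padded 0# (λ i → ρ (snd i) (fst (next i)))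
      warrs₀ 3 = padded 0# (λ i → ρ (snd i) (snd (next i)))
      warrs₀ _ = λ _ → 0#

    -- The solution is delivered in array 2.
    SolvesInTime : Program → {G : BipartiteGraph n} → Listing G → ℕ → Set
    SolvesInTime A {G} L t = ∃₂ λ s f →
      (A , initial L ⇓[ t ] s)
      × (∀ i → arrs s 2 (toℕ i) ≡ toℕ (f i))
      × IsOptimal G f

-- A solves every feasible instance of 2-TSPVR to optimality.
Solves2TSPVR : Program → Set₁
Solves2TSPVR A = ∀ (W : WeightDomain) n (G : BipartiteGraph n) → χ n G →
  (L : Listing G) (w : Weights W n) → ∃ λ t → SolvesInTime W w A L t

χ* : Program → ℕ → ∀ n → BipartiteGraph n → Set₁
χ* A C n G = χ n G ×
  (∀ (W : WeightDomain) (L : Listing G) (w : Weights W n) →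
     ∃ λ t → t ≤ C * n × SolvesInTime W w A L t)

------------------------------------------------------------------------
-- Cardinalities and limits

module _ {ℓ : Level} {A : Set} where

  HasSize : Pred A ℓ → ℕ → Set ℓ
  HasSize P k = ∃ λ xs →
    Unique xs × length xs ≡ k × (∀ x → x List.∈ xs ⇔ P x)

  HasSizeAtLeast : Pred A ℓ → ℕ → Set ℓ
  HasSizeAtLeast P k = ∃ λ xs → Unique xs × length xs ≡ k × All P xs

-- |P n| / |Q n| → 1 as n → ∞, for P n ⊆ Q n with Q n finite.  P n need not be
-- decidable, in which case |P n| is not available constructively; as the
-- ratio is at most 1, bounding |P n| from below by a k close to |Q n|
-- expresses the same limit.
RatioTendsTo1 : ∀ {p q} {A : ℕ → Set} →
  (∀ n → Pred (A n) p) → (∀ n → Pred (A n) q) → Set _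
RatioTendsTo1 P Q = ∀ ε → ℚ.0ℚ ℚ.< ε → ∃ λ N → ∀ n → N ≤ n →
  ∃₂ λ k m → HasSizeAtLeast (P n) k × HasSize (Q n) m ×
  Σ (NonZero m) λ m≢0 →
    ℚ.∣ (ℚ._/_ (ℤ.+ k) m {{m≢0}}) ℚ.- ℚ.1ℚ ∣ ℚ.< ε

{-# OPTIONS --safe #-}

-- An instance is a multigraph on X with an edge {x , y} (or a loop) for each
-- requisition; a feasible solution matches every edge with one of its ends.
-- Repeatedly matching a vertex of degree 1 leaves disjoint cycles, each of which
-- can be matched in two ways.  With B - 1 cycles there are 2^(B-1) solutions, and
-- since a tour is a sum of costs of consecutive requisitions, its cost only depends
-- on a table indexed by pairs of cycles; all of this takes time O(n + 2^B B²).
--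
-- It remains to see that few graphs have many perfect matchings m(G).  Let f be a
-- fixed bijection.  Summing over bijections f′ the number of graphs through both f
-- and f′ gives at most ∑ₖ (n)ₖ nⁿ⁻ᵏ, since f′ is determined by the word of its values
-- that differ from those of f; as ∑ₖ k (n)ₖ n⁻ᵏ telescopes to n, this is O(√n nⁿ).
-- Hence ∑ m² = O(√n) ∑ m, so ∑ m = O(√n |χ|), and at most a fraction O(√n / K) of
-- the graphs have m > K; we take K of order n^(3/4).
module Submission where

-- The program never sees a perfect matching: feasibility provides some `f₀`, which occurs only in
-- the proof. Once no vertex of degree 1 is left, every live edge `e` has a companion at `f₀ e`; by
-- finiteness the companion map is a permutation, so the live part is 2-regular.
--
-- The forced edges share label 0, so there are B labels for B - 1 cycles. The distribution of the
-- number of cycles is never studied: only 2^(B-1) ≤ m(G) links time and counting.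
--
-- Passing from ∑ m² ≤ κ ∑ m to ∑ m ≤ κ |χ| is the Cauchy-Schwarz inequality, and discarding graphs
-- with m > K is Markov's. The exponent 3/4 meets two demands: K must exceed √n by a growing factor,
-- so that the discarded fraction vanishes, and K log² K must be O(n), as each choice is evaluated
-- afresh from B² cells. With s = 2^e and s⁴ ≤ n < 16 s⁴ no roots or logarithms occur: √n becomes
-- s², K becomes s³, and a factor s is left to absorb B².
--
-- Times are bounded by credits: a fixed amount held by each live or unvisited edge pays for the
-- nested loops.

open import Defs
open import Data.Bool.Base using (Bool; true; false; if_then_else_; not; _∧_; _∨_)
open import Data.Fin.Base using (Fin; zero; suc; toℕ)
open import Data.Nat.Base
open import Data.Nat.Properties
open import Data.Nat.Tactic.RingSolver using (solve-∀)
open import Data.Product.Base using (∃; ∃₂; _×_; _,_; proj₁; proj₂)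
open import Data.Sum.Base using (_⊎_; inj₁; inj₂)
open import Data.List.Base using (List; []; _∷_; _++_; [_]; map; length; filter; allFin)
open import Relation.Binary.PropositionalEquality hiding (J; setoid; [_])
open import Relation.Nullary.Decidable using (Dec; does; yes; no; ¬?; dec-true; dec-false)
open import Relation.Nullary.Negation using (contradiction; ¬_)

-- Symbolic execution and time credits for the random access machine.

module Ram where

  update-at : {A : Set} (m : ℕ → A) (k : ℕ) (v : A) → (m [ k ↦ v ]) k ≡ v
  update-at m k v rewrite dec-true (k ≟ k) refl = refl

  update-off : {A : Set} (m : ℕ → A) {k j : ℕ} (v : A) → j ≢ k → (m [ k ↦ v ]) j ≡ m j
  update-off m {k} {j} v j≢k rewrite dec-false (j ≟ k) j≢k = refl

  does-true : {P : Set} (d : Dec P) → does d ≡ true → P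
  does-true (yes p) _ = p
  does-true (no _) ()

  does-false : {P : Set} (d : Dec P) → does d ≡ false → ¬ P
  does-false (no ¬p) _ p = ¬p p
  does-false (yes _) ()

  -- A syntactic over-approximation of the cells that a program may change. As it computes to a
  -- Boolean, `refl` proves that a concrete program leaves a cell alone.
  writesReg writesArr : Name → Program → Bool
  writesReg x skip = false
  writesReg x (y := e) = x ≡ᵇ y
  writesReg x (y :=ʷ e) = false
  writesReg x (a [ d ]:= e) = false
  writesReg x (a [ d ]:=ʷ e) = false
  writesReg x (p ⨟ q) = writesReg x p ∨ writesReg x q
  writesReg x (branch b p q) = writesReg x p ∨ writesReg x q
  writesReg x (while b p) = writesReg x p

  writesArr x skip = false
  writesArr x (y := e) = false
  writesArr x (y :=ʷ e) = false
  writesArr x (a [ d ]:= e) = x ≡ᵇ a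
  writesArr x (a [ d ]:=ʷ e) = false
  writesArr x (p ⨟ q) = writesArr x p ∨ writesArr x q
  writesArr x (branch b p q) = writesArr x p ∨ writesArr x q
  writesArr x (while b p) = writesArr x p

  writesWReg writesWArr : Name → Program → Bool
  writesWReg x skip = false
  writesWReg x (y := e) = false
  writesWReg x (y :=ʷ e) = x ≡ᵇ y
  writesWReg x (a [ d ]:= e) = false
  writesWReg x (a [ d ]:=ʷ e) = false
  writesWReg x (p ⨟ q) = writesWReg x p ∨ writesWReg x q
  writesWReg x (branch b p q) = writesWReg x p ∨ writesWReg x q
  writesWReg x (while b p) = writesWReg x p

  writesWArr x skip = false
  writesWArr x (y := e) = false
  writesWArr x (y :=ʷ e) = false
  writesWArr x (a [ d ]:= e) = false
  writesWArr x (a [ d ]:=ʷ e) = x ≡ᵇ a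
  writesWArr x (p ⨟ q) = writesWArr x p ∨ writesWArr x q
  writesWArr x (branch b p q) = writesWArr x p ∨ writesWArr x q
  writesWArr x (while b p) = writesWArr x p

  loopFree : Program → Bool
  loopFree (p ⨟ q) = loopFree p ∧ loopFree q
  loopFree (branch b p q) = loopFree p ∧ loopFree q
  loopFree (while b p) = false
  loopFree _ = true

  -- An upper bound: a branch is charged its longer side. The dummy value at `while` is excluded by
  -- `loopFree`.
  duration : Program → ℕ
  duration skip = 1
  duration (x := e) = 1 + costᵉ e
  duration (x :=ʷ e) = 1 + costʷ e
  duration (a [ d ]:= e) = 1 + (costᵉ d + costᵉ e)
  duration (a [ d ]:=ʷ e) = 1 + (costᵉ d + costʷ e)
  duration (p ⨟ q) = duration p + duration q
  duration (branch b p q) = 1 + (costᵗ b + (duration p ⊔ duration q))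
  duration (while b p) = 0

  for : Name → Name → Program → Program
  for x N body =
    x := const 0 ⨟ while (reg x <' reg N) (body ⨟ x := (reg x ⊕ const 1))

  ∨-falseˡ : ∀ {a b} → a ∨ b ≡ false → a ≡ false
  ∨-falseˡ {false} _ = refl

  ∨-falseʳ : ∀ {a b} → a ∨ b ≡ false → b ≡ false
  ∨-falseʳ {false} e = e

  ∧-trueˡ : ∀ {a b} → a ∧ b ≡ true → a ≡ true
  ∧-trueˡ {true} _ = refl

  ∧-trueʳ : ∀ {a b} → a ∧ b ≡ true → b ≡ true
  ∧-trueʳ {true} e = e

  module Logic (W : WeightDomain) where
    open WeightDomain W using (Carrier)
    open State public

    private
      St : Set
      St = State W

      infix 4 _,_↓[_]_
      _,_↓[_]_ : Program → St → ℕ → St → Set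
      p , s ↓[ t ] s′ = _,_⇓[_]_ W p s t s′

    -- Time credits: p started in s with credit c halts, and Q holds of the
    -- credit left over and the final state.
    Runs : Program → St → ℕ → (ℕ → St → Set) → Set
    Runs p s c Q = ∃₂ λ t s′ → p , s ↓[ t ] s′ × ∃ λ r → t + r ≤ c × Q r s′

    record Frame (p : Program) (s s′ : St) : Set where
      field
        regs≡  : ∀ x → writesReg x p ≡ false → regs s′ x ≡ regs s x
        arrs≡  : ∀ a → writesArr a p ≡ false → arrs s′ a ≡ arrs s a
        wregs≡ : ∀ x → writesWReg x p ≡ false → wregs s′ x ≡ wregs s x
        warrs≡ : ∀ a → writesWArr a p ≡ false → warrs s′ a ≡ warrs s a
    open Frame public

    private
      frame-refl : ∀ {p s} → Frame p s s
      frame-refl = record { regs≡ = λ _ _ → refl ; arrs≡ = λ _ _ → refl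
                          ; wregs≡ = λ _ _ → refl ; warrs≡ = λ _ _ → refl }

      off : {A : Set} (m : ℕ → A) (k : ℕ) (v : A) (j : ℕ) →
        (j ≡ᵇ k) ≡ false → (m [ k ↦ v ]) j ≡ m j
      off m k v j eq rewrite eq = refl

    frame : ∀ {p s t s′} → p , s ↓[ t ] s′ → Frame p s s′
    frame skip = frame-refl
    frame (assign {x} {e} {s}) = record
      { regs≡ = λ y → off (regs s) x _ y ; arrs≡ = λ _ _ → refl
      ; wregs≡ = λ _ _ → refl ; warrs≡ = λ _ _ → refl }
    frame (assignʷ {x} {e} {s}) = record
      { regs≡ = λ _ _ → refl ; arrs≡ = λ _ _ → refl
      ; wregs≡ = λ y → off (wregs s) x _ y ; warrs≡ = λ _ _ → refl }
    frame (store {a} {s = s}) = record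
      { regs≡ = λ _ _ → refl ; arrs≡ = λ y → off (arrs s) a _ y
      ; wregs≡ = λ _ _ → refl ; warrs≡ = λ _ _ → refl }
    frame (storeʷ {a} {s = s}) = record
      { regs≡ = λ _ _ → refl ; arrs≡ = λ _ _ → refl
      ; wregs≡ = λ _ _ → refl ; warrs≡ = λ y → off (warrs s) a _ y }
    frame (seq {p} {q} d e) with frame d | frame e
    ... | f | g = record
      { regs≡ = λ x w → trans (regs≡ g x (∨-falseʳ {writesReg x p} w)) (regs≡ f x (∨-falseˡ w))
      ; arrs≡ = λ x w → trans (arrs≡ g x (∨-falseʳ {writesArr x p} w)) (arrs≡ f x (∨-falseˡ w))
      ; wregs≡ = λ x w → trans (wregs≡ g x (∨-falseʳ {writesWReg x p} w)) (wregs≡ f x (∨-falseˡ w))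
      ; warrs≡ = λ x w → trans (warrs≡ g x (∨-falseʳ {writesWArr x p} w)) (warrs≡ f x (∨-falseˡ w)) }
    frame (branch-true _ d) with frame d
    ... | f = record
      { regs≡ = λ x w → regs≡ f x (∨-falseˡ w) ; arrs≡ = λ x w → arrs≡ f x (∨-falseˡ w)
      ; wregs≡ = λ x w → wregs≡ f x (∨-falseˡ w) ; warrs≡ = λ x w → warrs≡ f x (∨-falseˡ w) }
    frame (branch-false {p = p} _ d) with frame d
    ... | f = record
      { regs≡ = λ x w → regs≡ f x (∨-falseʳ {writesReg x p} w)
      ; arrs≡ = λ x w → arrs≡ f x (∨-falseʳ {writesArr x p} w)
      ; wregs≡ = λ x w → wregs≡ f x (∨-falseʳ {writesWReg x p} w)
      ; warrs≡ = λ x w → warrs≡ f x (∨-falseʳ {writesWArr x p} w) }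
    frame (while-true _ d e) with frame d | frame e
    ... | f | g = record
      { regs≡ = λ x w → trans (regs≡ g x w) (regs≡ f x w)
      ; arrs≡ = λ x w → trans (arrs≡ g x w) (arrs≡ f x w)
      ; wregs≡ = λ x w → trans (wregs≡ g x w) (wregs≡ f x w)
      ; warrs≡ = λ x w → trans (warrs≡ g x w) (warrs≡ f x w) }
    frame (while-false _) = frame-refl

    framed : ∀ {p s c Q} → Runs p s c Q → Runs p s c (λ r s′ → Frame p s s′ × Q r s′)
    framed (t , s′ , d , r , le , q) = t , s′ , d , r , le , frame d , q

    weaken : ∀ {p s c Q Q′} → Runs p s c Q → (∀ {r s′} → Q r s′ → Q′ r s′) → Runs p s c Q′
    weaken (t , s′ , d , r , le , q) f = t , s′ , d , r , le , f q

    more : ∀ {p s c c′ Q} → c ≤ c′ → Runs p s c Q → Runs p s c′ Q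
    more c≤ (t , s′ , d , r , le , q) = t , s′ , d , r , ≤-trans le c≤ , q

    infixr 5 _⨟ᴿ_
    -- The second program receives whatever credit the first leaves over, so what is saved in one
    -- place can be spent in another; amortised bounds compose this way.
    _⨟ᴿ_ : ∀ {p q s c Q Q′} → Runs p s c Q → (∀ {r s′} → Q r s′ → Runs q s′ r Q′) →
      Runs (p ⨟ q) s c Q′
    _⨟ᴿ_ {c = c} (t , s′ , d , r , le , h) k with k h
    ... | t′ , s″ , d′ , r′ , le′ , h′ = t + t′ , s″ , seq d d′ , r′ ,
      ≤-trans (≤-reflexive (+-assoc t t′ r′)) (≤-trans (+-monoʳ-≤ t le′) le) , h′

    -- The final state as a function, so that postconditions of loop-free code can be checked by
    -- computation.
    run : Program → St → St
    run (x := e) s = record s { regs = regs s [ x ↦ ⟦_⟧ᵉ W e s ] }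
    run (x :=ʷ e) s = record s { wregs = wregs s [ x ↦ ⟦_⟧ʷ W e s ] }
    run (a [ d ]:= e) s = record s { arrs = arrs s [ a ↦ arrs s a [ ⟦_⟧ᵉ W d s ↦ ⟦_⟧ᵉ W e s ] ] }
    run (a [ d ]:=ʷ e) s = record s { warrs = warrs s [ a ↦ warrs s a [ ⟦_⟧ᵉ W d s ↦ ⟦_⟧ʷ W e s ] ] }
    run (p ⨟ q) s = run q (run p s)
    run (branch b p q) s = if ⟦_⟧ᵗ W b s then run p s else run q s
    run _ s = s

    run-↓ : ∀ p s → loopFree p ≡ true → ∃ λ t → t ≤ duration p × p , s ↓[ t ] run p s
    run-↓ skip s _ = 1 , ≤-refl , skip
    run-↓ (x := e) s _ = _ , ≤-refl , assign
    run-↓ (x :=ʷ e) s _ = _ , ≤-refl , assignʷ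
    run-↓ (a [ d ]:= e) s _ = _ , ≤-refl , store
    run-↓ (a [ d ]:=ʷ e) s _ = _ , ≤-refl , storeʷ
    run-↓ (p ⨟ q) s lf with run-↓ p s (∧-trueˡ lf) | run-↓ q (run p s) (∧-trueʳ {loopFree p} lf)
    ... | t , le , d | t′ , le′ , d′ = t + t′ , +-mono-≤ le le′ , seq d d′
    run-↓ (branch b p q) s lf with ⟦_⟧ᵗ W b s in eq
    ... | true with run-↓ p s (∧-trueˡ lf)
    ...   | t , le , d = _ , s≤s (+-monoʳ-≤ (costᵗ b) (≤-trans le (m≤m⊔n _ _))) , branch-true eq d
    run-↓ (branch b p q) s lf | false with run-↓ q s (∧-trueʳ {loopFree p} lf)
    ...   | t , le , d = _ , s≤s (+-monoʳ-≤ (costᵗ b) (≤-trans le (m≤n⊔m (duration p) _))) , branch-false eq d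

    straight : ∀ p {s r c Q} → loopFree p ≡ true → duration p + r ≤ c → Q r (run p s) → Runs p s c Q
    straight p {s} {r} lf le q with run-↓ p s lf
    ... | t , t≤ , d = t , _ , d , r , ≤-trans (+-monoˡ-≤ r t≤) le , q

    branchᴿ : ∀ {b p q s c c′ Q} → 1 + costᵗ b + c′ ≤ c →
      (⟦_⟧ᵗ W b s ≡ true → Runs p s c′ Q) → (⟦_⟧ᵗ W b s ≡ false → Runs q s c′ Q) →
      Runs (branch b p q) s c Q
    branchᴿ {b} {p} {q} {s} {c} {c′} {Q} le f g with ⟦_⟧ᵗ W b s in eq
    ... | true with f refl
    ...   | t , s′ , d , r , le′ , h = _ , s′ , branch-true eq d , r ,
            ≤-trans (s≤s (≤-trans (≤-reflexive (+-assoc (costᵗ b) t r)) (+-monoʳ-≤ (costᵗ b) le′))) le , h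
    branchᴿ {b} {p} {q} {s} {c} {c′} {Q} le f g | false with g refl
    ...   | t , s′ , d , r , le′ , h = _ , s′ , branch-false eq d , r ,
            ≤-trans (s≤s (≤-trans (≤-reflexive (+-assoc (costᵗ b) t r)) (+-monoʳ-≤ (costᵗ b) le′))) le , h

    -- Each test costs at least one unit, so the credit itself is the termination measure: the
    -- recursion is on a bound for it.
    whileᴿ : ∀ {b p s c Q} (I : ℕ → St → Set) →
      (∀ {c s} → I c s →
        (⟦_⟧ᵗ W b s ≡ false × ∃ λ r → 1 + costᵗ b + r ≤ c × Q r s) ⊎
        (⟦_⟧ᵗ W b s ≡ true × ∃ λ c′ → 1 + costᵗ b + c′ ≤ c × Runs p s c′ I)) →
      I c s → Runs (while b p) s c Q
    whileᴿ {b} {p} {Q = Q} I step i = go _ ≤-refl i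
      where
      go : ∀ fuel {c s} → c ≤ fuel → I c s → Runs (while b p) s c Q
      go zero {c} c≤ i with step i
      ... | inj₁ (eq , r , le , q) = _ , _ , while-false eq , r , le , q
      ... | inj₂ (eq , c′ , le , _) = contradiction (≤-trans le c≤) λ ()
      go (suc fuel) {c} c≤ i with step i
      ... | inj₁ (eq , r , le , q) = _ , _ , while-false eq , r , le , q
      ... | inj₂ (eq , c′ , le , t , s′ , d , r , le′ , i′)
        with go fuel {r} (≤-pred (≤-trans (s≤s (≤-trans (m≤n+m r t) (≤-trans le′ (m≤n+m c′ (costᵗ b))))) (≤-trans le c≤))) i′
      ... | t₂ , s₂ , d₂ , r₂ , le₂ , q = _ , s₂ , while-true eq d d₂ , r₂ , le₃ , q
        where
        open ≤-Reasoning
        le₃ : suc (costᵗ b + (t + t₂) + r₂) ≤ c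
        le₃ = begin
          suc (costᵗ b + (t + t₂) + r₂)   ≡⟨ cong suc (+-assoc (costᵗ b) (t + t₂) r₂) ⟩
          suc (costᵗ b + (t + t₂ + r₂))   ≡⟨ cong (λ z → suc (costᵗ b + z)) (+-assoc t t₂ r₂) ⟩
          suc (costᵗ b + (t + (t₂ + r₂))) ≤⟨ s≤s (+-monoʳ-≤ (costᵗ b) (+-monoʳ-≤ t le₂)) ⟩
          suc (costᵗ b + (t + r))         ≤⟨ s≤s (+-monoʳ-≤ (costᵗ b) le′) ⟩
          suc (costᵗ b + c′)              ≤⟨ le ⟩
          c                               ∎

    -- Eight units per round pay for the loop test and the increment.
    forᴿ : ∀ {x N body s m d c Q} (I : ℕ → ℕ → St → Set) →
      (x ≡ᵇ N) ≡ false → writesReg x body ≡ false → writesReg N body ≡ false →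
      regs s N ≡ m →
      I 0 c (run (x := const 0) s) →
      (∀ {k c s} → k < m → regs s x ≡ k → regs s N ≡ m → I k c s →
        Runs body s (d + c) (λ r s′ → I (suc k) r (record s′ { regs = regs s′ [ x ↦ suc k ] }))) →
      (∀ {c s} → regs s N ≡ m → I m c s → Q c s) →
      Runs (for x N body) s (6 + m * (8 + d) + c) Q
    forᴿ {x} {N} {body} {s} {m} {d} {c} {Q} I x≢N wx wN sN≡m i₀ step fin =
      straight (x := const 0) refl (≤-refl {suc (suc (4 + m * (8 + d) + c))}) init
      ⨟ᴿ whileᴿ J loop
      where
      J : ℕ → St → Set
      -- `j` counts the rounds still to come; the leading 4 is held back for the test that ends the
      -- loop.
      J c s = ∃₂ λ k j → ∃ λ c′ → k + j ≡ m × 4 + j * (8 + d) + c′ ≤ c ×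
        regs s x ≡ k × regs s N ≡ m × I k c′ s

      N≢x : (N ≡ᵇ x) ≡ false
      N≢x = trans (≡ᵇ-sym N x) x≢N
        where
        ≡ᵇ-sym : ∀ a b → (a ≡ᵇ b) ≡ (b ≡ᵇ a)
        ≡ᵇ-sym zero zero = refl
        ≡ᵇ-sym zero (suc b) = refl
        ≡ᵇ-sym (suc a) zero = refl
        ≡ᵇ-sym (suc a) (suc b) = ≡ᵇ-sym a b

      init : J (4 + m * (8 + d) + c) (run (x := const 0) s)
      init = 0 , m , c , refl , ≤-refl , update-at (regs s) x 0 ,
        trans (off (regs s) x 0 N N≢x) sN≡m , i₀

      loop : ∀ {c s} → J c s →
        (⟦_⟧ᵗ W (reg x <' reg N) s ≡ false × ∃ λ r → 4 + r ≤ c × Q r s) ⊎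
        (⟦_⟧ᵗ W (reg x <' reg N) s ≡ true × ∃ λ c′ → 4 + c′ ≤ c ×
          Runs (body ⨟ x := (reg x ⊕ const 1)) s c′ J)
      loop {c} {s} (k , zero , c′ , eq , le , sx , sN , i) = inj₁
        ( dec-false (regs s x <? regs s N) (λ lt → <-irrefl (trans sx (trans (trans (sym (+-identityʳ k)) eq) (sym sN))) lt)
        , c′ , le , fin sN (subst (λ z → I z c′ s) (trans (sym (+-identityʳ k)) eq) i) )
      loop {c} {s} (k , suc j , c′ , eq , le , sx , sN , i) = inj₂
        ( dec-true (regs s x <? regs s N) (subst₂ _<_ (sym sx) (sym sN) k<m)
        , d + c′ + (8 + j * (8 + d)) , le₁ , body-runs )
        where
        k<m : k < m
        k<m = subst (k <_) eq (m<m+n k z<s)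

        le₁ : 4 + (d + c′ + (8 + j * (8 + d))) ≤ c
        le₁ = ≤-trans (≤-reflexive (lem d c′ (j * (8 + d)))) le
          where
          lem : ∀ d c′ y → 4 + (d + c′ + (8 + y)) ≡ 4 + ((8 + d) + y) + c′
          lem = solve-∀

        body-runs : Runs (body ⨟ x := (reg x ⊕ const 1)) s (d + c′ + (8 + j * (8 + d))) J
        body-runs with framed (step k<m sx sN i)
        ... | t , s′ , D , r , le′ , fr , i′ =
          _⨟ᴿ_ {Q = λ r′ s″ → r′ ≡ r + (8 + j * (8 + d)) × s″ ≡ s′}
          (t , s′ , D , r + (8 + j * (8 + d)) ,
            ≤-trans (≤-reflexive (sym (+-assoc t r _))) (+-monoˡ-≤ (8 + j * (8 + d)) le′) , refl , refl)
          λ { (refl , refl) → straight (x := (reg x ⊕ const 1)) {r = r + (4 + j * (8 + d))} refl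
                   (≤-reflexive (lem r (j * (8 + d))))
                   ( suc k , j , r , trans (sym (+-suc k j)) eq , ≤-reflexive (+-comm _ r)
                   , trans (update-at (regs s′) x _) x≡
                   , trans (off (regs s′) x _ N N≢x) (trans (regs≡ fr N wN) sN)
                   , subst (λ z → I (suc k) r (record s′ { regs = regs s′ [ x ↦ z ] })) (sym x≡) i′ ) }
          where
          x≡ : regs s′ x + 1 ≡ suc k
          x≡ = trans (cong (_+ 1) (trans (regs≡ fr x wx) sx)) (+-comm k 1)
          lem : ∀ r y → 4 + (r + (4 + y)) ≡ r + (8 + y)
          lem = solve-∀

    straight-then : ∀ p {q s r c Q} → loopFree p ≡ true → duration p + r ≤ c →
      Runs q (run p s) r Q → Runs (p ⨟ q) s c Q
    straight-then p {s = s} {r} lf le h =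
      _⨟ᴿ_ {Q = λ r′ s′ → r′ ≡ r × s′ ≡ run p s} (straight p lf le (refl , refl)) λ { (refl , refl) → h }

    ==-true : ∀ {a b} → does (a ≟ b) ≡ true → a ≡ b
    ==-true {a} {b} = does-true (a ≟ b)

    ==-false : ∀ {a b} → does (a ≟ b) ≡ false → a ≢ b
    ==-false {a} {b} = does-false (a ≟ b)

-- The multigraph of requisitions and the structure of its perfect matchings.

module Graph where

  open import Data.Bool.Properties using (∨-zeroʳ)
  open import Data.Empty using (⊥)
  open import Data.Fin.Base using (punchOut)
  open import Data.Fin.Properties using (punchOut-injective; injective⇒≤; any?) renaming (_≟_ to _≟ᶠ_)
  open import Function.Base using (_∘_)
  open import Function.Definitions using (Injective)

  split : ∀ b → b ≡ true ⊎ b ≡ false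
  split true = inj₁ refl
  split false = inj₂ refl

  -- Pigeonhole: a missed value could be punched out of the codomain, leaving an injection into a
  -- smaller set.
  injective⇒hits : ∀ {n} (f : Fin n → Fin n) → Injective _≡_ _≡_ f → ∀ y → ∃ λ x → f x ≡ y
  injective⇒hits {zero} f inj ()
  injective⇒hits {suc n} f inj y with any? (λ x → f x ≟ᶠ y)
  ... | yes p = p
  ... | no ¬p = contradiction (injective⇒≤ {f = λ x → punchOut (missed x)}
                  (λ {a} {b} eq → inj (punchOut-injective (missed a) (missed b) eq))) 1+n≰n
    where
    missed : ∀ x → y ≢ f x
    missed x eq = ¬p (x , sym eq)

  _⟨_≔_⟩ : ∀ {n} {A : Set} → (Fin n → A) → Fin n → A → (Fin n → A)
  (f ⟨ i ≔ v ⟩) j = if does (j ≟ᶠ i) then v else f j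

  set-at : ∀ {n} {A : Set} (f : Fin n → A) i {v} → (f ⟨ i ≔ v ⟩) i ≡ v
  set-at f i rewrite dec-true (i ≟ᶠ i) refl = refl

  set-off : ∀ {n} {A : Set} (f : Fin n → A) i {v j} → j ≢ i → (f ⟨ i ≔ v ⟩) j ≡ f j
  set-off f i {j = j} j≢i rewrite dec-false (j ≟ᶠ i) j≢i = refl

  total : ∀ {n} → (Fin n → ℕ) → ℕ
  total {zero} f = 0
  total {suc n} f = f zero + total (f ∘ suc)

  total-cong : ∀ {n} {f g : Fin n → ℕ} → (∀ i → f i ≡ g i) → total f ≡ total g
  total-cong {zero} eq = refl
  total-cong {suc n} eq = cong₂ _+_ (eq zero) (total-cong (eq ∘ suc))

  total-zero : ∀ {n} {f : Fin n → ℕ} → (∀ i → f i ≡ 0) → total f ≡ 0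
  total-zero {zero} eq = refl
  total-zero {suc n} eq rewrite eq zero = total-zero (eq ∘ suc)

  term≤total : ∀ {n} (f : Fin n → ℕ) i → f i ≤ total f
  term≤total f zero = m≤m+n _ _
  term≤total f (suc i) = ≤-trans (term≤total (f ∘ suc) i) (m≤n+m _ (f zero))

  -- Both sides consist of the common part and the two values at `i`. Adding the values instead of
  -- subtracting them avoids truncation.
  total-change : ∀ {n} (f g : Fin n → ℕ) i → (∀ j → j ≢ i → f j ≡ g j) →
    g i + total f ≡ f i + total g
  total-change f g zero eq = begin
    g zero + (f zero + total (f ∘ suc)) ≡⟨ cong (λ z → g zero + (f zero + z)) (total-cong λ j → eq (suc j) λ ()) ⟩
    g zero + (f zero + total (g ∘ suc)) ≡⟨ +-assoc (g zero) _ _ ⟨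
    g zero + f zero + total (g ∘ suc)   ≡⟨ cong (_+ total (g ∘ suc)) (+-comm (g zero) (f zero)) ⟩
    f zero + g zero + total (g ∘ suc)   ≡⟨ +-assoc (f zero) _ _ ⟩
    f zero + (g zero + total (g ∘ suc)) ∎
    where open ≡-Reasoning
  total-change f g (suc i) eq = begin
    g (suc i) + (f zero + total (f ∘ suc)) ≡⟨ swap (g (suc i)) (f zero) _ ⟩
    f zero + (g (suc i) + total (f ∘ suc)) ≡⟨ cong₂ _+_ (eq zero λ ()) (total-change (f ∘ suc) (g ∘ suc) i λ j j≢i → eq (suc j) λ { refl → j≢i refl }) ⟩
    g zero + (f (suc i) + total (g ∘ suc)) ≡⟨ swap (g zero) (f (suc i)) _ ⟩
    f (suc i) + (g zero + total (g ∘ suc)) ∎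
    where
    open ≡-Reasoning
    swap : ∀ a b c → a + (b + c) ≡ b + (a + c)
    swap a b c = trans (sym (+-assoc a b c)) (trans (cong (_+ c) (+-comm a b)) (+-assoc b a c))

  total-split : ∀ {n} (f : Fin n → ℕ) i → total f ≡ f i + total (f ⟨ i ≔ 0 ⟩)
  total-split f i = subst (λ z → z + total f ≡ f i + total (f ⟨ i ≔ 0 ⟩)) (set-at f i)
    (total-change f (f ⟨ i ≔ 0 ⟩) i λ j j≢i → sym (set-off f i j≢i))

  total-single : ∀ {n} (f : Fin n → ℕ) i → (∀ j → j ≢ i → f j ≡ 0) → total f ≡ f i
  total-single {n} f i off = trans (total-change f (λ _ → 0) i off)
    (trans (cong (f i +_) (total-zero {f = λ (_ : Fin n) → 0} λ _ → refl)) (+-identityʳ (f i)))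

  total-pair : ∀ {n} (f : Fin n → ℕ) i j → j ≢ i → (∀ k → k ≢ i → k ≢ j → f k ≡ 0) → total f ≡ f i + f j
  total-pair f i j j≢i off = trans (total-split f i) (cong (f i +_)
    (trans (total-single (f ⟨ i ≔ 0 ⟩) j zero-off) (set-off f i j≢i)))
    where
    zero-off : ∀ k → k ≢ j → (f ⟨ i ≔ 0 ⟩) k ≡ 0
    zero-off k k≢j with k ≟ᶠ i
    ... | yes _ = refl
    ... | no k≢i = off k k≢i k≢j

  total-nonzero : ∀ {n} (f : Fin n → ℕ) → total f ≢ 0 → ∃ λ i → f i ≢ 0
  total-nonzero f t≢0 with any? (λ i → 1 ≤? f i)
  ... | yes (i , 1≤) = i , λ eq → 1+n≰n (subst (1 ≤_) eq 1≤)
  ... | no ¬p = contradiction (total-zero λ i → n≤0⇒n≡0 (≤-pred (≰⇒> λ 1≤ → ¬p (i , 1≤)))) t≢0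

  module Incidence {n : ℕ} (fst snd : Fin n → Fin n) where

    inc : Fin n → Fin n → Bool
    inc i x = does (x ≟ᶠ fst i) ∨ does (x ≟ᶠ snd i)

    End : Fin n → Fin n → Set
    End i x = x ≡ fst i ⊎ x ≡ snd i

    inc⁺ : ∀ {i x} → End i x → inc i x ≡ true
    inc⁺ {i} {x} (inj₁ eq) rewrite dec-true (x ≟ᶠ fst i) eq = refl
    inc⁺ {i} {x} (inj₂ eq) rewrite dec-true (x ≟ᶠ snd i) eq = ∨-zeroʳ _

    inc⁻ : ∀ {i x} → inc i x ≡ true → End i x
    inc⁻ {i} {x} t with x ≟ᶠ fst i | x ≟ᶠ snd i
    ... | yes p | _ = inj₁ p
    ... | no _  | yes p = inj₂ p
    inc⁻ {i} {x} () | no _ | no _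

    ¬inc : ∀ {i x} → x ≢ fst i → x ≢ snd i → inc i x ≡ false
    ¬inc {i} {x} p q rewrite dec-false (x ≟ᶠ fst i) p | dec-false (x ≟ᶠ snd i) q = refl

    term : (Fin n → ℕ) → (Fin n → Bool) → Fin n → Fin n → ℕ
    term c alive x i = if alive i ∧ inc i x then c i else 0

    -- The two instances that matter are `c = 1`, the degree, and `c = toℕ`, the sum of the numbers
    -- of the incident live edges. A loop contributes once, since `inc` is a disjunction.
    load : (Fin n → ℕ) → (Fin n → Bool) → Fin n → ℕ
    load c alive x = total (term c alive x)

    degree : (Fin n → Bool) → Fin n → ℕ
    degree = load (λ _ → 1)

    size : (Fin n → Bool) → ℕ
    size alive = total (λ i → if alive i then 1 else 0)

    term-on : ∀ {c alive x i} → alive i ≡ true → End i x → term c alive x i ≡ c i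
    term-on {x = x} a e rewrite a | inc⁺ {x = x} e = refl

    term-off : ∀ {c alive x i} → (alive i ≡ true → End i x → c i ≡ 0) → term c alive x i ≡ 0
    term-off {alive = alive} {x} {i} h with alive i in eq | inc i x in eq₂
    ... | true  | true  = h refl (inc⁻ eq₂)
    ... | true  | false = refl
    ... | false | _     = refl

    term₁-nonzero : ∀ {alive x i} → term (λ _ → 1) alive x i ≢ 0 → alive i ≡ true × End i x
    term₁-nonzero {alive} {x} {i} nz with alive i in eq | inc i x in eq₂
    ... | true  | true  = refl , inc⁻ eq₂
    ... | true  | false = contradiction refl nz
    ... | false | _     = contradiction refl nz

    -- Read forwards when edges are entered into the tables, and backwards when they are peeled or
    -- visited.
    record Extends (alive alive⁺ : Fin n → Bool) (i : Fin n) : Set where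
      field
        before : alive i ≡ false
        after  : alive⁺ i ≡ true
        others : ∀ j → j ≢ i → alive⁺ j ≡ alive j

    module _ {alive alive⁺ i} (E : Extends alive alive⁺ i) where
      open Extends E

      load-extend : ∀ c x → load c alive⁺ x ≡ (if inc i x then c i else 0) + load c alive x
      load-extend c x = trans (cong (_+ load c alive⁺ x) (sym t₀))
        (trans (total-change (term c alive⁺ x) (term c alive x) i
                 λ j j≢i → cong (λ b → if b ∧ inc j x then c j else 0) (others j j≢i))
          (cong (_+ load c alive x) t₁))
        where
        t₀ : term c alive x i ≡ 0
        t₀ rewrite before = refl
        t₁ : term c alive⁺ x i ≡ (if inc i x then c i else 0)
        t₁ rewrite after = refl

      size-extend : size alive⁺ ≡ suc (size alive)
      size-extend = trans (cong (_+ size alive⁺) (sym t₀))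
        (trans (total-change _ _ i λ j j≢i → cong (λ b → if b then 1 else 0) (others j j≢i))
          (cong (_+ size alive) t₁))
        where
        t₀ : (if alive i then 1 else 0) ≡ 0
        t₀ rewrite before = refl
        t₁ : (if alive⁺ i then 1 else 0) ≡ 1
        t₁ rewrite after = refl

    module _ {alive : Fin n → Bool} {x : Fin n} where

      private
        unit : Fin n → ℕ
        unit = term (λ _ → 1) alive x

      degree-split : ∀ {i} → alive i ≡ true → End i x →
        degree alive x ≡ suc (total (unit ⟨ i ≔ 0 ⟩))
      degree-split {i} a e = trans (total-split unit i) (cong (_+ total (unit ⟨ i ≔ 0 ⟩)) (term-on {λ _ → 1} {alive} a e))

      degree-one : degree alive x ≡ 1 →
        ∃ λ i → alive i ≡ true × End i x × (∀ j → alive j ≡ true → End j x → j ≡ i)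
      degree-one d≡1 with total-nonzero unit (λ eq → 1+n≢0 (trans (sym d≡1) eq))
      ... | i , nz with term₁-nonzero {alive} nz
      ... | a , e = i , a , e , unique
        where
        rest≡0 : total (unit ⟨ i ≔ 0 ⟩) ≡ 0
        rest≡0 = suc-injective (trans (sym (degree-split a e)) d≡1)
        unique : ∀ j → alive j ≡ true → End j x → j ≡ i
        unique j aj ej with j ≟ᶠ i
        ... | yes eq = eq
        ... | no j≢i = contradiction
          (subst₂ _≤_ (trans (set-off unit i j≢i) (term-on {λ _ → 1} {alive} aj ej)) rest≡0 (term≤total (unit ⟨ i ≔ 0 ⟩) j)) 1+n≰n

      another : ∀ {i} → degree alive x ≢ 1 → alive i ≡ true → End i x →
        ∃ λ j → j ≢ i × alive j ≡ true × End j x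
      another {i} d≢1 a e with total-nonzero (unit ⟨ i ≔ 0 ⟩) (λ eq → d≢1 (trans (degree-split a e) (cong suc eq)))
      ... | j , nz = j , j≢i , term₁-nonzero {alive} (λ eq → nz (trans (set-off unit i j≢i) eq))
        where
        j≢i : j ≢ i
        j≢i eq = nz (trans (cong (unit ⟨ i ≔ 0 ⟩) eq) (set-at unit i))

    -- Injectivity suffices for a perfect matching, both sides having `n` elements.
    Matching : (Fin n → Fin n) → Set
    Matching f = Injective _≡_ _≡_ f × (∀ i → End i (f i))

    -- The interface between peeling and walking: the order of the removals is forgotten. `forced`
    -- compares arbitrary matchings, so it does not depend on how the removed edges were found.
    record Peeled (alive : Fin n → Bool) : Set where
      field
        stuck   : ∀ x → degree alive x ≢ 1
        forced  : ∀ e → alive e ≡ false → ∀ f f′ → Matching f → Matching f′ → f e ≡ f′ e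
        cleared : ∀ e → alive e ≡ false → ∀ f → Matching f → degree alive (f e) ≡ 0

    module Cycles {alive : Fin n → Bool} (P : Peeled alive) {f₀ : Fin n → Fin n} (M₀ : Matching f₀) where
      open Peeled P

      f₀-injective : Injective _≡_ _≡_ f₀
      f₀-injective = proj₁ M₀

      opposite : Fin n → Fin n
      opposite e = if does (f₀ e ≟ᶠ fst e) then snd e else fst e

      -- A second matching, taking on each live edge the end that `f₀` leaves out. Its injectivity
      -- only follows once `κ` is known to be a permutation.
      g : Fin n → Fin n
      g e = if alive e then opposite e else f₀ e

      g-dead : ∀ {e} → alive e ≡ false → g e ≡ f₀ e
      g-dead eq rewrite eq = refl

      private
        g-alive : ∀ {e} → alive e ≡ true →
          (f₀ e ≡ fst e × g e ≡ snd e) ⊎ (f₀ e ≡ snd e × g e ≡ fst e)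
        g-alive {e} a rewrite a with f₀ e ≟ᶠ fst e
        ... | yes eq = inj₁ (eq , refl)
        ... | no neq with proj₂ M₀ e
        ...   | inj₁ eq = contradiction eq neq
        ...   | inj₂ eq = inj₂ (eq , refl)

      g-end : ∀ e → End e (g e)
      g-end e with alive e in eq
      ... | false = proj₂ M₀ e
      ... | true with f₀ e ≟ᶠ fst e
      ...   | yes _ = inj₂ refl
      ...   | no _  = inj₁ refl

      ends-sum : ∀ {e} → alive e ≡ true → toℕ (fst e) + toℕ (snd e) ≡ toℕ (f₀ e) + toℕ (g e)
      ends-sum {e} a with g-alive a
      ... | inj₁ (p , q) rewrite p | q = refl
      ... | inj₂ (p , q) rewrite p | q = +-comm (toℕ (fst e)) _

      fst-f₀-or-g : ∀ e → alive e ≡ true → fst e ≡ f₀ e ⊎ fst e ≡ g e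
      fst-f₀-or-g e a with g-alive a
      ... | inj₁ (p , q) = inj₁ (sym p)
      ... | inj₂ (p , q) = inj₂ (sym q)

      only-ends : ∀ {e x} → alive e ≡ true → End e x → x ≡ f₀ e ⊎ x ≡ g e
      only-ends a e with g-alive a | e
      ... | inj₁ (p , q) | inj₁ r = inj₁ (trans r (sym p))
      ... | inj₁ (p , q) | inj₂ r = inj₂ (trans r (sym q))
      ... | inj₂ (p , q) | inj₁ r = inj₂ (trans r (sym q))
      ... | inj₂ (p , q) | inj₂ r = inj₁ (trans r (sym p))

      complete : ∀ {f} → Matching f → ∀ e → f e ≡ f₀ e ⊎ f e ≡ g e
      complete {f} M e with alive e in eq
      ... | false = inj₁ (forced e eq f f₀ M M₀)
      ... | true  = subst (λ z → f e ≡ f₀ e ⊎ f e ≡ z) (cong (λ b → if b then opposite e else f₀ e) eq)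
                      (only-ends eq (proj₂ M e))

      private
        -- `stuck` yields a second live edge `j` at `f₀ e`. Since `f₀` is injective it matches `j`
        -- elsewhere, so `f₀ e` is the end of `j` taken by `g`. Dead edges are their own partners,
        -- which makes the map total.
        partner : ∀ e → ∃ λ j → (alive e ≡ true → j ≢ e × alive j ≡ true × g j ≡ f₀ e)
                              × (alive e ≡ false → j ≡ e)
        partner e with alive e in eq
        ... | false = e , (λ ()) , λ _ → refl
        ... | true with another (stuck (f₀ e)) eq (proj₂ M₀ e)
        ...   | j , j≢e , aj , ej = j , (λ _ → j≢e , aj , gj) , λ ()
          where
          gj : g j ≡ f₀ e
          gj with only-ends aj ej
          ... | inj₁ p = contradiction (sym (f₀-injective p)) j≢e
          ... | inj₂ p = sym p

      -- The step along a cycle through the vertex `f₀ e`. As `g (κ e)` gives back `f₀ e`, it is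
      -- injective, hence a permutation; its inverse `ν` steps through the vertex `g e`.
      κ : Fin n → Fin n
      κ e = proj₁ (partner e)

      κ-dead : ∀ {e} → alive e ≡ false → κ e ≡ e
      κ-dead {e} = proj₂ (proj₂ (partner e))

      κ-moves : ∀ {e} → alive e ≡ true → κ e ≢ e
      κ-moves {e} a = proj₁ (proj₁ (proj₂ (partner e)) a)

      κ-alive : ∀ {e} → alive e ≡ true → alive (κ e) ≡ true
      κ-alive {e} a = proj₁ (proj₂ (proj₁ (proj₂ (partner e)) a))

      g-κ : ∀ e → g (κ e) ≡ f₀ e
      g-κ e with split (alive e)
      ... | inj₁ eq = proj₂ (proj₂ (proj₁ (proj₂ (partner e)) eq))
      ... | inj₂ eq = trans (cong g (κ-dead eq)) (g-dead eq)

      κ-injective : Injective _≡_ _≡_ κ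
      κ-injective {e} {e′} eq = f₀-injective (trans (sym (g-κ e)) (trans (cong g eq) (g-κ e′)))

      ν : Fin n → Fin n
      ν e = proj₁ (injective⇒hits κ κ-injective e)

      κ-ν : ∀ e → κ (ν e) ≡ e
      κ-ν e = proj₂ (injective⇒hits κ κ-injective e)

      ν-κ : ∀ e → ν (κ e) ≡ e
      ν-κ e = κ-injective (κ-ν (κ e))

      f₀-ν : ∀ e → f₀ (ν e) ≡ g e
      f₀-ν e = trans (sym (g-κ (ν e))) (cong g (κ-ν e))

      ν-dead : ∀ {e} → alive e ≡ false → ν e ≡ e
      ν-dead {e} d = κ-injective (trans (κ-ν e) (sym (κ-dead d)))

      ν-alive : ∀ {e} → alive e ≡ true → alive (ν e) ≡ true
      ν-alive {e} a with split (alive (ν e))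
      ... | inj₁ eq = eq
      ... | inj₂ eq = trans (cong alive (trans (sym (κ-dead eq)) (κ-ν e))) a

      alive-ν : ∀ e → alive (ν e) ≡ alive e
      alive-ν e with split (alive e)
      ... | inj₁ eq = trans (ν-alive eq) (sym eq)
      ... | inj₂ eq = cong alive (ν-dead eq)

      -- Equality would make `e` a fixed point of `ν`, hence of `κ`, which moves every live edge. In
      -- particular no live edge is a loop.
      g≢f₀ : ∀ {e} → alive e ≡ true → g e ≢ f₀ e
      g≢f₀ {e} a eq = κ-moves a (trans (cong κ (sym (f₀-injective (trans (f₀-ν e) eq)))) (κ-ν e))

      g-injective : Injective _≡_ _≡_ g
      g-injective {e} {e′} eq = trans (sym (κ-ν e)) (trans (cong κ
        (f₀-injective (trans (f₀-ν e) (trans eq (sym (f₀-ν e′)))))) (κ-ν e′))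

      -- At f₀ e exactly the edges e and κ e are alive.
      load-f₀ : ∀ {e} → alive e ≡ true → load toℕ alive (f₀ e) ≡ toℕ e + toℕ (κ e)
      load-f₀ {e} a = trans
        (total-pair (term toℕ alive (f₀ e)) e (κ e) (κ-moves a) λ k k≢e k≢κ →
          term-off {toℕ} {alive} λ ak ek → contradiction ek (λ ek → no-other k k≢e k≢κ ak ek))
        (cong₂ _+_ (term-on {toℕ} {alive} a (proj₂ M₀ e))
          (term-on {toℕ} {alive} (κ-alive a) (subst (End (κ e)) (g-κ e) (g-end (κ e)))))
        where
        no-other : ∀ k → k ≢ e → k ≢ κ e → alive k ≡ true → End k (f₀ e) → ⊥
        no-other k k≢e k≢κ ak ek with only-ends ak ek
        ... | inj₁ p = k≢e (sym (f₀-injective p))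
        ... | inj₂ p = k≢κ (g-injective (trans (sym p) (sym (g-κ e))))

      -- A set of edges constant along `ν`, that is, a union of cycles and of dead edges.
      Invariant : (Fin n → Bool) → Set
      Invariant h = ∀ e → h (ν e) ≡ h e

      flip : (Fin n → Bool) → Fin n → Fin n
      flip h e = if h e then g e else f₀ e

      -- Two edges `d`, `e` treated differently could only collide in `f₀ d = g e = f₀ (ν e)`, which
      -- forces `d = ν e`; but invariance treats `ν e` like `e`.
      flip-matching : ∀ {h} → Invariant h → Matching (flip h)
      flip-matching {h} inv = inj , ends
        where
        ends : ∀ e → End e (flip h e)
        ends e with h e
        ... | true = g-end e
        ... | false = proj₂ M₀ e
        clash : ∀ {d e} → h d ≡ false → h e ≡ true → f₀ d ≢ g e
        clash {d} {e} hd he eq with f₀-injective (trans eq (sym (f₀-ν e)))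
        ... | refl with trans (sym hd) (trans (inv e) he)
        ... | ()
        inj : Injective _≡_ _≡_ (flip h)
        inj {d} {e} eq with h d in hd | h e in he
        ... | true  | true  = g-injective eq
        ... | false | false = f₀-injective eq
        ... | false | true  = contradiction eq (clash hd he)
        ... | true  | false = contradiction (sym eq) (clash he hd)

      side : (Fin n → Fin n) → Fin n → Bool
      side f e = not (does (f e ≟ᶠ f₀ e))

      flip-side : ∀ {f} → Matching f → ∀ e → flip (side f) e ≡ f e
      flip-side {f} M e with f e ≟ᶠ f₀ e
      ... | yes p = sym p
      ... | no p with complete M e
      ...   | inj₁ q = contradiction q p
      ...   | inj₂ q = sym q

      -- The edges `e` and `ν e` share the vertex `g e = f₀ (ν e)`. If `f` took `g` on `e` and `f₀`
      -- on `ν e`, this vertex would be used twice; in the opposite case no edge would cover it,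
      -- although `f` is onto.
      side-invariant : ∀ {f} → Matching f → Invariant (side f)
      side-invariant {f} M e with split (alive e)
      ... | inj₂ eq = cong (side f) (ν-dead eq)
      ... | inj₁ eq with f e ≟ᶠ f₀ e | f (ν e) ≟ᶠ f₀ (ν e)
      ...   | yes p | yes q = refl
      ...   | no p  | no q  = refl
      ...   | no p  | yes q with complete M e
      ...     | inj₁ r = contradiction r p
      ...     | inj₂ r = contradiction (trans (cong κ (sym (proj₁ M (trans q (trans (f₀-ν e) (sym r)))))) (κ-ν e)) (κ-moves eq)
      side-invariant {f} M e | inj₁ eq | yes p | no q
        with injective⇒hits f (proj₁ M) (g e)
      ... | d , fd with complete M d
      ...   | inj₁ r = contradiction (subst (λ z → f z ≡ f₀ z) (f₀-injective (trans (sym r) (trans fd (sym (f₀-ν e))))) r) q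
      ...   | inj₂ r = contradiction (trans (sym fd) (trans (cong f (g-injective (trans (sym r) fd))) p)) (g≢f₀ eq)

      -- A set of edges closed under ν is also closed under its inverse, by finiteness.
      closed⇒invariant : ∀ {h : Fin n → Bool} (π : Fin n → Fin n) → Injective _≡_ _≡_ π →
        (∀ e → h e ≡ true → h (π e) ≡ true) → ∀ e → h (π e) ≡ h e
      closed⇒invariant {h} π π-inj closed e with h e in he
      ... | true = closed e he
      ... | false with h (π e) in hπ
      ...   | false = refl
      ...   | true = contradiction (trans (sym he) (trans (cong h (sym d≡e)) hd)) λ ()
        where
        -- `ψ` is `π` on the set and the identity outside; closedness makes it injective, so it hits
        -- `π e`. A preimage outside the set would be `π e` itself, which lies in the set; a
        -- preimage inside is `e`, by injectivity of `π`.
        ψ : Fin n → Fin n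
        ψ d = if h d then π d else d
        ψ-injective : Injective _≡_ _≡_ ψ
        ψ-injective {a} {b} eq with h a in ha | h b in hb
        ... | true  | true  = π-inj eq
        ... | false | false = eq
        ... | true  | false = contradiction (trans (sym hb) (trans (cong h (sym eq)) (closed a ha))) λ ()
        ... | false | true  = contradiction (trans (sym ha) (trans (cong h eq) (closed b hb))) λ ()
        d : Fin n
        d = proj₁ (injective⇒hits ψ ψ-injective (π e))
        both : h d ≡ true × d ≡ e
        both with h d in hd | proj₂ (injective⇒hits ψ ψ-injective (π e))
        ... | true  | eq = refl , π-inj eq
        ... | false | eq = contradiction (trans (sym hd) (trans (cong h eq) hπ)) λ ()
        hd : h d ≡ true
        hd = proj₁ both
        d≡e : d ≡ e
        d≡e = proj₂ both

-- The program for the first phase, and the tables of degrees and sums.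

module Loads where

  open Ram
  open Graph
  open import Data.Fin.Base using (fromℕ<)
  open import Data.Fin.Properties using (toℕ-injective; toℕ<n; toℕ-fromℕ<) renaming (_≟_ to _≟ᶠ_)

  -- aSum holds, for each vertex, the sum of the live edges at it: this names the edge
  -- when there is only one, and the partner of a known edge when there are two.
  aFst aSnd aOut aDeg aSum aDone aM₀ aM₁ aBlk : Name
  aFst = 0
  aSnd = 1
  aOut = 2
  aDeg = 3
  aSum = 4
  aDone = 5
  aM₀ = 6
  aM₁ = 7
  aBlk = 8

  rN rI rV rE rU rB : Name
  rN = 0
  rI = 1
  rV = 2
  rE = 3
  rU = 4
  rB = 5

  buildBody peelStep peelBody walkStep walkBody build peel walk phase₁ : Program

  buildBody =
    (rV := aFst at reg rI ⨟
     rU := aSnd at reg rI ⨟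
     aDeg [ reg rV ]:= aDeg at reg rV ⊕ const 1 ⨟
     aSum [ reg rV ]:= aSum at reg rV ⊕ reg rI) ⨟
    -- A loop is entered once only, so that a vertex with nothing but a loop has degree 1 and is
    -- peeled.
    branch (reg rV == reg rU) skip (
      aDeg [ reg rU ]:= aDeg at reg rU ⊕ const 1 ⨟
      aSum [ reg rU ]:= aSum at reg rU ⊕ reg rI)

  peelStep =
    rE := aSum at reg rV ⨟
    -- Sum of both ends minus the near one: the far end without a case distinction, and `rV` again
    -- for a loop.
    rU := aFst at reg rE ⊕ aSnd at reg rE ⊖ reg rV ⨟
    aM₀ [ reg rE ]:= reg rV ⨟
    aM₁ [ reg rE ]:= reg rV ⨟
    aDone [ reg rE ]:= const 1 ⨟
    -- The near end is cleared before the far end is reduced. For a loop both are the same cell, and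
    -- truncated subtraction then leaves 0.
    aDeg [ reg rV ]:= const 0 ⨟
    aSum [ reg rV ]:= const 0 ⨟
    aDeg [ reg rU ]:= aDeg at reg rU ⊖ const 1 ⨟
    aSum [ reg rU ]:= aSum at reg rU ⊖ reg rE ⨟
    rV := reg rU

  peelBody = rV := reg rI ⨟ while (aDeg at reg rV == const 1) peelStep

  walkStep =
    rU := aFst at reg rE ⊕ aSnd at reg rE ⊖ reg rV ⨟
    aM₀ [ reg rE ]:= reg rV ⨟
    aM₁ [ reg rE ]:= reg rU ⨟
    aDone [ reg rE ]:= const 1 ⨟
    aBlk [ reg rE ]:= reg rB ⨟
    rV := reg rU ⨟
    rE := aSum at reg rU ⊖ reg rE

  walkBody = branch (aDone at reg rI == const 0)
    (rE := reg rI ⨟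
     rV := aFst at reg rI ⨟
     while (aDone at reg rE == const 0) walkStep ⨟
     rB := reg rB ⊕ const 1)
    skip

  build = for rI rN buildBody
  peel = for rI rN peelBody
  -- Label 0 stays with the forced edges, whose cells in `aBlk` keep their initial value.
  walk = rB := const 1 ⨟ for rI rN walkBody
  phase₁ = build ⨟ peel ⨟ walk

  record Rep {n : ℕ} (a : ℕ → ℕ) (φ : Fin n → ℕ) : Set where
    constructor rep
    field
      look : ∀ i → a (toℕ i) ≡ φ i
  open Rep public

  module _ {n : ℕ} where

    Rep-cong : ∀ {a} {φ ψ : Fin n → ℕ} → Rep a φ → (∀ i → φ i ≡ ψ i) → Rep a ψ
    Rep-cong r eq = rep λ i → trans (look r i) (eq i)

    Rep-set : ∀ {a k v} {φ : Fin n → ℕ} (j : Fin n) → Rep a φ → k ≡ toℕ j → Rep (a [ k ↦ v ]) (φ ⟨ j ≔ v ⟩)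
    Rep-set {a} {k} {v} {φ} j r refl = rep go
      where
      go : ∀ i → (a [ k ↦ v ]) (toℕ i) ≡ (φ ⟨ j ≔ v ⟩) i
      go i with i ≟ᶠ j
      ... | yes refl = update-at a (toℕ i) v
      ... | no i≢j = trans (update-off a v λ eq → i≢j (toℕ-injective eq)) (look r i)

    at-fin : ∀ {k} → k < n → ∃ λ (i : Fin n) → toℕ i ≡ k
    at-fin k<n = fromℕ< k<n , toℕ-fromℕ< k<n

    below : ℕ → Fin n → Bool
    below k i = does (toℕ i <? k)

  module Loading {n : ℕ} (fst snd : Fin n → Fin n) where
    open Incidence fst snd

    below-extends : ∀ (i : Fin n) → Extends (below (toℕ i)) (below (suc (toℕ i))) i
    below-extends i = record
      { before = dec-false (toℕ i <? toℕ i) (<-irrefl refl)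
      ; after = dec-true (toℕ i <? suc (toℕ i)) ≤-refl
      ; others = others }
      where
      others : ∀ j → j ≢ i → below (suc (toℕ i)) j ≡ below (toℕ i) j
      others j j≢i with toℕ j <? toℕ i
      ... | yes lt = trans (dec-true (toℕ j <? suc (toℕ i)) (m≤n⇒m≤1+n lt)) (sym (dec-true (toℕ j <? toℕ i) lt))
      ... | no ¬lt = trans (dec-false (toℕ j <? suc (toℕ i)) λ lt →
        ¬lt (≤∧≢⇒< (≤-pred lt) λ eq → j≢i (toℕ-injective eq))) (sym (dec-false (toℕ j <? toℕ i) ¬lt))

    module _ {a : ℕ → ℕ} {φ φ′ : Fin n → ℕ} {i : Fin n} {w p q : ℕ}
      (r : Rep a φ) (p≡ : p ≡ toℕ (fst i)) (q≡ : q ≡ toℕ (snd i))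
      (φ≡ : ∀ z → φ′ z ≡ (if inc i z then w else 0) + φ z) where

      private
        stays : ∀ {z} → z ≢ fst i → z ≢ snd i → φ z ≡ φ′ z
        stays {z} u v = sym (trans (φ≡ z) (cong (λ b → (if b then w else 0) + φ z) (¬inc u v)))
        grows : ∀ {z} → End i z → φ z + w ≡ φ′ z
        grows {z} e = sym (trans (φ≡ z) (trans (cong (λ b → (if b then w else 0) + φ z) (inc⁺ e)) (+-comm w _)))

      add-loop-at : p ≡ q → ∀ z → (a [ p ↦ a p + w ]) (toℕ z) ≡ φ′ z
      add-loop : p ≡ q → Rep (a [ p ↦ a p + w ]) φ′
      add-loop p≡q = rep (add-loop-at p≡q)

      add-loop-at p≡q z with z ≟ᶠ fst i
      ... | yes refl = trans (cong (a [ p ↦ a p + w ]) (sym p≡)) (trans (update-at a p _)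
            (trans (cong (_+ w) (trans (cong a p≡) (look r z))) (grows (inj₁ refl))))
      ... | no z≢ = trans (update-off a _ λ eq → z≢ (toℕ-injective (trans eq p≡))) (trans (look r z)
            (stays z≢ λ z≡ → z≢ (trans z≡ (toℕ-injective (trans (sym q≡) (trans (sym p≡q) p≡))))))

      add-edge-at : p ≢ q → ∀ z → (let a₁ = a [ p ↦ a p + w ] in a₁ [ q ↦ a₁ q + w ]) (toℕ z) ≡ φ′ z
      add-edge : p ≢ q → let a₁ = a [ p ↦ a p + w ] in Rep (a₁ [ q ↦ a₁ q + w ]) φ′
      add-edge p≢q = rep (add-edge-at p≢q)

      add-edge-at p≢q z with z ≟ᶠ snd i
      ... | yes refl = trans (cong (a₁ [ q ↦ a₁ q + w ]) (sym q≡)) (trans (update-at a₁ q _)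
            (trans (cong (_+ w) (trans (update-off a _ λ eq → p≢q (sym eq)) (trans (cong a q≡) (look r z)))) (grows (inj₂ refl))))
        where
        a₁ = a [ p ↦ a p + w ]
      ... | no z≢snd with z ≟ᶠ fst i
      ...   | yes refl = trans (update-off a₁ _ λ eq → z≢snd (toℕ-injective (trans eq q≡)))
              (trans (cong a₁ (sym p≡)) (trans (update-at a p _)
                (trans (cong (_+ w) (trans (cong a p≡) (look r z))) (grows (inj₁ refl)))))
        where
        a₁ = a [ p ↦ a p + w ]
      ...   | no z≢fst = trans (update-off a₁ _ λ eq → z≢snd (toℕ-injective (trans eq q≡)))
              (trans (update-off a _ λ eq → z≢fst (toℕ-injective (trans eq p≡))) (trans (look r z) (stays z≢fst z≢snd)))
        where
        a₁ = a [ p ↦ a p + w ]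

    -- Covers loops as well: with `u = v` the cleared cell remains 0 under truncated subtraction, as
    -- `φ′ v ≡ 0` demands. Otherwise the weight `w` is really contained in the cell of `u`.
    remove-edge : ∀ {a φ φ′ i w p q v u} → Rep a φ → p ≡ toℕ v → q ≡ toℕ u →
      (∀ z → φ z ≡ (if inc i z then w else 0) + φ′ z) →
      φ′ v ≡ 0 → End i u → (∀ {z} → End i z → z ≡ v ⊎ z ≡ u) →
      let a₁ = a [ p ↦ 0 ] in Rep (a₁ [ q ↦ a₁ q ∸ w ]) φ′
    remove-edge {a} {φ} {φ′} {i} {w} {p} {q} {v} {u} r refl refl φ≡ v≡0 eu only = rep go
      where
      not-inc : ∀ {z} → z ≢ v → z ≢ u → inc i z ≡ false
      not-inc {z} z≢v z≢u with inc i z in eq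
      ... | false = refl
      ... | true with only (inc⁻ eq)
      ...   | inj₁ e = contradiction e z≢v
      ...   | inj₂ e = contradiction e z≢u
      a₁ = a [ p ↦ 0 ]
      go : ∀ z → (a₁ [ q ↦ a₁ q ∸ w ]) (toℕ z) ≡ φ′ z
      go z with z ≟ᶠ u
      ... | yes refl with z ≟ᶠ v
      ...   | yes refl = trans (update-at a₁ q _) (trans (cong (_∸ w) (update-at a p 0)) (trans (0∸n≡0 w) (sym v≡0)))
      ...   | no z≢v = trans (update-at a₁ q _)
              (trans (cong (_∸ w) (trans (update-off a 0 λ eq → z≢v (toℕ-injective eq))
                (trans (look r z) (trans (φ≡ z) (cong (λ b → (if b then w else 0) + φ′ z) (inc⁺ eu))))))
                (m+n∸m≡n w _))
      go z | no z≢u with z ≟ᶠ v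
      ... | yes refl = trans (update-off a₁ _ λ eq → z≢u (toℕ-injective eq)) (trans (update-at a p 0) (sym v≡0))
      ... | no z≢v = trans (update-off a₁ _ λ eq → z≢u (toℕ-injective eq))
            (trans (update-off a 0 λ eq → z≢v (toℕ-injective eq))
            (trans (look r z) (trans (φ≡ z) (cong (λ b → (if b then w else 0) + φ′ z) (not-inc z≢v z≢u)))))

  module Build (W : WeightDomain) {n : ℕ} (fst snd : Fin n → Fin n) where
    open Logic W
    open Incidence fst snd
    open Loading fst snd

    record Input (s : State W) : Set where
      constructor input
      field
        size≡ : regs s rN ≡ n
        fst≡  : Rep (arrs s aFst) (λ i → toℕ (fst i))
        snd≡  : Rep (arrs s aSnd) (λ i → toℕ (snd i))
    open Input public

    record Loaded (alive : Fin n → Bool) (s : State W) : Set where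
      constructor loaded
      field
        inp  : Input s
        deg≡ : Rep (arrs s aDeg) (degree alive)
        sum≡ : Rep (arrs s aSum) (load toℕ alive)
    open Loaded public

    buildᴿ : ∀ {s c} → Input s → (∀ k → arrs s aDeg k ≡ 0) → (∀ k → arrs s aSum k ≡ 0) →
      Runs build s (6 + n * (8 + duration buildBody) + c) (λ r s′ → c ≤ r × Loaded (λ _ → true) s′)
    buildᴿ {s} {c} inp₀ d₀ s₀ = forᴿ {body = buildBody} I refl refl refl (size≡ inp₀)
      (≤-refl , loaded (input (size≡ inp₀) (fst≡ inp₀) (snd≡ inp₀))
        (rep λ x → trans (d₀ _) (sym (none (λ _ → 1) x)))
        (rep λ x → trans (s₀ _) (sym (none toℕ x))))
      body (λ _ (le , L) → le , final L)
      where
      I : ℕ → ℕ → State W → Set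
      I k r s = c ≤ r × Loaded (below k) s

      none : ∀ w x → load w (below 0) x ≡ 0
      none w x = total-zero {f = term w (below 0) x} λ i → refl

      all-below : ∀ (w : Fin n → ℕ) x → load w (below n) x ≡ load w (λ _ → true) x
      all-below w x = total-cong λ i → cong (λ b → if b ∧ inc i x then w i else 0) (dec-true (toℕ i <? n) (toℕ<n i))

      final : ∀ {s} → Loaded (below n) s → Loaded (λ _ → true) s
      final L = loaded (inp L) (Rep-cong (deg≡ L) (all-below _)) (Rep-cong (sum≡ L) (all-below _))

      body : ∀ {k r s} → k < n → regs s rI ≡ k → regs s rN ≡ n → I k r s →
        Runs buildBody s (duration buildBody + r)
          (λ r s′ → I (suc k) r (record s′ { regs = regs s′ [ rI ↦ suc k ] }))
      body {k} {r} {s} k<n sI sN (le , L) with at-fin k<n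
      ... | i , refl = straight-then first refl (≤-reflexive (+-assoc (duration first) _ r))
          (branchᴿ {p = skip} {q = second} {c′ = duration second + r} ≤-refl
            (λ t → straight skip {r = r} refl (+-monoˡ-≤ r {1} {duration second} (s≤s z≤n)) (le ,
               loaded (input sN (fst≡ (inp L)) (snd≡ (inp L)))
                 (add-loop (deg≡ L) p≡ q≡ (load-extend (below-extends i) (λ _ → 1)) (==-true t))
                 (subst (λ w → Rep (arrs s aSum [ p ↦ arrs s aSum p + w ]) (load toℕ (below (suc (toℕ i)))))
                    (sym sI) (add-loop (sum≡ L) p≡ q≡ (load-extend (below-extends i) toℕ) (==-true t)))))
            (λ t → straight second refl ≤-refl (le ,
               loaded (input sN (fst≡ (inp L)) (snd≡ (inp L)))
                 (add-edge (deg≡ L) p≡ q≡ (load-extend (below-extends i) (λ _ → 1)) (==-false t))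
                 (subst (λ w → let a₁ = arrs s aSum [ p ↦ arrs s aSum p + w ] in
                           Rep (a₁ [ q ↦ a₁ q + w ]) (load toℕ (below (suc (toℕ i)))))
                    (sym sI) (add-edge (sum≡ L) p≡ q≡ (load-extend (below-extends i) toℕ) (==-false t))))))
        where
        first second : Program
        first = rV := aFst at reg rI ⨟
          rU := aSnd at reg rI ⨟
          aDeg [ reg rV ]:= aDeg at reg rV ⊕ const 1 ⨟
          aSum [ reg rV ]:= aSum at reg rV ⊕ reg rI
        second = aDeg [ reg rU ]:= aDeg at reg rU ⊕ const 1 ⨟ aSum [ reg rU ]:= aSum at reg rU ⊕ reg rI
        p q : ℕ
        p = arrs s aFst (regs s rI)
        q = arrs s aSnd (regs s rI)
        p≡ : p ≡ toℕ (fst i)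
        p≡ = trans (cong (arrs s aFst) sI) (look (fst≡ (inp L)) i)
        q≡ : q ≡ toℕ (snd i)
        q≡ = trans (cong (arrs s aSnd) sI) (look (snd≡ (inp L)) i)

-- Peeling off the vertices of degree one.

module Peel where

  open Ram
  open Graph
  open Loads
  open import Data.Fin.Properties using (toℕ-injective; toℕ<n) renaming (_≟_ to _≟ᶠ_)

  module Peeling (W : WeightDomain) {n : ℕ} (fst snd : Fin n → Fin n)
    {f₀ : Fin n → Fin n} (M₀ : Incidence.Matching fst snd f₀) where
    open Logic W
    open Incidence fst snd
    open Loading fst snd
    open Build W fst snd

    far : Fin n → Fin n → Fin n
    far i v = if does (v ≟ᶠ fst i) then snd i else fst i

    far-sum : ∀ {i v} → End i v → toℕ (fst i) + toℕ (snd i) ∸ toℕ v ≡ toℕ (far i v)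
    far-sum {i} {v} e with v ≟ᶠ fst i | e
    ... | yes refl | _ = m+n∸m≡n (toℕ v) _
    ... | no v≢ | inj₁ eq = contradiction eq v≢
    ... | no v≢ | inj₂ refl = m+n∸n≡m (toℕ (fst i)) (toℕ v)

    far-end : ∀ {i v} → End i v → End i (far i v)
    far-end {i} {v} e with v ≟ᶠ fst i
    ... | yes _ = inj₂ refl
    ... | no _  = inj₁ refl

    near-or-far : ∀ {i v} → End i v → ∀ {z} → End i z → z ≡ v ⊎ z ≡ far i v
    near-or-far {i} {v} e ez with v ≟ᶠ fst i | e | ez
    ... | yes refl | _ | inj₁ p = inj₁ p
    ... | yes refl | _ | inj₂ p = inj₂ p
    ... | no v≢ | inj₁ eq | _ = contradiction eq v≢
    ... | no v≢ | inj₂ refl | inj₁ p = inj₂ p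
    ... | no v≢ | inj₂ refl | inj₂ p = inj₁ p

    -- Quantifying over all matchings says at once that a dead edge is forced and that memory holds
    -- the forced vertex; comparing two matchings with the same cell yields `forced`.
    record PeelState (alive : Fin n → Bool) (s : State W) : Set where
      field
        ldd   : Loaded alive s
        done≡ : Rep (arrs s aDone) (λ i → if alive i then 0 else 1)
        fix₀  : ∀ e → alive e ≡ false → ∀ f → Matching f → arrs s aM₀ (toℕ e) ≡ toℕ (f e)
        fix₁  : ∀ e → alive e ≡ false → ∀ f → Matching f → arrs s aM₁ (toℕ e) ≡ toℕ (f e)
        clear : ∀ e → alive e ≡ false → ∀ f → Matching f → degree alive (f e) ≡ 0
    open PeelState public

    same-arrays : ∀ {alive} {s s′ : State W} → PeelState alive s → regs s′ rN ≡ n → arrs s′ ≡ arrs s → PeelState alive s′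
    same-arrays {s = state _ _ _ _} {state _ _ _ _} P N≡ refl = record
      { ldd = loaded (input N≡ (fst≡ (inp (ldd P))) (snd≡ (inp (ldd P)))) (deg≡ (ldd P)) (sum≡ (ldd P))
      ; done≡ = done≡ P ; fix₀ = fix₀ P ; fix₁ = fix₁ P ; clear = clear P }

    -- The 5 is the price of the inner test, so that each removed edge pays for its whole round.
    peelCost : ℕ
    peelCost = 5 + duration peelStep

    module Step {alive v s} (P : PeelState alive s) (sV : regs s rV ≡ toℕ v)
      (d≡1 : degree alive v ≡ 1) where

      private
        found = degree-one {alive} {v} d≡1

      i : Fin n
      i = proj₁ found

      i-alive : alive i ≡ true
      i-alive = proj₁ (proj₂ found)

      i-end : End i v
      i-end = proj₁ (proj₂ (proj₂ found))

      i-unique : ∀ j → alive j ≡ true → End j v → j ≡ i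
      i-unique = proj₂ (proj₂ (proj₂ found))

      u : Fin n
      u = far i v

      alive′ : Fin n → Bool
      alive′ = alive ⟨ i ≔ false ⟩

      extends : Extends alive′ alive i
      extends = record { before = set-at alive i ; after = i-alive ; others = λ j j≢i → sym (set-off alive i j≢i) }

      degree-v : degree alive′ v ≡ 0
      degree-v = suc-injective (trans (sym (subst (λ b → degree alive v ≡ (if b then 1 else 0) + degree alive′ v)
        (inc⁺ i-end) (load-extend extends (λ _ → 1) v))) d≡1)

      sum-v : load toℕ alive v ≡ toℕ i
      sum-v = trans (total-single (term toℕ alive v) i λ j j≢i → term-off {toℕ} {alive} λ a e → contradiction (i-unique j a e) j≢i)
        (term-on {toℕ} {alive} i-alive i-end)

      load-v : load toℕ alive′ v ≡ 0
      load-v = +-cancelˡ-≡ (toℕ i) _ 0 (trans (sym (subst (λ b → load toℕ alive v ≡ (if b then toℕ i else 0) + load toℕ alive′ v)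
        (inc⁺ i-end) (load-extend extends toℕ v))) (trans sum-v (sym (+-identityʳ _))))

      -- Some edge `d` is matched with `v`. A dead `d` would contradict `clear`, as `v` still has
      -- degree 1; a live `d` is `i`, the only live edge at `v`.
      i-forced : ∀ f → Matching f → f i ≡ v
      i-forced f M with injective⇒hits f (proj₁ M) v
      ... | d , fd with split (alive d)
      ...   | inj₁ a = trans (cong f (sym (i-unique d a (subst (End d) fd (proj₂ M d))))) fd
      ...   | inj₂ a = contradiction (trans (sym d≡1) (trans (cong (degree alive) (sym fd)) (clear P d a f M))) λ ()

      degree-mono : ∀ x → degree alive x ≡ 0 → degree alive′ x ≡ 0
      degree-mono x eq = m+n≡0⇒n≡0 (if inc i x then 1 else 0) (trans (sym (load-extend extends (λ _ → 1) x)) eq)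

      degree-same : ∀ {x} → x ≢ v → x ≢ u → degree alive x ≡ degree alive′ x
      degree-same {x} x≢v x≢u with load-extend extends (λ _ → 1) x | split (inc i x)
      ... | eq | inj₂ p rewrite p = eq
      ... | eq | inj₁ p with near-or-far i-end (inc⁻ p)
      ...   | inj₁ q = contradiction q x≢v
      ...   | inj₂ q = contradiction q x≢u

      E U : ℕ
      E = arrs s aSum (regs s rV)
      U = arrs s aFst E + arrs s aSnd E ∸ regs s rV

      E≡ : E ≡ toℕ i
      E≡ = trans (cong (arrs s aSum) sV) (trans (look (sum≡ (ldd P)) v) sum-v)

      U≡ : U ≡ toℕ u
      U≡ = trans (cong₂ _∸_ (cong₂ _+_ (trans (cong (arrs s aFst) E≡) (look (fst≡ (inp (ldd P))) i))
                                       (trans (cong (arrs s aSnd) E≡) (look (snd≡ (inp (ldd P))) i))) sV)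
             (far-sum i-end)

      s′ : State W
      s′ = run peelStep s

      dead-cases : ∀ e → alive′ e ≡ false → e ≡ i ⊎ (e ≢ i × alive e ≡ false)
      dead-cases e a with e ≟ᶠ i
      ... | yes p = inj₁ p
      ... | no p  = inj₂ (p , a)

      fixed : ∀ {a} → (∀ e → alive e ≡ false → ∀ f → Matching f → a (toℕ e) ≡ toℕ (f e)) →
        ∀ e → alive′ e ≡ false → ∀ f → Matching f → (a [ E ↦ regs s rV ]) (toℕ e) ≡ toℕ (f e)
      fixed {a} h e d f M with dead-cases e d
      ... | inj₁ refl = trans (cong (a [ E ↦ regs s rV ]) (sym E≡)) (trans (update-at a E _)
                          (trans sV (cong toℕ (sym (i-forced f M)))))
      ... | inj₂ (e≢i , d′) = trans (update-off a _ λ eq → e≢i (toℕ-injective (trans eq E≡))) (h e d′ f M)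

      post : PeelState alive′ s′
      post = record
        { ldd = loaded
            (input (size≡ (inp (ldd P))) (fst≡ (inp (ldd P))) (snd≡ (inp (ldd P))))
            (remove-edge {i = i} (deg≡ (ldd P)) sV U≡ (load-extend extends (λ _ → 1))
              degree-v (far-end i-end) (near-or-far i-end))
            (remove-edge {i = i} (sum≡ (ldd P)) sV U≡
              (λ z → trans (load-extend extends toℕ z) (cong (λ w → (if inc i z then w else 0) + load toℕ alive′ z) (sym E≡)))
              load-v (far-end i-end) (near-or-far i-end))
        ; done≡ = Rep-cong (Rep-set i (done≡ P) E≡) done-cases
        ; fix₀ = fixed {arrs s aM₀} (fix₀ P)
        ; fix₁ = fixed {arrs s aM₁} (fix₁ P)
        ; clear = λ e d f M → clear′ e (dead-cases e d) f M
        }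
        where
        done-cases : ∀ e → ((λ i → if alive i then 0 else 1) ⟨ i ≔ 1 ⟩) e ≡ (if alive′ e then 0 else 1)
        done-cases e with e ≟ᶠ i
        ... | yes _ = refl
        ... | no _ = refl
        clear′ : ∀ e → e ≡ i ⊎ (e ≢ i × alive e ≡ false) → ∀ f → Matching f → degree alive′ (f e) ≡ 0
        clear′ e (inj₁ refl) f M = trans (cong (degree alive′) (i-forced f M)) degree-v
        clear′ e (inj₂ (_ , d)) f M = degree-mono (f e) (clear P e d f M)

    StuckBelow : ℕ → (Fin n → Bool) → Set
    StuckBelow k alive = ∀ x → toℕ x < k → degree alive x ≢ 1

    peeled : ∀ {alive s} → PeelState alive s → StuckBelow n alive → Peeled alive
    peeled P st = record
      { stuck = λ x → st x (toℕ<n x)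
      ; forced = λ e d f f′ M M′ → toℕ-injective (trans (sym (fix₀ P e d f M)) (fix₀ P e d f′ M′))
      ; cleared = clear P }

    module _ (c₀ : ℕ) where

      -- The live edges are the potential. A chain of removals may be long in a single round of the
      -- scan, but each removal is paid for by the edge that disappears.
      Outer : ℕ → ℕ → State W → Set
      Outer k c s = ∃ λ alive → PeelState alive s × StuckBelow k alive × size alive * peelCost + c₀ ≤ c

      -- Removing an edge lowers the degree of its far end only, apart from the vertex being
      -- cleared. Hence among the vertices scanned so far at most the current end of the chain has
      -- degree 1, and the scan need never go back.
      Inner : ℕ → ℕ → State W → Set
      Inner k c s = ∃₂ λ alive v → PeelState alive s × regs s rV ≡ toℕ v ×
        (∀ x → toℕ x < suc k → degree alive x ≡ 1 → x ≡ v) × 5 + size alive * peelCost + c₀ ≤ c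

      inner : ∀ {k c s} → Inner k c s →
        (⟦_⟧ᵗ W (aDeg at reg rV == const 1) s ≡ false × ∃ λ r → 5 + r ≤ c × Outer (suc k) r s) ⊎
        (⟦_⟧ᵗ W (aDeg at reg rV == const 1) s ≡ true × ∃ λ c′ → 5 + c′ ≤ c × Runs peelStep s c′ (Inner k))
      inner {k} {c} {s} (alive , v , P , sV , only , le) with degree alive v ≟ 1
      ... | no d≢1 = inj₁ (dec-false (arrs s aDeg (regs s rV) ≟ 1) (λ eq → d≢1 (trans (sym deg) eq))
                          , _ , le , alive , P , stuck , ≤-refl)
        where
        deg : arrs s aDeg (regs s rV) ≡ degree alive v
        deg = trans (cong (arrs s aDeg) sV) (look (deg≡ (ldd P)) v)
        stuck : StuckBelow (suc k) alive
        stuck x x< eq = d≢1 (trans (cong (degree alive) (sym (only x x< eq))) eq)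
      ... | yes d≡1 = inj₂ (dec-true (arrs s aDeg (regs s rV) ≟ 1) (trans deg d≡1)
                          , size alive * peelCost + c₀ , le ,
                          straight peelStep {r = 5 + size alive′ * peelCost + c₀} refl (≤-reflexive cred)
                            (alive′ , u , post , U≡ , only′ , ≤-refl))
        where
        open Step P sV d≡1
        deg : arrs s aDeg (regs s rV) ≡ degree alive v
        deg = trans (cong (arrs s aDeg) sV) (look (deg≡ (ldd P)) v)
        only′ : ∀ x → toℕ x < suc k → degree alive′ x ≡ 1 → x ≡ u
        only′ x x< eq with x ≟ᶠ u
        ... | yes p = p
        ... | no x≢u with x ≟ᶠ v
        ...   | yes refl = contradiction (trans (sym degree-v) eq) λ ()
        ...   | no x≢v = contradiction (only x x< (trans (degree-same x≢v x≢u) eq)) x≢v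
        cred : duration peelStep + (5 + size alive′ * peelCost + c₀) ≡ size alive * peelCost + c₀
        cred = trans (lem (duration peelStep) (size alive′ * peelCost) c₀)
          (cong (λ z → z * peelCost + c₀) (sym (size-extend extends)))
          where
          lem : ∀ a x c → a + (5 + x + c) ≡ 5 + a + x + c
          lem = solve-∀

      peelᴿ : ∀ {s} → PeelState (λ _ → true) s →
        Runs peel s (6 + n * (8 + 7) + (size (λ (_ : Fin n) → true) * peelCost + c₀)) (Outer n)
      -- 7 units: 2 for the assignment to `rV` and 5 for the inner test that fails.
      peelᴿ {s} P = forᴿ {body = peelBody} {d = 7} Outer refl refl refl (size≡ (inp (ldd P)))
        ((λ _ → true) , same-arrays P (size≡ (inp (ldd P))) refl , (λ x ()) , ≤-refl) body (λ _ o → o)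
        where
        body : ∀ {k c s} → k < n → regs s rI ≡ k → regs s rN ≡ n → Outer k c s →
          Runs peelBody s (7 + c) (λ r s′ → Outer (suc k) r (record s′ { regs = regs s′ [ rI ↦ suc k ] }))
        body {k} {c} {s} k<n sI sN (alive , P , stuck , le) with at-fin k<n
        ... | x , refl = weaken
          (straight-then (rV := reg rI) {r = 5 + c} refl ≤-refl
            (whileᴿ {p = peelStep} (Inner (toℕ x)) inner
              (alive , x , same-arrays P sN refl , sI , only , s≤s (s≤s (s≤s (s≤s (s≤s le)))))))
          λ { (alive′ , P′ , stuck′ , le′) → alive′ , same-arrays P′ (size≡ (inp (ldd P′))) refl , stuck′ , le′ }
          where
          only : ∀ y → toℕ y < suc (toℕ x) → degree alive y ≡ 1 → y ≡ x
          only y y≤x d≡1 with y ≟ᶠ x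
          ... | yes p = p
          ... | no y≢x = contradiction d≡1 (stuck y (≤∧≢⇒< (≤-pred y≤x) λ eq → y≢x (toℕ-injective eq)))

-- Walking around the cycles and labelling them.

module Walk where

  open Ram
  open Graph
  open Loads
  open import Data.Fin.Properties using (any?; toℕ-injective) renaming (_≟_ to _≟ᶠ_)
  open import Function.Definitions using (Injective)

  -- All matchings: m false and m true are the two ways to match an edge, and the
  -- edges with the same label have to make the same choice.
  record Certificate {n : ℕ} (fst snd : Fin n → Fin n) (B : ℕ) (blk : Fin n → ℕ) (m : Bool → Fin n → Fin n) : Set where
    open Incidence fst snd using (Matching)
    field
      B≥1      : 1 ≤ B
      blk<B    : ∀ e → blk e < B
      sound    : ∀ (β : ℕ → Bool) → Matching (λ e → m (β (blk e)) e)
      complete : ∀ f → Matching f → ∃ λ (β : ℕ → Bool) → ∀ e → f e ≡ m (β (blk e)) e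
      distinct : ∀ b → 1 ≤ b → b < B → ∃ λ ℓ → blk ℓ ≡ b × m false ℓ ≢ m true ℓ

  module Walking (W : WeightDomain) {n : ℕ} (fst snd : Fin n → Fin n)
    {alive : Fin n → Bool} (P : Incidence.Peeled fst snd alive)
    {f₀ : Fin n → Fin n} (M₀ : Incidence.Matching fst snd f₀) where
    open Logic W
    open Incidence fst snd
    open Build W fst snd
    open Cycles P M₀

    pick : Bool → Fin n → Fin n
    pick b e = if b then g e else f₀ e

    -- A walk starts at `fst` of its first edge, which may be the `f₀` end or the `g` end. With
    -- `δ = true` edges are entered at `g` and left at `f₀`, so that `κ` follows; with `δ = false`
    -- it is the other way round.
    π : Bool → Fin n → Fin n
    π true  = κ
    π false = ν

    pick-π : ∀ δ e → pick δ (π δ e) ≡ pick (not δ) e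
    pick-π true e = g-κ e
    pick-π false e = f₀-ν e

    π-alive : ∀ δ {e} → alive e ≡ true → alive (π δ e) ≡ true
    π-alive true = κ-alive
    π-alive false = ν-alive

    π-injective : ∀ δ → Injective _≡_ _≡_ (π δ)
    π-injective true = κ-injective
    π-injective false {a} {b} eq = trans (sym (κ-ν a)) (trans (cong κ eq) (κ-ν b))

    ν-invariant⇒π : ∀ δ {h} → Invariant h → ∀ e → h (π δ e) ≡ h e
    ν-invariant⇒π true {h} inv e = trans (sym (inv (κ e))) (cong h (ν-κ e))
    ν-invariant⇒π false inv e = inv e

    π-invariant⇒ν : ∀ δ {h : Fin n → Bool} → (∀ e → h (π δ e) ≡ h e) → Invariant h
    π-invariant⇒ν true {h} inv e = trans (sym (inv (ν e))) (cong h (κ-ν e))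
    π-invariant⇒ν false inv = inv

    -- Exactly two live edges meet at the vertex through which `e` is left, so the stored sum minus
    -- `e` names the other one.
    next-edge : ∀ δ {e} → alive e ≡ true → load toℕ alive (pick (not δ) e) ∸ toℕ e ≡ toℕ (π δ e)
    next-edge true {e} a = trans (cong (_∸ toℕ e) (load-f₀ a)) (m+n∸m≡n (toℕ e) _)
    next-edge false {e} a = trans (cong (λ z → load toℕ alive z ∸ toℕ e) (sym (f₀-ν e)))
      (trans (cong (_∸ toℕ e) (trans (load-f₀ (ν-alive a)) (cong (λ z → toℕ (ν e) + toℕ z) (κ-ν e))))
        (m+n∸n≡m _ (toℕ e)))

    opposite-end : ∀ δ {e} → alive e ≡ true → toℕ (fst e) + toℕ (snd e) ∸ toℕ (pick δ e) ≡ toℕ (pick (not δ) e)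
    opposite-end true {e} a = trans (cong (_∸ toℕ (g e)) (ends-sum a)) (m+n∸n≡m _ (toℕ (g e)))
    opposite-end false {e} a = trans (cong (_∸ toℕ (f₀ e)) (ends-sum a)) (m+n∸m≡n (toℕ (f₀ e)) _)

    -- B is the number of labels in use; label 0 marks the forced edges.
    record Labelled (vis : Fin n → Bool) (blk : Fin n → ℕ) (B : ℕ) : Set where
      field
        B≥1       : 1 ≤ B
        vis-inv   : Invariant vis
        blk-inv   : ∀ e → blk (ν e) ≡ blk e
        dead-vis  : ∀ e → alive e ≡ false → vis e ≡ true
        dead-blk  : ∀ e → alive e ≡ false → blk e ≡ 0
        unvis-blk : ∀ e → vis e ≡ false → blk e ≡ 0
        live-blk  : ∀ e → vis e ≡ true → alive e ≡ true → 1 ≤ blk e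
        blk<B     : ∀ e → blk e < B
        leader    : ∀ b → 1 ≤ b → b < B → ∃ λ ℓ → alive ℓ ≡ true × blk ℓ ≡ b
        -- Lying on a common cycle, expressed without paths: no invariant set separates the two
        -- edges.
        connected : ∀ d e → blk d ≡ blk e → 1 ≤ blk d → ∀ h → Invariant h → h d ≡ h e

    -- `o b` remembers the direction in which the cycle labelled `b` was walked, that is, whether
    -- `aM₀` holds `g` or `f₀` on it; `aM₁` holds the other one.
    record Written (s : State W) (vis : Fin n → Bool) (blk : Fin n → ℕ) (o : ℕ → Bool) : Set where
      field
        ldd   : Loaded alive s
        done≡ : Rep (arrs s aDone) (λ e → if vis e then 1 else 0)
        blk≡  : Rep (arrs s aBlk) blk
        mem₀  : ∀ e → vis e ≡ true → arrs s aM₀ (toℕ e) ≡ toℕ (pick (o (blk e)) e)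
        mem₁  : ∀ e → vis e ≡ true → arrs s aM₁ (toℕ e) ≡ toℕ (pick (not (o (blk e))) e)
    open Written

    same-arrays : ∀ {s s′ : State W} {vis blk o} → Written s vis blk o → regs s′ rN ≡ n → arrs s′ ≡ arrs s → Written s′ vis blk o
    same-arrays {state _ _ _ _} {state _ _ _ _} w N≡ refl = record
      { ldd = loaded (input N≡ (fst≡ (inp (ldd w))) (snd≡ (inp (ldd w)))) (deg≡ (ldd w)) (sum≡ (ldd w))
      ; done≡ = done≡ w ; blk≡ = blk≡ w ; mem₀ = mem₀ w ; mem₁ = mem₁ w }

    unvisited : (Fin n → Bool) → ℕ
    unvisited vis = size (λ e → not (vis e))

    walkCost : ℕ
    walkCost = 5 + duration walkStep

    module Cycle {vis₀ blk₀ B} (L₀ : Labelled vis₀ blk₀ B) (o₀ : ℕ → Bool) (i₀ : Fin n)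
      (i₀-new : vis₀ i₀ ≡ false) (c₀ : ℕ) where
      open Labelled L₀

      i₀-alive : alive i₀ ≡ true
      i₀-alive with split (alive i₀)
      ... | inj₁ a = a
      ... | inj₂ d = contradiction (trans (sym i₀-new) (dead-vis i₀ d)) λ ()

      direction : ∃ λ δ → fst i₀ ≡ pick δ i₀
      direction with fst-f₀-or-g i₀ i₀-alive
      ... | inj₁ p = false , p
      ... | inj₂ p = true , p

      δ : Bool
      δ = proj₁ direction

      o : ℕ → Bool
      o b = if does (b ≟ B) then δ else o₀ b

      o-B : o B ≡ δ
      o-B rewrite dec-true (B ≟ B) refl = refl

      o-old : ∀ e → o (blk₀ e) ≡ o₀ (blk₀ e)
      o-old e rewrite dec-false (blk₀ e ≟ B) (<⇒≢ (blk<B e)) = refl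

      -- `onward` says that the visited edges are closed under the step of the walk, except that the
      -- step may lead to the front `e`. As soon as `e` turns out to be visited, the set is closed.
      record New (vis : Fin n → Bool) (blk : Fin n → ℕ) (e d : Fin n) : Set where
        field
          was-unvisited : vis₀ d ≡ false
          is-visited    : vis d ≡ true
          label         : blk d ≡ B
          is-alive      : alive d ≡ true
          linked        : ∀ h → Invariant h → h d ≡ h i₀
          onward        : vis (π δ d) ≡ true ⊎ π δ d ≡ e
      open New

      record Front (vis : Fin n → Bool) (blk : Fin n → ℕ) (e : Fin n) : Set where
        field
          e-alive  : alive e ≡ true
          e-linked : ∀ h → Invariant h → h e ≡ h i₀
          cases    : ∀ d → (vis d ≡ vis₀ d × blk d ≡ blk₀ d) ⊎ New vis blk e d
      open Front

      monotone : ∀ {vis blk e} → Front vis blk e → ∀ d → vis₀ d ≡ true → vis d ≡ true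
      monotone F d v with cases F d
      ... | inj₁ (p , _) = trans p v
      ... | inj₂ N = is-visited N

      start : Front vis₀ blk₀ i₀
      start = record { e-alive = i₀-alive ; e-linked = λ _ _ → refl ; cases = λ _ → inj₁ (refl , refl) }

      advance : ∀ {vis blk e} → vis e ≡ false → Front vis blk e →
        Front (vis ⟨ e ≔ true ⟩) (blk ⟨ e ≔ B ⟩) (π δ e)
      advance {vis} {blk} {e} unv F = record
        { e-alive = π-alive δ (e-alive F)
        ; e-linked = λ h inv → trans (ν-invariant⇒π δ inv e) (e-linked F h inv)
        ; cases = cases′ }
        where
        vis′ = vis ⟨ e ≔ true ⟩
        blk′ = blk ⟨ e ≔ B ⟩
        grow : ∀ d → vis d ≡ true → vis′ d ≡ true
        grow d v with d ≟ᶠ e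
        ... | yes _ = refl
        ... | no _ = v
        old-e : vis₀ e ≡ false
        old-e with cases F e
        ... | inj₁ (p , _) = trans (sym p) unv
        ... | inj₂ N = was-unvisited N
        cases′ : ∀ d → (vis′ d ≡ vis₀ d × blk′ d ≡ blk₀ d) ⊎ New vis′ blk′ (π δ e) d
        cases′ d with d ≟ᶠ e
        ... | yes refl = inj₂ (record { was-unvisited = old-e ; is-visited = set-at vis d ; label = set-at blk d
                       ; is-alive = e-alive F ; linked = e-linked F ; onward = inj₂ refl })
        ... | no d≢e with cases F d
        ...   | inj₁ (p , q) = inj₁ (p , q)
        ...   | inj₂ N = inj₂ (record { was-unvisited = was-unvisited N ; is-visited = grow d (is-visited N)
                       ; label = trans (set-off blk e d≢e) (label N)
                       ; is-alive = is-alive N ; linked = linked N ; onward = onward′ (onward N) })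
          where
          onward′ : vis (π δ d) ≡ true ⊎ π δ d ≡ e → vis′ (π δ d) ≡ true ⊎ π δ d ≡ π δ e
          onward′ (inj₁ v) = inj₁ (grow _ v)
          onward′ (inj₂ p) = inj₁ (trans (cong vis′ p) (set-at vis e))

      -- The program only notices that some visited edge has been reached, not that it is `i₀`. The
      -- visited set is then closed under the step, hence invariant by finiteness, and `e-linked`
      -- transfers membership from `e` to `i₀`.
      finish : ∀ {vis blk e} → vis e ≡ true → Front vis blk e → Labelled vis blk (suc B) × vis i₀ ≡ true
      finish {vis} {blk} {e} vis-e F = record
        { B≥1 = s≤s z≤n
        ; vis-inv = inv
        ; blk-inv = λ d → trans (new-label (ν d)) (trans (cong₂ (λ b x → if b then B else x)
                      (cong₂ (λ a b → a ∧ not b) (inv d) (vis-inv d)) (blk-inv d)) (sym (new-label d)))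
        ; dead-vis = λ d a → monotone F d (dead-vis d a)
        ; dead-blk = dead
        ; unvis-blk = unvis
        ; live-blk = live
        ; blk<B = bound
        ; leader = lead
        ; connected = conn } , trans (sym (e-linked F vis inv)) vis-e
        where
        closed : ∀ d → vis d ≡ true → vis (π δ d) ≡ true
        closed d v with cases F d
        ... | inj₁ (p , _) = monotone F (π δ d) (trans (ν-invariant⇒π δ vis-inv d) (trans (sym p) v))
        ... | inj₂ N with onward N
        ...   | inj₁ q = q
        ...   | inj₂ q = trans (cong vis q) vis-e
        inv : Invariant vis
        inv = π-invariant⇒ν δ (closed⇒invariant (π δ) (π-injective δ) closed)
        new-label : ∀ d → blk d ≡ (if vis d ∧ not (vis₀ d) then B else blk₀ d)
        new-label d with cases F d
        ... | inj₁ (p , q) rewrite p = trans q (same (vis₀ d))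
          where
          same : ∀ b → blk₀ d ≡ (if b ∧ not b then B else blk₀ d)
          same true = refl
          same false = refl
        ... | inj₂ N rewrite is-visited N | was-unvisited N = label N
        dead : ∀ d → alive d ≡ false → blk d ≡ 0
        dead d a with cases F d
        ... | inj₁ (_ , q) = trans q (dead-blk d a)
        ... | inj₂ N = contradiction (trans (sym a) (is-alive N)) λ ()
        unvis : ∀ d → vis d ≡ false → blk d ≡ 0
        unvis d u with cases F d
        ... | inj₁ (p , q) = trans q (unvis-blk d (trans (sym p) u))
        ... | inj₂ N = contradiction (trans (sym u) (is-visited N)) λ ()
        live : ∀ d → vis d ≡ true → alive d ≡ true → 1 ≤ blk d
        live d v a with cases F d
        ... | inj₁ (p , q) = subst (1 ≤_) (sym q) (live-blk d (trans (sym p) v) a)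
        ... | inj₂ N = subst (1 ≤_) (sym (label N)) B≥1
        bound : ∀ d → blk d < suc B
        bound d with cases F d
        ... | inj₁ (_ , q) = m≤n⇒m≤1+n (subst (_< B) (sym q) (blk<B d))
        ... | inj₂ N = s≤s (≤-reflexive (label N))
        lead : ∀ b → 1 ≤ b → b < suc B → ∃ λ ℓ → alive ℓ ≡ true × blk ℓ ≡ b
        lead b 1≤b b<sB with b ≟ B
        -- The front `e` serves as the leader of the new label. It cannot have been visited before:
        -- the old visited set is invariant, `e` is linked to `i₀`, and `i₀` was new.
        ... | yes refl = e , e-alive F , label-e
          where
          label-e : blk e ≡ b
          label-e with cases F e
          ... | inj₁ (p , _) = contradiction (trans (sym vis-e) (trans p (trans (e-linked F vis₀ vis-inv) i₀-new))) λ ()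
          ... | inj₂ N = label N
        ... | no b≢B with leader b 1≤b (≤∧≢⇒< (≤-pred b<sB) b≢B)
        ...   | ℓ , a , eq = ℓ , a , still
          where
          still : blk ℓ ≡ b
          still with cases F ℓ
          ... | inj₁ (_ , q) = trans q eq
          ... | inj₂ N = contradiction (subst (1 ≤_) (trans (sym eq) (unvis-blk ℓ (was-unvisited N))) 1≤b) λ ()
        conn : ∀ d d′ → blk d ≡ blk d′ → 1 ≤ blk d → ∀ h → Invariant h → h d ≡ h d′
        conn d d′ eq 1≤ h hinv with cases F d | cases F d′
        ... | inj₁ (_ , q) | inj₁ (_ , q′) = connected d d′ (trans (sym q) (trans eq q′)) (subst (1 ≤_) q 1≤) h hinv
        ... | inj₂ N | inj₂ N′ = trans (linked N h hinv) (sym (linked N′ h hinv))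
        ... | inj₁ (_ , q) | inj₂ N′ = contradiction (trans (sym q) (trans eq (label N′))) (<⇒≢ (blk<B d))
        ... | inj₂ N | inj₁ (_ , q′) = contradiction (trans (sym q′) (trans (sym eq) (label N))) (<⇒≢ (blk<B d′))

      Inner : ℕ → State W → Set
      Inner c s = ∃₂ λ vis blk → ∃ λ e → Front vis blk e × Written s vis blk o ×
        regs s rE ≡ toℕ e × regs s rV ≡ toℕ (pick δ e) × regs s rB ≡ B × regs s rN ≡ n ×
        5 + unvisited vis * walkCost + c₀ ≤ c

      Done : ℕ → State W → Set
      Done c s = ∃₂ λ vis blk → Labelled vis blk (suc B) × vis i₀ ≡ true × (∀ e → vis₀ e ≡ true → vis e ≡ true) ×
        Written s vis blk o × regs s rB ≡ B × regs s rN ≡ n × unvisited vis * walkCost + c₀ ≤ c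

      inner : ∀ {c s} → Inner c s →
        (⟦_⟧ᵗ W (aDone at reg rE == const 0) s ≡ false × ∃ λ r → 5 + r ≤ c × Done r s) ⊎
        (⟦_⟧ᵗ W (aDone at reg rE == const 0) s ≡ true × ∃ λ c′ → 5 + c′ ≤ c × Runs walkStep s c′ Inner)
      inner {c} {s} (vis , blk , e , F , w , sE , sV , sB , sN , le) with split (vis e)
      ... | inj₁ v = inj₁ (dec-false (arrs s aDone (regs s rE) ≟ 0) (λ eq → contradiction (trans (sym (trans flag (cong (λ b → if b then 1 else 0) v))) eq) λ ())
                          , _ , le , vis , blk , proj₁ (finish v F) , proj₂ (finish v F) , monotone F , w , sB , sN , ≤-refl)
        where
        flag : arrs s aDone (regs s rE) ≡ (if vis e then 1 else 0)
        flag = trans (cong (arrs s aDone) sE) (look (done≡ w) e)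
      ... | inj₂ u = inj₂ (dec-true (arrs s aDone (regs s rE) ≟ 0) (trans flag (cong (λ b → if b then 1 else 0) u))
                          , unvisited vis * walkCost + c₀ , le ,
                          straight walkStep {r = 5 + unvisited vis′ * walkCost + c₀} refl (≤-reflexive cred)
                            (vis′ , blk′ , π δ e , advance u F , w′ , E′≡ , trans U≡ (cong toℕ (sym (pick-π δ e))) , sB , sN , ≤-refl))
        where
        flag : arrs s aDone (regs s rE) ≡ (if vis e then 1 else 0)
        flag = trans (cong (arrs s aDone) sE) (look (done≡ w) e)
        vis′ = vis ⟨ e ≔ true ⟩
        blk′ = blk ⟨ e ≔ B ⟩
        extends : Extends (λ d → not (vis′ d)) (λ d → not (vis d)) e
        extends = record { before = cong not (set-at vis e) ; after = cong not u
                         ; others = λ d d≢e → cong not (sym (set-off vis e d≢e)) }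
        cred : duration walkStep + (5 + unvisited vis′ * walkCost + c₀) ≡ unvisited vis * walkCost + c₀
        cred = trans (lem (duration walkStep) (unvisited vis′ * walkCost) c₀)
          (cong (λ z → z * walkCost + c₀) (sym (size-extend extends)))
          where
          lem : ∀ a x c → a + (5 + x + c) ≡ 5 + a + x + c
          lem = solve-∀
        E U : ℕ
        E = regs s rE
        U = arrs s aFst E + arrs s aSnd E ∸ regs s rV
        U≡ : U ≡ toℕ (pick (not δ) e)
        U≡ = trans (cong₂ _∸_ (cong₂ _+_ (trans (cong (arrs s aFst) sE) (look (fst≡ (inp (ldd w))) e))
                                         (trans (cong (arrs s aSnd) sE) (look (snd≡ (inp (ldd w))) e))) sV)
               (opposite-end δ (e-alive F))
        E′≡ : arrs s aSum U ∸ E ≡ toℕ (π δ e)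
        E′≡ = trans (cong₂ _∸_ (trans (cong (arrs s aSum) U≡) (look (sum≡ (ldd w)) _)) sE) (next-edge δ (e-alive F))
        write : ∀ {a v} (ψ : Fin n → ℕ → Fin n) → v ≡ toℕ (ψ e B) →
          (∀ d → vis d ≡ true → a (toℕ d) ≡ toℕ (ψ d (blk d))) →
          ∀ d → vis′ d ≡ true → (a [ E ↦ v ]) (toℕ d) ≡ toℕ (ψ d (blk′ d))
        write {a} {v} ψ v≡ old d vd with d ≟ᶠ e
        ... | yes refl = trans (cong (a [ E ↦ v ]) (sym sE)) (trans (update-at a E v) v≡)
        ... | no d≢e = trans (update-off a v λ eq → d≢e (toℕ-injective (trans eq sE))) (old d vd)
        w′ : Written (run walkStep s) vis′ blk′ o
        w′ = record
          { ldd = loaded (input sN (fst≡ (inp (ldd w))) (snd≡ (inp (ldd w)))) (deg≡ (ldd w)) (sum≡ (ldd w))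
          ; done≡ = Rep-cong (Rep-set e (done≡ w) sE) done-cases
          ; blk≡ = subst (λ b → Rep (arrs s aBlk [ E ↦ regs s rB ]) (blk ⟨ e ≔ b ⟩)) sB (Rep-set e (blk≡ w) sE)
          ; mem₀ = write {arrs s aM₀} (λ d b → pick (o b) d) (trans sV (cong (λ b → toℕ (pick b e)) (sym o-B))) (mem₀ w)
          ; mem₁ = write {arrs s aM₁} (λ d b → pick (not (o b)) d) (trans U≡ (cong (λ b → toℕ (pick (not b) e)) (sym o-B))) (mem₁ w) }
          where
          done-cases : ∀ d → ((λ d → if vis d then 1 else 0) ⟨ e ≔ 1 ⟩) d ≡ (if vis′ d then 1 else 0)
          done-cases d with d ≟ᶠ e
          ... | yes _ = refl
          ... | no _ = refl

    module _ (c₀ : ℕ) where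

      Outer : ℕ → ℕ → State W → Set
      Outer k c s = ∃₂ λ vis blk → ∃₂ λ B o → Labelled vis blk B × Written s vis blk o ×
        (∀ e → toℕ e < k → vis e ≡ true) × regs s rB ≡ B × unvisited vis * walkCost + c₀ ≤ c

      walkᴿ : ∀ {s} → Written s (λ e → not (alive e)) (λ _ → 0) (λ _ → false) →
        Runs walk s (2 + (6 + n * (8 + 19) + (size alive * walkCost + c₀))) (Outer n)
      walkᴿ {s} w₀ = straight-then (rB := const 1) {r = 6 + n * (8 + 19) + (size alive * walkCost + c₀)} refl ≤-refl
        -- 19 units: 5 for the branch, 2 and 3 for the assignments, 5 for the inner test that ends
        -- the walk and 4 for the next label.
        (forᴿ {body = walkBody} {d = 19} Outer refl refl refl (size≡ (inp (ldd w₀)))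
          ((λ e → not (alive e)) , (λ _ → 0) , 1 , (λ _ → false) , initially
          , same-arrays w₀ (size≡ (inp (ldd w₀))) refl , (λ e ()) , refl , ≤-reflexive cred)
          body (λ _ x → x))
        where
        cred : unvisited (λ e → not (alive e)) * walkCost + c₀ ≡ size alive * walkCost + c₀
        cred = cong (λ z → z * walkCost + c₀) (total-cong λ e → cong (λ b → if b then 1 else 0) (not-involutive (alive e)))
          where open import Data.Bool.Properties using (not-involutive)
        initially : Labelled (λ e → not (alive e)) (λ _ → 0) 1
        initially = record
          { B≥1 = ≤-refl ; vis-inv = λ e → cong not (alive-ν e) ; blk-inv = λ _ → refl
          ; dead-vis = λ e a → cong not a ; dead-blk = λ _ _ → refl ; unvis-blk = λ _ _ → refl
          ; live-blk = λ e v a → contradiction (trans (sym v) (cong not a)) λ ()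
          ; blk<B = λ _ → ≤-refl ; leader = λ b 1≤b b<1 → contradiction (≤-trans b<1 1≤b) (<-irrefl refl)
          ; connected = λ _ _ _ () }
        body : ∀ {k c s} → k < n → regs s rI ≡ k → regs s rN ≡ n → Outer k c s →
          Runs walkBody s (19 + c) (λ r s′ → Outer (suc k) r (record s′ { regs = regs s′ [ rI ↦ suc k ] }))
        body {k} {c} {s} k<n sI sN (vis , blk , B , oₖ , L , w , seen , sB , le) with at-fin k<n
        ... | x , refl = branchᴿ {q = skip} {c′ = 14 + c} ≤-refl new old
          where
          flag : arrs s aDone (regs s rI) ≡ (if vis x then 1 else 0)
          flag = trans (cong (arrs s aDone) sI) (look (done≡ w) x)
          new : ⟦_⟧ᵗ W (aDone at reg rI == const 0) s ≡ true → _
          new t with split (vis x)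
          ... | inj₁ v = contradiction (trans (sym (==-true t)) (trans flag (cong (λ b → if b then 1 else 0) v))) λ ()
          ... | inj₂ u = straight-then (rE := reg rI) {r = 12 + c} refl ≤-refl
            (straight-then (rV := aFst at reg rI) {r = 9 + c} refl ≤-refl
            (whileᴿ {p = walkStep} (Cycle.Inner L oₖ x u (4 + c₀)) (Cycle.inner L oₖ x u (4 + c₀))
                (vis , blk , x , start , w′ , sI
                , trans (cong (arrs s aFst) sI) (trans (look (fst≡ (inp (ldd w))) x) (cong toℕ (proj₂ direction)))
                , sB , sN , cred₀)
             ⨟ᴿ λ { {r} {s′} (vis′ , blk′ , L′ , x-seen , mono , w″ , sB′ , sN′ , le′) →
               straight (rB := reg rB ⊕ const 1) {r = unvisited vis′ * walkCost + c₀} refl (≤-trans (≤-reflexive (lem₄ (unvisited vis′ * walkCost) c₀)) le′)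
                (vis′ , blk′ , suc B , _ , L′ , same-arrays w″ sN′ refl , seen′ {vis′} x-seen mono , trans (cong (_+ 1) sB′) (+-comm B 1) , ≤-refl) }))
            where
            open Cycle L oₖ x u (4 + c₀)
            lem₄ : ∀ a b → 4 + (a + b) ≡ a + (4 + b)
            lem₄ = solve-∀
            cred₀ : 5 + unvisited vis * walkCost + (4 + c₀) ≤ 9 + c
            cred₀ = ≤-trans (≤-reflexive (lem₉ (unvisited vis * walkCost) c₀)) (+-monoʳ-≤ 9 le)
              where
              lem₉ : ∀ a b → 5 + a + (4 + b) ≡ 9 + (a + b)
              lem₉ = solve-∀
            w′ : Written (record s { regs = (regs s [ rE ↦ regs s rI ]) [ rV ↦ arrs s aFst (regs s rI) ] }) vis blk o
            w′ = same-arrays (record { ldd = ldd w ; done≡ = done≡ w ; blk≡ = blk≡ w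
              ; mem₀ = λ e v → trans (mem₀ w e v) (cong (λ b → toℕ (pick b e)) (sym (o-old e)))
              ; mem₁ = λ e v → trans (mem₁ w e v) (cong (λ b → toℕ (pick (not b) e)) (sym (o-old e))) }) sN refl
            seen′ : ∀ {vis′ : Fin n → Bool} → vis′ x ≡ true → (∀ e → vis e ≡ true → vis′ e ≡ true) →
              ∀ e → toℕ e < suc (toℕ x) → vis′ e ≡ true
            seen′ x-seen mono e e≤x with e ≟ᶠ x
            ... | yes refl = x-seen
            ... | no e≢x = mono e (seen e (≤∧≢⇒< (≤-pred e≤x) λ eq → e≢x (toℕ-injective eq)))
          old : ⟦_⟧ᵗ W (aDone at reg rI == const 0) s ≡ false → _
          old t = straight skip {r = c} refl (s≤s (m≤n+m c 13))
            (vis , blk , B , oₖ , L , same-arrays w sN refl , seen′ , sB , le)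
            where
            x-seen : vis x ≡ true
            x-seen with split (vis x)
            ... | inj₁ v = v
            ... | inj₂ u = contradiction (trans flag (cong (λ b → if b then 1 else 0) u)) (==-false t)
            seen′ : ∀ e → toℕ e < suc (toℕ x) → vis e ≡ true
            seen′ e e≤x with e ≟ᶠ x
            ... | yes refl = x-seen
            ... | no e≢x = seen e (≤∧≢⇒< (≤-pred e≤x) λ eq → e≢x (toℕ-injective eq))

    labels : ∀ {s : State W} {vis blk B o} → Labelled vis blk B → Written s vis blk o → (∀ e → vis e ≡ true) →
      ∃ λ m → Certificate fst snd B blk m × (∀ t → Rep (arrs s (if t then aM₁ else aM₀)) (λ e → toℕ (m t e)))
    labels {s} {vis} {blk} {B} {o} L w all-vis = m , certificate ,
      λ { true → rep λ e → mem₁ w e (all-vis e) ; false → rep λ e → mem₀ w e (all-vis e) }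
      where
      open Labelled L
      turn : Bool → ℕ → Bool
      turn t b = if t then not (o b) else o b
      m : Bool → Fin n → Fin n
      m t e = pick (turn t (blk e)) e
      -- Once everything is visited, label 0 occurs on dead edges only, where `g` and `f₀` coincide.
      forced⇒same : ∀ {e} → blk e ≡ 0 → ∀ s t → pick s e ≡ pick t e
      forced⇒same {e} b≡0 s t with split (alive e)
      ... | inj₁ a = contradiction (subst (1 ≤_) b≡0 (live-blk e (all-vis e) a)) λ ()
      ... | inj₂ d = trans (is-f₀ s) (sym (is-f₀ t))
        where
        is-f₀ : ∀ s → pick s e ≡ f₀ e
        is-f₀ true = g-dead d
        is-f₀ false = refl
      certificate : Certificate fst snd B blk m
      certificate = record
        { B≥1 = B≥1
        ; blk<B = blk<B
        ; sound = λ β → flip-matching {λ e → turn (β (blk e)) (blk e)} λ e → cong (λ b → turn (β b) b) (blk-inv e)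
        ; complete = λ f M → bit f , λ e → trans (sym (flip-side M e)) (choose f M e)
        ; distinct = λ b 1≤b b<B → differ (leader b 1≤b b<B) }
        where
        -- The choice for a label is read off any edge bearing it; `connected`, applied to `side f`,
        -- makes the result independent of that edge.
        bit : (Fin n → Fin n) → ℕ → Bool
        bit f b with any? (λ e → blk e ≟ b)
        ... | yes (e , _) = if side f e then not (o b) else o b
        ... | no _ = false
        untangle : ∀ h x → h ≡ (if (if h then not x else x) then not x else x)
        untangle true true = refl
        untangle true false = refl
        untangle false true = refl
        untangle false false = refl
        choose : ∀ f → Matching f → ∀ e → flip (side f) e ≡ m (bit f (blk e)) e
        choose f M e with any? (λ d → blk d ≟ blk e)
        ... | no none = contradiction (e , refl) none
        ... | yes (d , eq) with 1 ≤? blk e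
        ...   | yes 1≤ = cong (λ b → pick b e) (trans (sym (connected d e eq (subst (1 ≤_) (sym eq) 1≤) (side f) (side-invariant M)))
                  (untangle (side f d) (o (blk e))))
        ...   | no ≰ = forced⇒same (n<1⇒n≡0 (≰⇒> ≰)) (side f e) (turn (if side f d then not (o (blk e)) else o (blk e)) (blk e))
        differ : ∀ {b} → (∃ λ ℓ → alive ℓ ≡ true × blk ℓ ≡ b) → ∃ λ ℓ → blk ℓ ≡ b × m false ℓ ≢ m true ℓ
        differ (ℓ , a , eq) = ℓ , eq , apart (o (blk ℓ))
          where
          apart : ∀ x → pick x ℓ ≢ pick (not x) ℓ
          apart true = g≢f₀ a
          apart false p = g≢f₀ a (sym p)

-- The first phase as a whole.

module Labelling where

  open Ram
  open Graph
  open Loads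
  open Peel
  open Walk
  open import Data.Fin.Properties using (toℕ<n)

  module Labels (W : WeightDomain) {n : ℕ} (fst snd : Fin n → Fin n)
    {f₀ : Fin n → Fin n} (M₀ : Incidence.Matching fst snd f₀) where
    open Logic W
    open Incidence fst snd
    open Build W fst snd
    open Peeling W fst snd M₀ using (PeelState; peelᴿ; peelCost; peeled)

    size≤n : ∀ {k} (h : Fin k → Bool) → total (λ e → if h e then 1 else 0) ≤ k
    size≤n {zero} h = z≤n
    size≤n {suc k} h = +-mono-≤ (bit (h zero)) (size≤n (λ e → h (suc e)))
      where
      bit : ∀ b → (if b then 1 else 0) ≤ 1
      bit true = ≤-refl
      bit false = z≤n

    walkCost₁ : ℕ
    walkCost₁ = 5 + duration walkStep

    budget : ℕ
    budget = 6 + n * (8 + duration buildBody) + (6 + n * 15 + (n * peelCost + (2 + (6 + n * 27 + (n * walkCost₁ + 0)))))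

    Labelled₁ : State W → Set
    Labelled₁ s = Input s × ∃₂ λ B blk → ∃ λ m → Certificate fst snd B blk m × regs s rB ≡ B ×
      Rep (arrs s aBlk) blk × (∀ t → Rep (arrs s (if t then aM₁ else aM₀)) (λ e → toℕ (m t e)))

    -- The matching `f₀` belongs to the specification alone. It is shared by the peeling and the
    -- walk, so that both speak of the same `g` and `f₀`.
    phase₁ᴿ : ∀ {s} → Input s → (∀ a k → 2 ≤ a → arrs s a k ≡ 0) →
      Runs phase₁ s budget (λ _ s′ → Labelled₁ s′)
    phase₁ᴿ {s} i zeros =
      framed {build} (buildᴿ i (λ k → zeros aDeg k (s≤s (s≤s z≤n))) (λ k → zeros aSum k (s≤s (s≤s z≤n))))
      ⨟ᴿ λ { {r} {s₁} (fr , le , L) → more le (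
        framed {peel} (more (+-monoʳ-≤ (6 + n * 15) (+-monoˡ-≤ _ (*-monoˡ-≤ peelCost (size≤n {n} (λ _ → true))))) (peelᴿ c₁ (loadedState L fr)))
        ⨟ᴿ λ { {r₂} {s₂} (fr₂ , alive , P , stuck , le₂) → more (≤-trans (m≤n+m c₁ (size alive * peelCost)) le₂) (
          more (+-monoʳ-≤ (2 + (6 + n * 27)) (+-monoˡ-≤ 0 (*-monoˡ-≤ walkCost₁ (size≤n alive))))
            (weaken (Walking.walkᴿ W fst snd (peeled P stuck) M₀ 0
              (written P stuck (λ k → trans (cong-app (trans (arrs≡ fr₂ aBlk refl) (arrs≡ fr aBlk refl)) k) (zeros aBlk k (s≤s (s≤s z≤n))))))
            λ { {r₃} {s₃} (vis , blk , B , o , L₃ , w , all-vis , sB , _) →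
              let (m , cert , reps) = Walking.labels W fst snd (peeled P stuck) M₀ L₃ w (λ e → all-vis e (toℕ<n e)) in
              Loaded.inp (Walking.Written.ldd w) , B , blk , m , cert , sB , Walking.Written.blk≡ w , reps })) }) }
      where
      c₁ : ℕ
      c₁ = 2 + (6 + n * 27 + (n * walkCost₁ + 0))
      loadedState : ∀ {s₁} → Loaded (λ _ → true) s₁ → Frame build s s₁ → PeelState (λ _ → true) s₁
      loadedState L fr = record
        { ldd = L
        ; done≡ = rep λ e → trans (cong-app (arrs≡ fr aDone refl) (toℕ e)) (zeros aDone (toℕ e) (s≤s (s≤s z≤n)))
        ; fix₀ = λ _ () ; fix₁ = λ _ () ; clear = λ _ () }
      written : ∀ {alive s₂} (P : PeelState alive s₂) stuck → (∀ k → arrs s₂ aBlk k ≡ 0) →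
        Walking.Written W fst snd (peeled P stuck) M₀ s₂ (λ e → not (alive e)) (λ _ → 0) (λ _ → false)
      written {alive} {s₂} P stuck blk0 = record
        { ldd = PeelState.ldd P
        ; done≡ = Rep-cong (PeelState.done≡ P) λ e → swap (alive e)
        ; blk≡ = rep λ e → blk0 (toℕ e)
        ; mem₀ = λ e v → PeelState.fix₀ P e (dead v) f₀ M₀
        ; mem₁ = λ e v → trans (PeelState.fix₁ P e (dead v) f₀ M₀)
            (cong toℕ (sym (Cycles.g-dead (peeled P stuck) M₀ (dead v)))) }
        where
        swap : ∀ b → (if b then 0 else 1) ≡ (if not b then 1 else 0)
        swap true = refl
        swap false = refl
        dead : ∀ {b} → not b ≡ true → b ≡ false
        dead {false} _ = refl

-- Table addresses, sums of weights and binary counting.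

module Encoding where

  open Ram
  open import Algebra.Bundles using (CommutativeMonoid)
  import Algebra.Properties.CommutativeMonoid.Sum as Sum
  open import Data.Bool.Properties using () renaming (_≟_ to _≟ᵇ_)
  open import Data.Empty using (⊥)
  open import Data.Fin.Base using (fromℕ; inject₁)
  open import Data.Fin.Properties using (toℕ<n; toℕ-fromℕ; toℕ-inject₁; fromℕ<-toℕ)

  bit : Bool → ℕ
  bit b = if b then 1 else 0

  bit<2 : ∀ b → bit b < 2
  bit<2 true = ≤-refl
  bit<2 false = s≤s z≤n

  -- The pair of a label and its chosen bit, as a number below `2 * B`.
  node : (ℕ → Bool) → ℕ → ℕ
  node β a = a + a + bit (β a)

  double-bit-injective : ∀ a b s t → a + a + bit s ≡ b + b + bit t → a ≡ b × s ≡ t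
  double-bit-injective zero zero true true _ = refl , refl
  double-bit-injective zero zero false false _ = refl , refl
  double-bit-injective zero (suc b) true t eq = contradiction (trans eq (cong (λ z → suc (z + bit t)) (+-suc b b))) λ ()
  double-bit-injective zero (suc b) false t ()
  double-bit-injective (suc a) zero s true eq = contradiction (trans (sym eq) (cong (λ z → suc (z + bit s)) (+-suc a a))) λ ()
  double-bit-injective (suc a) zero s false ()
  double-bit-injective (suc a) (suc b) s t eq with double-bit-injective a b s t
    (suc-injective (suc-injective (trans (sym (cong (λ z → suc (z + bit s)) (+-suc a a))) (trans eq (cong (λ z → suc (z + bit t)) (+-suc b b))))))
  ... | refl , p = refl , p

  double-bit< : ∀ {a B} s → a < B → a + a + bit s < B + B
  double-bit< {a} {suc B} s (s≤s a≤B) = s≤s (≤-trans (+-mono-≤ (+-mono-≤ a≤B a≤B) (≤-pred (bit<2 s)))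
    (≤-reflexive (trans (+-assoc B B 1) (cong (B +_) (+-comm B 1)))))

  idx : ℕ → ℕ → ℕ → ℕ
  idx R u v = u * R + v

  idx-injective : ∀ {R} u u′ {v v′} → v < R → v′ < R → idx R u v ≡ idx R u′ v′ → u ≡ u′ × v ≡ v′
  idx-injective zero zero _ _ eq = refl , eq
  idx-injective {R} zero (suc u′) {v} {v′} v< _ eq = contradiction v< (≤⇒≯ (≤-trans (m≤m+n R (u′ * R)) (≤-trans (m≤m+n _ v′) (≤-reflexive (sym eq)))))
  idx-injective {R} (suc u) zero {v} {v′} _ v′< eq = contradiction v′< (≤⇒≯ (≤-trans (m≤m+n R (u * R)) (≤-trans (m≤m+n _ v) (≤-reflexive eq))))
  idx-injective {R} (suc u) (suc u′) {v} {v′} v< v′< eq with idx-injective u u′ v< v′<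
    (+-cancelˡ-≡ R _ _ (trans (sym (+-assoc R (u * R) v)) (trans eq (+-assoc R (u′ * R) v′))))
  ... | p , q = cong suc p , q

  module _ {A : Set} where

    padded-toℕ : ∀ {n} (z : A) (v : Fin n → A) i → padded z v (toℕ i) ≡ v i
    padded-toℕ {n} z v i with toℕ i <? n
    ... | yes lt = cong v (fromℕ<-toℕ i lt)
    ... | no ≮ = contradiction (toℕ<n i) ≮

  module WeightSums (W : WeightDomain) where
    open WeightDomain W
    open CommutativeMonoid commutativeMonoid public using (setoid; ∙-cong; ∙-congˡ; ∙-congʳ; assoc; comm; identityˡ; identityʳ)
      renaming (refl to ≈-refl; sym to ≈-sym; trans to ≈-trans; reflexive to ≈-reflexive)
    open Sum commutativeMonoid using (sum; sum-cong-≋; sum-init-last)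
    open import Relation.Binary.Reasoning.Setoid setoid

    -- The last term is added on the right, in the order in which a loop accumulates; `sumᵂ-sum`
    -- relates this to the sum in `cost`.
    sumᵂ : ℕ → (ℕ → Carrier) → Carrier
    sumᵂ zero f = 0#
    sumᵂ (suc k) f = sumᵂ k f ∙ f k

    sumᵂ-cong : ∀ k {f g} → (∀ j → j < k → f j ≈ g j) → sumᵂ k f ≈ sumᵂ k g
    sumᵂ-cong zero h = ≈-refl
    sumᵂ-cong (suc k) h = ∙-cong (sumᵂ-cong k λ j j< → h j (m<n⇒m<1+n j<)) (h k ≤-refl)

    sumᵂ-zero : ∀ k → sumᵂ k (λ _ → 0#) ≈ 0#
    sumᵂ-zero zero = ≈-refl
    sumᵂ-zero (suc k) = ≈-trans (identityʳ _) (sumᵂ-zero k)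

    sumᵂ-add : ∀ k {f g w} i → i < k → (∀ j → j < k → j ≢ i → f j ≈ g j) → f i ≈ g i ∙ w → sumᵂ k f ≈ sumᵂ k g ∙ w
    sumᵂ-add (suc k) {f} {g} {w} i i< off on with i ≟ k
    ... | yes refl = begin
      sumᵂ k f ∙ f k       ≈⟨ ∙-cong (sumᵂ-cong k λ j j< → off j (m<n⇒m<1+n j<) (<⇒≢ j<)) on ⟩
      sumᵂ k g ∙ (g k ∙ w) ≈⟨ assoc _ _ _ ⟨
      sumᵂ k g ∙ g k ∙ w   ∎
    ... | no i≢k = begin
      sumᵂ k f ∙ f k     ≈⟨ ∙-cong (sumᵂ-add k i (≤∧≢⇒< (≤-pred i<) i≢k) (λ j j< → off j (m<n⇒m<1+n j<)) on) (off k ≤-refl λ p → i≢k (sym p)) ⟩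
      sumᵂ k g ∙ w ∙ g k   ≈⟨ assoc _ _ _ ⟩
      sumᵂ k g ∙ (w ∙ g k) ≈⟨ ∙-congˡ (comm w (g k)) ⟩
      sumᵂ k g ∙ (g k ∙ w) ≈⟨ assoc _ _ _ ⟨
      sumᵂ k g ∙ g k ∙ w   ∎

    sumᵂ-sum : ∀ n (f : ℕ → Carrier) → sumᵂ n f ≈ sum {n} (λ i → f (toℕ i))
    sumᵂ-sum zero f = ≈-refl
    sumᵂ-sum (suc n) f = begin
      sumᵂ n f ∙ f n ≈⟨ ∙-cong (sumᵂ-sum n f) (≈-reflexive (cong f (sym (toℕ-fromℕ n)))) ⟩
      sum {n} (λ i → f (toℕ i)) ∙ f (toℕ (fromℕ n))
        ≈⟨ ∙-congʳ (sum-cong-≋ {n} λ i → ≈-reflexive (cong f (sym (toℕ-inject₁ i)))) ⟩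
      sum {n} (λ i → f (toℕ (inject₁ i))) ∙ f (toℕ (fromℕ n)) ≈⟨ sum-init-last {n} (λ i → f (toℕ i)) ⟨
      sum {suc n} (λ i → f (toℕ i)) ∎

    sumᵂ-padded : ∀ {n} (F : Fin n → Carrier) → sumᵂ n (padded 0# F) ≈ sum F
    sumᵂ-padded {n} F = ≈-trans (sumᵂ-sum n (padded 0# F)) (sum-cong-≋ {n} λ i → ≈-reflexive (padded-toℕ 0# F i))

    module Lookup (B : ℕ) where

      R : ℕ
      R = B + B

      cell : (ℕ → Bool) → ℕ → ℕ → ℕ
      cell β a b = idx R (node β a) (node β b)

      -- The cost of the choice β, read off a table of the costs between pairs (label , bit).
      value : (ℕ → Carrier) → (ℕ → Bool) → Carrier
      value T β = sumᵂ B (λ a → sumᵂ B (λ b → T (cell β a b)))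

      value-cong : ∀ {T β γ} → (∀ a → a < B → β a ≡ γ a) → value T β ≈ value T γ
      value-cong {T} {β} {γ} h = sumᵂ-cong B λ a a< → sumᵂ-cong B λ b b< →
        ≈-reflexive (cong₂ (λ u v → T (idx R (a + a + bit u) (b + b + bit v))) (h a a<) (h b b<))

      value-zero : ∀ {T β} → (∀ k → T k ≈ 0#) → value T β ≈ 0#
      value-zero {T} h = ≈-trans (sumᵂ-cong B λ a _ → ≈-trans (sumᵂ-cong B λ b _ → h _) (sumᵂ-zero B)) (sumᵂ-zero B)

      module _ {T T′ : ℕ → Carrier} {w : Carrier} {a₀ b₀ : ℕ} (s t : Bool) (a₀<B : a₀ < B) (b₀<B : b₀ < B)
        (changed : T′ (idx R (a₀ + a₀ + bit s) (b₀ + b₀ + bit t)) ≈ T (idx R (a₀ + a₀ + bit s) (b₀ + b₀ + bit t)) ∙ w)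
        (kept : ∀ k → k ≢ idx R (a₀ + a₀ + bit s) (b₀ + b₀ + bit t) → T′ k ≈ T k) where

        private
          same-cell : ∀ β a b → b < B → cell β a b ≡ idx R (a₀ + a₀ + bit s) (b₀ + b₀ + bit t) →
            (a ≡ a₀ × β a ≡ s) × (b ≡ b₀ × β b ≡ t)
          same-cell β a b b< eq with idx-injective (node β a) (a₀ + a₀ + bit s) (double-bit< (β b) b<) (double-bit< t b₀<B) eq
          ... | p , q = double-bit-injective a a₀ (β a) s p , double-bit-injective b b₀ (β b) t q

        value-hit : ∀ β → β a₀ ≡ s → β b₀ ≡ t → value T′ β ≈ value T β ∙ w
        value-hit β refl refl = sumᵂ-add B a₀ a₀<B
          (λ a a< a≢ → sumᵂ-cong B λ b b< → kept _ λ eq → a≢ (proj₁ (proj₁ (same-cell β a b b< eq))))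
          (sumᵂ-add B b₀ b₀<B (λ b b< b≢ → kept _ λ eq → b≢ (proj₁ (proj₂ (same-cell β a₀ b b< eq)))) changed)

        value-miss : ∀ β → ¬ (β a₀ ≡ s × β b₀ ≡ t) → value T′ β ≈ value T β
        value-miss β ¬hit = sumᵂ-cong B λ a a< → sumᵂ-cong B λ b b< → kept _ λ eq → ¬hit (hit (same-cell β a b b< eq))
          where
          hit : ∀ {a b} → (a ≡ a₀ × β a ≡ s) × (b ≡ b₀ × β b ≡ t) → β a₀ ≡ s × β b₀ ≡ t
          hit ((refl , p) , (refl , q)) = p , q

        -- Addresses determine both labels and both bits. So `β` reads the changed cell exactly once
        -- if it makes the choices `s` and `t`, and never otherwise.
        value-add : ∀ β → value T′ β ≈ value T β ∙ (if does (β a₀ ≟ᵇ s) ∧ does (β b₀ ≟ᵇ t) then w else 0#)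
        value-add β with β a₀ ≟ᵇ s | β b₀ ≟ᵇ t
        ... | yes p | yes q = value-hit β p q
        ... | no ¬p | _ = ≈-trans (value-miss β λ (p , _) → ¬p p) (≈-sym (identityʳ _))
        ... | yes _ | no ¬q = ≈-trans (value-miss β λ (_ , q) → ¬q q) (≈-sym (identityʳ _))

  -- Binary counting

  val : ℕ → (ℕ → Bool) → ℕ
  val zero β = 0
  val (suc k) β = val k β + bit (β k) * 2 ^ k

  2^-double : ∀ k → 2 ^ suc k ≡ 2 ^ k + 2 ^ k
  2^-double k = cong (2 ^ k +_) (+-identityʳ _)

  val<2^ : ∀ k β → val k β < 2 ^ k
  val<2^ zero β = ≤-refl
  val<2^ (suc k) β = <-≤-trans (+-mono-<-≤ (val<2^ k β) (*-monoˡ-≤ (2 ^ k) (≤-pred (bit<2 (β k)))))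
    (≤-reflexive refl)

  -- The lower bits amount to less than `2 ^ k`, so the top bits must agree; the rest is induction.
  val-injective : ∀ k {β γ} → val k β ≡ val k γ → ∀ j → j < k → β j ≡ γ j
  val-injective (suc k) {β} {γ} eq j j<sk = by (β k) (γ k) refl refl
    where
    low : β k ≡ γ k → val k β ≡ val k γ
    low p = +-cancelʳ-≡ (bit (β k) * 2 ^ k) _ _ (trans eq (cong (λ b → val k γ + bit b * 2 ^ k) (sym p)))
    finish : β k ≡ γ k → β j ≡ γ j
    finish p with j ≟ k
    ... | yes refl = p
    ... | no j≢k = val-injective k (low p) j (≤∧≢⇒< (≤-pred j<sk) j≢k)
    clash : ∀ {x y : ℕ → Bool} → val k x + 1 * 2 ^ k ≡ val k y + 0 * 2 ^ k → val k y < 2 ^ k → ⊥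
    clash {x} {y} e lt = <⇒≱ lt (≤-trans (≤-trans (≤-reflexive (sym (*-identityˡ _))) (m≤n+m _ (val k x))) (≤-reflexive (trans e (+-identityʳ _))))
    by : ∀ b c → β k ≡ b → γ k ≡ c → β j ≡ γ j
    by true true p q = finish (trans p (sym q))
    by false false p q = finish (trans p (sym q))
    by true false p q = contradiction (val<2^ k γ) (clash {β} {γ} (subst₂ (λ b c → val k β + bit b * 2 ^ k ≡ val k γ + bit c * 2 ^ k) p q eq))
    by false true p q = contradiction (val<2^ k β) (clash {γ} {β} (sym (subst₂ (λ b c → val k β + bit b * 2 ^ k ≡ val k γ + bit c * 2 ^ k) p q eq)))

  val-cong : ∀ k {β γ} → (∀ j → j < k → β j ≡ γ j) → val k β ≡ val k γ
  val-cong zero h = refl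
  val-cong (suc k) h = cong₂ (λ v b → v + bit b * 2 ^ k) (val-cong k λ j j< → h j (m<n⇒m<1+n j<)) (h k ≤-refl)

  +-swap : ∀ x y z → x + y + z ≡ x + z + y
  +-swap x y z = trans (+-assoc x y z) (trans (cong (x +_) (+-comm y z)) (sym (+-assoc x z y)))

  val-set : ∀ k β j b → j < k → val k (β [ j ↦ b ]) + bit (β j) * 2 ^ j ≡ val k β + bit b * 2 ^ j
  val-set (suc k) β j b j<sk with j ≟ k
  ... | yes refl = begin
    val k (β [ k ↦ b ]) + bit ((β [ k ↦ b ]) k) * 2 ^ k + bit (β k) * 2 ^ k
      ≡⟨ cong₂ (λ v c → v + bit c * 2 ^ k + bit (β k) * 2 ^ k)
           (val-cong k λ i i< → update-off β b (<⇒≢ i<)) (update-at β k b) ⟩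
    val k β + bit b * 2 ^ k + bit (β k) * 2 ^ k ≡⟨ +-swap (val k β) (bit b * 2 ^ k) (bit (β k) * 2 ^ k) ⟩
    val k β + bit (β k) * 2 ^ k + bit b * 2 ^ k ∎
    where open ≡-Reasoning
  ... | no j≢k = begin
    val k (β [ j ↦ b ]) + bit ((β [ j ↦ b ]) k) * 2 ^ k + bit (β j) * 2 ^ j
      ≡⟨ cong (λ c → val k (β [ j ↦ b ]) + bit c * 2 ^ k + bit (β j) * 2 ^ j) (update-off β b λ p → j≢k (sym p)) ⟩
    val k (β [ j ↦ b ]) + bit (β k) * 2 ^ k + bit (β j) * 2 ^ j ≡⟨ +-swap (val k (β [ j ↦ b ])) (bit (β k) * 2 ^ k) (bit (β j) * 2 ^ j) ⟩
    val k (β [ j ↦ b ]) + bit (β j) * 2 ^ j + bit (β k) * 2 ^ k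
      ≡⟨ cong (_+ bit (β k) * 2 ^ k) (val-set k β j b (≤∧≢⇒< (≤-pred j<sk) j≢k)) ⟩
    val k β + bit b * 2 ^ j + bit (β k) * 2 ^ k ≡⟨ +-swap (val k β) (bit b * 2 ^ j) (bit (β k) * 2 ^ k) ⟩
    val k β + bit (β k) * 2 ^ k + bit b * 2 ^ j ∎
    where open ≡-Reasoning

-- Building the table of costs between labelled choices.

module Table where

  open Ram
  open Graph
  open Loads
  open Encoding
  open import Data.Bool.Properties using () renaming (_≟_ to _≟ᵇ_)
  open import Data.Fin.Properties using (toℕ-injective; toℕ<n; toℕ-fromℕ<; nonZeroIndex)
  open import Data.Nat.DivMod using (m<n⇒m%n≡m; n%n≡0)

  aOff aT : Name
  aOff = 9
  aT = 4

  rR rJ rK : Name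
  rR = 6
  rJ = 7
  rK = 8

  aM : Bool → Name
  aM t = if t then aM₁ else aM₀

  -- The machine has no multiplication: the row offsets `u * R` are tabulated by repeated addition.
  offsets successor : Program
  offsets =
    rR := reg rB ⊕ reg rB ⨟
    rK := const 0 ⨟
    for rI rR (aOff [ reg rI ]:= reg rK ⨟ rK := reg rK ⊕ reg rR)

  successor = rJ := reg rI ⊕ const 1 ⨟ branch (reg rJ == reg rN) (rJ := const 0) skip

  choose addCell : Bool → Bool → Program
  choose s t =
    branch (aM s at reg rI == aFst at reg rI)
      (branch (aM t at reg rJ == aFst at reg rJ) (1 :=ʷ 0 at reg rI) (1 :=ʷ 1 at reg rI))
      (branch (aM t at reg rJ == aFst at reg rJ) (1 :=ʷ 2 at reg rI) (1 :=ʷ 3 at reg rI))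

  addCell s t = choose s t ⨟
    rK := (aOff at (aBlk at reg rI ⊕ aBlk at reg rI ⊕ const (bit s))) ⊕ (aBlk at reg rJ ⊕ aBlk at reg rJ ⊕ const (bit t)) ⨟
    aT [ reg rK ]:=ʷ aT at reg rK ⊕ reg 1

  -- All four pairs of bits are entered for each requisition. If two consecutive requisitions share
  -- a label, the cells with different bits are filled as well, but no choice ever reads them.
  tableBody table : Program
  tableBody = successor ⨟ addCell false false ⨟ addCell false true ⨟ addCell true false ⨟ addCell true true
  table = for rI rN tableBody

  next-toℕ : ∀ {n} (i : Fin n) → (suc (toℕ i) ≡ n × toℕ (next i) ≡ 0) ⊎ (suc (toℕ i) ≢ n × toℕ (next i) ≡ suc (toℕ i))
  next-toℕ {n} i with suc (toℕ i) ≟ n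
  ... | yes p = inj₁ (p , trans (toℕ-fromℕ< _) (trans (cong (λ z → _%_ z n {{nonZeroIndex i}}) p) (n%n≡0 n {{nonZeroIndex i}})))
  ... | no ¬p = inj₂ (¬p , trans (toℕ-fromℕ< _) (m<n⇒m%n≡m {{nonZeroIndex i}} (≤∧≢⇒< (toℕ<n i) ¬p)))

  module Tables (W : WeightDomain) {n : ℕ} (w : Weights W n) (fst snd : Fin n → Fin n)
    (B : ℕ) (blk : Fin n → ℕ) (blk<B : ∀ e → blk e < B)
    (m : Bool → Fin n → Fin n) (m-end : ∀ t e → m t e ≡ fst e ⊎ m t e ≡ snd e) where
    open Logic W
    open WeightDomain W
    open Weights w
    open WeightSums W
    open WeightSums.Lookup W B

    end : Bool → Fin n → Fin n
    end t = if t then snd else fst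

    aW : Bool → Bool → Name
    aW p q = if p then (if q then 3 else 2) else (if q then 1 else 0)

    record Core (s : State W) : Set where
      field
        N≡   : regs s rN ≡ n
        B≡   : regs s rB ≡ B
        fst≡ : Rep (arrs s aFst) (λ e → toℕ (fst e))
        m≡   : ∀ t → Rep (arrs s (aM t)) (λ e → toℕ (m t e))
        blk≡ : Rep (arrs s aBlk) blk
        arc≡ : ∀ p q i → warrs s (aW p q) (toℕ i) ≡ ρ (end p i) (end q (next i))
        nil≡ : wregs s 0 ≡ 0#

    -- Collects every cell on which `Core` depends, so that a single `refl` carries `Core` across a
    -- concrete program.
    quiet : Program → Bool
    quiet p = writesReg rN p ∨ writesReg rB p ∨ writesArr aFst p ∨ writesArr aM₀ p ∨ writesArr aM₁ p ∨ writesArr aBlk p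
      ∨ writesWArr 0 p ∨ writesWArr 1 p ∨ writesWArr 2 p ∨ writesWArr 3 p ∨ writesWReg 0 p

    core-frame : ∀ p {s s′} → quiet p ≡ false → Frame p s s′ → Core s → Core s′
    core-frame p {s} {s′} q fr C = record
      { N≡ = trans (regs≡ fr rN q₀) N≡
      ; B≡ = trans (regs≡ fr rB (∨-falseˡ q₁)) B≡
      ; fst≡ = subst (λ a → Rep a _) (sym (arrs≡ fr aFst (∨-falseˡ q₂))) fst≡
      ; m≡ = λ { false → subst (λ a → Rep a _) (sym (arrs≡ fr aM₀ (∨-falseˡ q₃))) (m≡ false)
               ; true → subst (λ a → Rep a _) (sym (arrs≡ fr aM₁ (∨-falseˡ q₄))) (m≡ true) }
      ; blk≡ = subst (λ a → Rep a _) (sym (arrs≡ fr aBlk (∨-falseˡ q₅))) blk≡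
      ; arc≡ = λ { false false i → trans (cong-app (warrs≡ fr 0 (∨-falseˡ q₆)) (toℕ i)) (arc≡ false false i)
                 ; false true i → trans (cong-app (warrs≡ fr 1 (∨-falseˡ q₇)) (toℕ i)) (arc≡ false true i)
                 ; true false i → trans (cong-app (warrs≡ fr 2 (∨-falseˡ q₈)) (toℕ i)) (arc≡ true false i)
                 ; true true i → trans (cong-app (warrs≡ fr 3 (∨-falseˡ q₉)) (toℕ i)) (arc≡ true true i) }
      ; nil≡ = trans (wregs≡ fr 0 (∨-falseʳ {writesWArr 3 p} q₉)) nil≡ }
      where
      open Core C
      q₀ : writesReg rN p ≡ false
      q₀ = ∨-falseˡ q
      q₁ = ∨-falseʳ {writesReg rN p} q
      q₂ = ∨-falseʳ {writesReg rB p} q₁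
      q₃ = ∨-falseʳ {writesArr aFst p} q₂
      q₄ = ∨-falseʳ {writesArr aM₀ p} q₃
      q₅ = ∨-falseʳ {writesArr aM₁ p} q₄
      q₆ = ∨-falseʳ {writesArr aBlk p} q₅
      q₇ = ∨-falseʳ {writesWArr 0 p} q₆
      q₈ = ∨-falseʳ {writesWArr 1 p} q₇
      q₉ = ∨-falseʳ {writesWArr 2 p} q₈

    core-rI : ∀ {s k} → Core s → Core (record s { regs = regs s [ rI ↦ k ] })
    core-rI C = record { N≡ = Core.N≡ C ; B≡ = Core.B≡ C ; fst≡ = Core.fst≡ C ; m≡ = Core.m≡ C ; blk≡ = Core.blk≡ C
            ; arc≡ = Core.arc≡ C ; nil≡ = Core.nil≡ C }

    Offsets : State W → Set
    Offsets s = ∀ u → u < R → arrs s aOff u ≡ u * R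

    offsetsᴿ : ∀ {s c} → Core s → Runs offsets s (4 + (2 + (6 + R * (8 + 7) + c))) (λ r s′ → c ≤ r × Core s′ × Offsets s′ × warrs s′ aT ≡ warrs s aT)
    offsetsᴿ {s} {c} C = weaken (framed {offsets} main) λ { (fr , le , O) → le , core-frame offsets refl fr C , O , warrs≡ fr aT refl }
      where
      I : ℕ → ℕ → State W → Set
      I k r s = c ≤ r × regs s rR ≡ R × regs s rK ≡ k * R × (∀ u → u < k → arrs s aOff u ≡ u * R)
      R≡ : regs s rB + regs s rB ≡ R
      R≡ = cong₂ _+_ (Core.B≡ C) (Core.B≡ C)
      main : Runs offsets s (4 + (2 + (6 + R * (8 + 7) + c))) (λ r s′ → c ≤ r × Offsets s′)
      main = straight-then (rR := reg rB ⊕ reg rB) refl ≤-refl (straight-then (rK := const 0) refl ≤-refl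
        (forᴿ {body = aOff [ reg rI ]:= reg rK ⨟ rK := reg rK ⊕ reg rR} {d = 7} I refl refl refl R≡
          (≤-refl , R≡ , refl , λ u ())
          (λ { {k} {r} {s} k< sI sR (le , _ , sK , off) → straight (aOff [ reg rI ]:= reg rK ⨟ rK := reg rK ⊕ reg rR) refl ≤-refl
            (le , sR , trans (cong₂ _+_ sK sR) (+-comm (k * R) R) , step s k sI sK off) })
          λ { _ (le , _ , _ , off) → le , off }))
        where
        step : ∀ s k → regs s rI ≡ k → regs s rK ≡ k * R → (∀ u → u < k → arrs s aOff u ≡ u * R) →
          ∀ u → u < suc k → (arrs s aOff [ regs s rI ↦ regs s rK ]) u ≡ u * R
        step s k sI sK off u u< with u ≟ k
        ... | yes refl = trans (cong (arrs s aOff [ regs s rI ↦ regs s rK ]) (sym sI)) (trans (update-at (arrs s aOff) _ _) sK)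
        ... | no u≢ = trans (update-off (arrs s aOff) _ λ eq → u≢ (trans eq sI)) (off u (≤∧≢⇒< (≤-pred u<) u≢))

    successorᴿ : ∀ {s r} (i : Fin n) → regs s rI ≡ toℕ i → regs s rN ≡ n →
      Runs successor s (duration successor + r) (λ r′ s′ → r ≤ r′ × regs s′ rJ ≡ toℕ (next i))
    successorᴿ {s} {r} i sI sN = straight-then (rJ := reg rI ⊕ const 1) {r = 6 + r} refl ≤-refl
      (branchᴿ {c′ = 2 + r} ≤-refl
        (λ t → straight (rJ := const 0) refl ≤-refl (≤-refl , wrap (==-true t)))
        (λ t → straight skip refl (s≤s (m≤n+m r 1)) (≤-refl , trans sJ (onward (==-false t)))))
      where
      sJ : regs s rI + 1 ≡ suc (toℕ i)
      sJ = trans (cong (_+ 1) sI) (+-comm _ 1)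
      wrap : regs s rI + 1 ≡ regs s rN → 0 ≡ toℕ (next i)
      wrap eq with next-toℕ i
      ... | inj₁ (_ , p) = sym p
      ... | inj₂ (¬p , _) = contradiction (trans (sym sJ) (trans eq sN)) ¬p
      onward : regs s rI + 1 ≢ regs s rN → suc (toℕ i) ≡ toℕ (next i)
      onward neq with next-toℕ i
      ... | inj₁ (p , _) = contradiction (trans sJ (trans p (sym sN))) neq
      ... | inj₂ (_ , p) = sym p

    module Edge (i : Fin n) where

      j : Fin n
      j = next i

      weight : Bool → Bool → Carrier
      weight s t = ρ (m s i) (m t j)

      record At (s : State W) : Set where
        field
          core : Core s
          offs : Offsets s
          I≡   : regs s rI ≡ toℕ i
          J≡   : regs s rJ ≡ toℕ j
      open At

      chooseᴿ : ∀ s t {σ r} → At σ →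
        Runs (choose s t) σ (duration (choose s t) + r) (λ r′ σ′ → r ≤ r′ × wregs σ′ 1 ≡ weight s t)
      chooseᴿ s t {σ} {r} A = branchᴿ {c′ = 9 + r} ≤-refl
          (λ p → branchᴿ {c′ = 3 + r} ≤-refl (λ q → leaf false false (first I≡′ (==-true p)) (first J≡′ (==-true q)))
                                             (λ q → leaf false true (first I≡′ (==-true p)) (second J≡′ (==-false q))))
          (λ p → branchᴿ {c′ = 3 + r} ≤-refl (λ q → leaf true false (second I≡′ (==-false p)) (first J≡′ (==-true q)))
                                             (λ q → leaf true true (second I≡′ (==-false p)) (second J≡′ (==-false q))))
        where
        open Core (core A)
        I≡′ = I≡ A
        J≡′ = J≡ A
        m-at : ∀ {t e k} → k ≡ toℕ e → arrs σ (aM t) k ≡ toℕ (m t e)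
        m-at {t} {e} refl = look (m≡ t) e
        first : ∀ {t e k} → k ≡ toℕ e → arrs σ (aM t) k ≡ arrs σ aFst k → m t e ≡ end false e
        first {t} {e} k≡ eq = toℕ-injective (trans (sym (m-at {t} {e} k≡)) (trans eq (trans (cong (arrs σ aFst) k≡) (look fst≡ e))))
        second : ∀ {t e k} → k ≡ toℕ e → arrs σ (aM t) k ≢ arrs σ aFst k → m t e ≡ end true e
        second {t} {e} k≡ neq with m-end t e
        ... | inj₂ q = q
        ... | inj₁ q = contradiction (trans (m-at {t} {e} k≡) (trans (cong toℕ q) (sym (trans (cong (arrs σ aFst) k≡) (look fst≡ e))))) neq
        leaf : ∀ p q → m s i ≡ end p i → m t j ≡ end q j →
          Runs (1 :=ʷ aW p q at reg rI) σ (3 + r) (λ r′ σ′ → r ≤ r′ × wregs σ′ 1 ≡ weight s t)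
        leaf p q eq eq′ = straight (1 :=ʷ aW p q at reg rI) refl ≤-refl
          (≤-refl , trans (cong (warrs σ (aW p q)) I≡′) (trans (arc≡ p q i) (sym (cong₂ ρ eq eq′))))

      addCellᴿ : ∀ s t {σ r} → At σ →
        Runs (addCell s t) σ (duration (addCell s t) + r) (λ r′ σ′ → r ≤ r′ × At σ′ ×
          (∀ β → value (warrs σ′ aT) β ≈ value (warrs σ aT) β ∙
            (if does (β (blk i) ≟ᵇ s) ∧ does (β (blk j) ≟ᵇ t) then weight s t else 0#)))
      addCellᴿ s t {σ} {r} A = more (≤-reflexive (+-assoc (duration (choose s t)) _ r))
        (framed {choose s t} (chooseᴿ s t {r = duration rest + r} A) ⨟ᴿ
          λ { {r₁} {σ₁} (fr , le , w₁) → more le (straight rest refl ≤-refl (≤-refl , after σ₁ fr , grown σ₁ fr w₁)) })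
        where
        rest : Program
        rest = rK := (aOff at (aBlk at reg rI ⊕ aBlk at reg rI ⊕ const (bit s))) ⊕ (aBlk at reg rJ ⊕ aBlk at reg rJ ⊕ const (bit t)) ⨟
          aT [ reg rK ]:=ʷ aT at reg rK ⊕ reg 1
        after₁ : ∀ σ₁ → Frame (choose s t) σ σ₁ → At σ₁
        after₁ σ₁ fr = record
          { core = core-frame (choose s t) refl fr (core A)
          ; offs = λ u u< → trans (cong-app (arrs≡ fr aOff refl) u) (offs A u u<)
          ; I≡ = trans (regs≡ fr rI refl) (I≡ A) ; J≡ = trans (regs≡ fr rJ refl) (J≡ A) }
        after : ∀ σ₁ → Frame (choose s t) σ σ₁ → At (run rest σ₁)
        after σ₁ fr = let A₁ = after₁ σ₁ fr ; C = core A₁ in record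
          { core = record { N≡ = Core.N≡ C ; B≡ = Core.B≡ C ; fst≡ = Core.fst≡ C ; m≡ = Core.m≡ C ; blk≡ = Core.blk≡ C
              ; arc≡ = λ { false false i → Core.arc≡ C false false i ; false true i → Core.arc≡ C false true i
                         ; true false i → Core.arc≡ C true false i ; true true i → Core.arc≡ C true true i }
              ; nil≡ = Core.nil≡ C }
          ; offs = offs A₁ ; I≡ = I≡ A₁ ; J≡ = J≡ A₁ }
        grown : ∀ σ₁ → Frame (choose s t) σ σ₁ → wregs σ₁ 1 ≡ weight s t → ∀ β →
          value (warrs (run rest σ₁) aT) β ≈ value (warrs σ aT) β ∙
            (if does (β (blk i) ≟ᵇ s) ∧ does (β (blk j) ≟ᵇ t) then weight s t else 0#)
        grown σ₁ fr w₁ = value-add s t (blk<B i) (blk<B j) changed kept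
          where
          A₁ = after₁ σ₁ fr
          open Core (core A₁)
          key : ℕ
          key = idx R (blk i + blk i + bit s) (blk j + blk j + bit t)
          T₀ T₁ : ℕ → Carrier
          T₀ = warrs σ aT
          T₁ = warrs σ₁ aT
          T≡ : T₁ ≡ T₀
          T≡ = warrs≡ fr aT refl
          bi : arrs σ₁ aBlk (regs σ₁ rI) ≡ blk i
          bi = trans (cong (arrs σ₁ aBlk) (I≡ A₁)) (look blk≡ i)
          bj : arrs σ₁ aBlk (regs σ₁ rJ) ≡ blk j
          bj = trans (cong (arrs σ₁ aBlk) (J≡ A₁)) (look blk≡ j)
          K : ℕ
          K = arrs σ₁ aOff (arrs σ₁ aBlk (regs σ₁ rI) + arrs σ₁ aBlk (regs σ₁ rI) + bit s) + (arrs σ₁ aBlk (regs σ₁ rJ) + arrs σ₁ aBlk (regs σ₁ rJ) + bit t)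
          K≡ : K ≡ key
          K≡ = cong₂ _+_
            (trans (cong (λ b → arrs σ₁ aOff (b + b + bit s)) bi) (offs A₁ (blk i + blk i + bit s) (double-bit< s (blk<B i))))
            (cong (λ b → b + b + bit t) bj)
          changed : (T₁ [ K ↦ T₁ K ∙ wregs σ₁ 1 ]) key ≈ T₀ key ∙ weight s t
          changed = ≈-reflexive (trans (cong (T₁ [ K ↦ T₁ K ∙ wregs σ₁ 1 ]) (sym K≡))
            (trans (update-at T₁ K _) (cong₂ _∙_ (trans (cong T₁ K≡) (cong-app T≡ key)) w₁)))
          kept : ∀ k → k ≢ key → (T₁ [ K ↦ T₁ K ∙ wregs σ₁ 1 ]) k ≈ T₀ k
          kept k k≢ = ≈-reflexive (trans (update-off T₁ _ λ eq → k≢ (trans eq K≡)) (cong-app T≡ k))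

      arc : (ℕ → Bool) → Carrier
      arc β = weight (β (blk i)) (β (blk j))

      -- Of the four additions exactly one is seen by `β`, the one with its own bits at the two
      -- labels; the others add `0#`.
      four : ∀ β {x x₁ x₂ x₃ x₄} →
        let e = λ s t → if does (β (blk i) ≟ᵇ s) ∧ does (β (blk j) ≟ᵇ t) then weight s t else 0# in
        x₁ ≈ x ∙ e false false → x₂ ≈ x₁ ∙ e false true → x₃ ≈ x₂ ∙ e true false → x₄ ≈ x₃ ∙ e true true →
        x₄ ≈ x ∙ arc β
      four β p q r s with β (blk i) | β (blk j)
      ... | false | false = ≈-trans (≈-trans s (identityʳ _)) (≈-trans (≈-trans r (identityʳ _)) (≈-trans (≈-trans q (identityʳ _)) p))
      ... | false | true = ≈-trans (≈-trans s (identityʳ _)) (≈-trans (≈-trans r (identityʳ _)) (≈-trans q (∙-congʳ (≈-trans p (identityʳ _)))))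
      ... | true | false = ≈-trans (≈-trans s (identityʳ _)) (≈-trans r (∙-congʳ (≈-trans (≈-trans q (identityʳ _)) (≈-trans p (identityʳ _)))))
      ... | true | true = ≈-trans s (∙-congʳ (≈-trans (≈-trans r (identityʳ _)) (≈-trans (≈-trans q (identityʳ _)) (≈-trans p (identityʳ _)))))

    -- Padding lets the cyclic tour be summed over an initial segment, the shape required of a loop
    -- invariant.
    partial : ℕ → (ℕ → Bool) → Carrier
    partial k β = sumᵂ k (padded 0# (λ i → Edge.arc i β))

    tableᴿ : ∀ {s c} → Core s → Offsets s → (∀ k → warrs s aT k ≡ 0#) →
      Runs table s (6 + n * (8 + duration tableBody) + c) (λ r s′ → c ≤ r × Core s′ × Offsets s′ ×
        (∀ β → value (warrs s′ aT) β ≈ partial n β))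
    tableᴿ {s} {c} C₀ O₀ T₀ = forᴿ {body = tableBody} {d = duration tableBody} I refl refl refl (Core.N≡ C₀)
      (≤-refl , core-rI C₀ , O₀ , λ β → value-zero λ k → ≈-reflexive (T₀ k)) body (λ _ i → i)
      where
      I : ℕ → ℕ → State W → Set
      I k r s = c ≤ r × Core s × Offsets s × (∀ β → value (warrs s aT) β ≈ partial k β)
      body : ∀ {k r s} → k < n → regs s rI ≡ k → regs s rN ≡ n → I k r s →
        Runs tableBody s (duration tableBody + r) (λ r′ s′ → I (suc k) r′ (record s′ { regs = regs s′ [ rI ↦ suc k ] }))
      body {k} {r} {s} k<n sI sN (le , C , O , V) with at-fin k<n
      ... | i , refl =
        framed {successor} (successorᴿ {s} {4 * duration (addCell false false) + r} i sI sN) ⨟ᴿ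
        λ { {r₀} {s₀} (fr , le₀ , J≡) → more le₀ (
          addCellᴿ false false (record
            { core = core-frame successor refl fr C ; offs = λ u u< → trans (cong-app (arrs≡ fr aOff refl) u) (O u u<)
            ; I≡ = trans (regs≡ fr rI refl) sI ; J≡ = J≡ }) ⨟ᴿ
        λ { (le₁ , A₁ , V₁) → more le₁ (addCellᴿ false true A₁ ⨟ᴿ
        λ { (le₂ , A₂ , V₂) → more le₂ (addCellᴿ true false A₂ ⨟ᴿ
        λ { (le₃ , A₃ , V₃) → more le₃ (weaken (addCellᴿ true true A₃)
        λ { (le₄ , A₄ , V₄) → ≤-trans le le₄ , core-rI (At.core A₄) , At.offs A₄ , λ β →
          ≈-trans (four β (V₁ β) (V₂ β) (V₃ β) (V₄ β))
            (∙-cong (≈-trans (≈-reflexive (cong (λ T → value T β) (warrs≡ fr aT refl))) (V β))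
              (≈-reflexive (sym (padded-toℕ 0# (λ i → arc′ i β) i)))) }) }) }) }) }
        where
        open Edge i
        arc′ : Fin n → (ℕ → Bool) → Carrier
        arc′ i = Edge.arc i

-- Trying all choices and writing out the best.

module Enumerate where

  open Ram
  open Graph
  open Loads
  open Encoding
  open Table
  open import Data.Fin.Properties using (toℕ-injective; toℕ<n)
  open import Data.Unit.Base using (⊤; tt)
  open import Relation.Binary.Structures using (IsDecTotalOrder)

  aBits aBest : Name
  aBits = 10
  aBest = 11

  rA rC rGo rHave : Name
  rA = 9
  rC = 10
  rGo = 11
  rHave = 12

  rowBody cellBody evaluate copyBody copy record-best keep clear increment round enumerate outBody output phase₂ : Program
  cellBody = 1 :=ʷ reg 1 ⊕ aT at (reg rK ⊕ (reg rC ⊕ reg rC ⊕ aBits at reg rC))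
  rowBody = rK := aOff at (reg rA ⊕ reg rA ⊕ aBits at reg rA) ⨟ for rC rB cellBody
  -- Expressions have no constant weights; weight register 0 is never written and still holds the
  -- initial `0#`.
  evaluate = 1 :=ʷ reg 0 ⨟ for rA rB rowBody

  copyBody = aBest [ reg rA ]:= aBits at reg rA
  copy = for rA rB copyBody
  record-best = rHave := const 1 ⨟ 2 :=ʷ reg 1 ⨟ copy
  -- The first choice is stored unconditionally, as weight register 2 holds no cost before it.
  keep = branch (reg rHave == const 1 && reg 2 ≤ʷ reg 1) skip record-best

  clear = aBits [ reg rA ]:= const 0 ⨟ rA := reg rA ⊕ const 1
  increment = rA := const 0 ⨟ while (reg rA <' reg rB && aBits at reg rA == const 1) clear ⨟
    branch (reg rA <' reg rB) (aBits [ reg rA ]:= const 1) (rGo := const 0)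

  round = evaluate ⨟ keep ⨟ increment
  enumerate = rGo := const 1 ⨟ rHave := const 0 ⨟ while (reg rGo == const 1) round

  outBody = branch (aBest at (aBlk at reg rI) == const 0) (aOut [ reg rI ]:= aM₀ at reg rI) (aOut [ reg rI ]:= aM₁ at reg rI)
  output = for rI rN outBody

  phase₂ = offsets ⨟ table ⨟ enumerate ⨟ output

  evaluateCost keepCost incrementCost roundCost : ℕ → ℕ
  evaluateCost B = 2 + (6 + B * (8 + (8 + (6 + B * (8 + duration cellBody)))))
  keepCost B = 8 + (2 + (2 + (6 + B * (8 + duration copyBody))))
  incrementCost B = 2 + (9 + B * (9 + duration clear) + 8)
  roundCost B = evaluateCost B + (keepCost B + incrementCost B)

  module Enumeration (W : WeightDomain) {n : ℕ} (w : Weights W n) (fst snd : Fin n → Fin n)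
    (B : ℕ) (blk : Fin n → ℕ) (blk<B : ∀ e → blk e < B)
    (m : Bool → Fin n → Fin n) (m-end : ∀ t e → m t e ≡ fst e ⊎ m t e ≡ snd e) where
    open Logic W
    open WeightDomain W renaming (_≤?_ to _≼?_)
    open WeightSums W
    open WeightSums.Lookup W B
    open Tables W w fst snd B blk blk<B m m-end
    open IsDecTotalOrder isDecTotalOrder using () renaming (refl to ≼-refl; trans to ≼-trans; total to ≼-total; reflexive to ≼-reflexive)

    BitsAre : (ℕ → ℕ) → (ℕ → Bool) → Set
    BitsAre a β = ∀ j → j < B → a j ≡ bit (β j)

    evaluateᴿ : ∀ {s c} β → Core s → Offsets s → BitsAre (arrs s aBits) β →
      Runs evaluate s (evaluateCost B + c) (λ r s′ → c ≤ r × wregs s′ 1 ≈ value (warrs s aT) β)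
    evaluateᴿ {s₀} {c} β C O bits = straight-then (1 :=ʷ reg 0) refl ≤-refl
      (forᴿ {body = rowBody} {d = 8 + (6 + B * (8 + duration cellBody))} I refl refl refl (Core.B≡ C)
        (≤-refl , Core.B≡ C , refl , refl , refl , ≈-reflexive (Core.nil≡ C))
        row (λ { _ (le , _ , _ , _ , _ , v) → le , v }))
      where
      T = warrs s₀ aT
      I : ℕ → ℕ → State W → Set
      I k r s = c ≤ r × regs s rB ≡ B × warrs s aT ≡ T × arrs s aOff ≡ arrs s₀ aOff × arrs s aBits ≡ arrs s₀ aBits ×
        wregs s 1 ≈ sumᵂ k (λ a → sumᵂ B (λ b → T (cell β a b)))
      J : ℕ → ℕ → ℕ → State W → Set
      J a k r s = c ≤ r × regs s rB ≡ B × warrs s aT ≡ T × arrs s aOff ≡ arrs s₀ aOff × arrs s aBits ≡ arrs s₀ aBits ×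
        regs s rK ≡ node β a * R ×
        wregs s 1 ≈ sumᵂ a (λ a → sumᵂ B (λ b → T (cell β a b))) ∙ sumᵂ k (λ b → T (cell β a b))
      row : ∀ {k r s} → k < B → regs s rA ≡ k → regs s rB ≡ B → I k r s →
        Runs rowBody s (8 + (6 + B * (8 + duration cellBody)) + r)
          (λ r′ s′ → I (suc k) r′ (record s′ { regs = regs s′ [ rA ↦ suc k ] }))
      row {k} {r} {s} k< sA sB (le , _ , T≡ , O≡ , b≡ , v) =
        straight-then (rK := aOff at (reg rA ⊕ reg rA ⊕ aBits at reg rA)) refl ≤-refl
          (forᴿ {body = cellBody} {d = duration cellBody} (J k) refl refl refl sB
            (le , sB , T≡ , O≡ , b≡ , K≡ , ≈-trans v (≈-sym (identityʳ _)))
            cell-step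
            (λ { _ (le′ , sB′ , T≡′ , O≡′ , b≡′ , _ , v′) → le′ , sB′ , T≡′ , O≡′ , b≡′ , v′ }))
        where
        bit-at : ∀ {s j} → j < B → arrs s aBits ≡ arrs s₀ aBits → arrs s aBits j ≡ bit (β j)
        bit-at {s} {j} j< eq = trans (cong-app eq j) (bits j j<)
        K≡ : arrs s aOff (regs s rA + regs s rA + arrs s aBits (regs s rA)) ≡ node β k * R
        K≡ = trans (cong (λ a → arrs s aOff (a + a + arrs s aBits a)) sA)
          (trans (cong-app O≡ _) (trans (cong (λ x → arrs s₀ aOff (k + k + x)) (bit-at {s} k< b≡)) (O _ (double-bit< (β k) k<))))
        cell-step : ∀ {k′ r s} → k′ < B → regs s rC ≡ k′ → regs s rB ≡ B → J k k′ r s →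
          Runs cellBody s (duration cellBody + r)
            (λ r′ s′ → J k (suc k′) r′ (record s′ { regs = regs s′ [ rC ↦ suc k′ ] }))
        cell-step {k′} {r} {s} k′< sC sB (le , _ , T≡ , O≡ , b≡ , sK , v) = straight cellBody refl ≤-refl
          (le , sB , T≡ , O≡ , b≡ , sK , ≈-trans (∙-cong v (≈-reflexive (trans (cong-app T≡ _) (cong T addr)))) (assoc _ _ _))
          where
          addr : regs s rK + (regs s rC + regs s rC + arrs s aBits (regs s rC)) ≡ cell β k k′
          addr = cong₂ _+_ sK (trans (cong (λ b → b + b + arrs s aBits b) sC) (cong (k′ + k′ +_) (bit-at {s} k′< b≡)))

    record Best (s : State W) (T : ℕ → Carrier) (seen : (ℕ → Bool) → Set) : Set where
      field
        γ      : ℕ → Bool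
        have   : regs s rHave ≡ 1
        stored : BitsAre (arrs s aBest) γ
        cost≡  : wregs s 2 ≈ value T γ
        least  : ∀ β → seen β → value T γ ≼ value T β
    open Best

    BestSoFar : State W → (ℕ → Carrier) → ℕ → Set
    BestSoFar s T v = (v ≡ 0 × regs s rHave ≡ 0) ⊎ Best s T (λ β → val B β < v)

    keepᴿ : ∀ {s c T v} β → regs s rB ≡ B → BitsAre (arrs s aBits) β → val B β ≡ v → wregs s 1 ≈ value T β →
      BestSoFar s T v → Runs keep s (keepCost B + c) (λ r s′ → c ≤ r × Best s′ T (λ β → val B β < suc v))
    keepᴿ {s} {c} {T} {v} β sB bits vβ acc best = branchᴿ {c′ = 2 + (2 + (6 + B * (8 + duration copyBody))) + c} ≤-refl
      (λ t → straight skip {r = c} refl (s≤s (m≤n+m c (9 + B * 12))) (≤-refl , skipped t best))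
      (λ t → straight-then (rHave := const 1) refl ≤-refl (straight-then (2 :=ʷ reg 1) refl ≤-refl
        (forᴿ {body = copyBody} {d = 4} I refl refl refl sB
          (≤-refl , refl , refl , acc , λ j ())
          copy-step
          (λ { _ (le , h , _ , cost , st) → le , record { γ = β ; have = h ; stored = st ; cost≡ = cost ; least = replaced t best } }))))
      where
      test : Test
      test = reg rHave == const 1 && reg 2 ≤ʷ reg 1
      I : ℕ → ℕ → State W → Set
      I k r s′ = c ≤ r × regs s′ rHave ≡ 1 × arrs s′ aBits ≡ arrs s aBits × wregs s′ 2 ≈ value T β ×
        (∀ j → j < k → arrs s′ aBest j ≡ bit (β j))
      copy-step : ∀ {k r s} → k < B → regs s rA ≡ k → regs s rB ≡ B → I k r s →
        Runs copyBody s (4 + r) (λ r′ s′ → I (suc k) r′ (record s′ { regs = regs s′ [ rA ↦ suc k ] }))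
      copy-step {k} {r} {s′} k< sA _ (le , h , b≡ , cost , st) = straight copyBody refl ≤-refl (le , h , b≡ , cost , st′)
        where
        st′ : ∀ j → j < suc k → (arrs s′ aBest [ regs s′ rA ↦ arrs s′ aBits (regs s′ rA) ]) j ≡ bit (β j)
        st′ j j< with j ≟ k
        ... | yes refl = trans (cong (arrs s′ aBest [ regs s′ rA ↦ arrs s′ aBits (regs s′ rA) ]) (sym sA))
                (trans (update-at (arrs s′ aBest) _ _) (trans (cong (arrs s′ aBits) sA) (trans (cong-app b≡ j) (bits j k<))))
        ... | no j≢ = trans (update-off (arrs s′ aBest) _ λ eq → j≢ (trans eq sA)) (st j (≤∧≢⇒< (≤-pred j<) j≢))
      -- A choice with counter value exactly `v` agrees with `β` below `B`, hence has the same
      -- value. This is how one evaluation covers all functions with the same bits.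
      new : ∀ γ → val B γ < suc v → val B γ < v ⊎ value T β ≈ value T γ
      new γ lt with val B γ ≟ v
      ... | yes eq = inj₂ (value-cong {T} (val-injective B (trans vβ (sym eq))))
      ... | no neq = inj₁ (≤∧≢⇒< (≤-pred lt) neq)
      skipped : ⟦_⟧ᵗ W test s ≡ true → BestSoFar s T v → Best s T (λ β → val B β < suc v)
      skipped t (inj₁ (_ , h)) = contradiction (trans (sym (==-true (∧-trueˡ t))) h) λ ()
      skipped t (inj₂ b) = record { γ = γ b ; have = have b ; stored = stored b ; cost≡ = cost≡ b ; least = least′ }
        where
        least′ : ∀ δ → val B δ < suc v → value T (γ b) ≼ value T δ
        least′ δ lt with new δ lt
        ... | inj₁ lt′ = least b δ lt′
        ... | inj₂ eq = ≼-trans (≼-reflexive (≈-sym (cost≡ b)))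
          (≼-trans (does-true (wregs s 2 ≼? wregs s 1) (∧-trueʳ {does (regs s rHave ≟ 1)} t)) (≼-reflexive (≈-trans acc eq)))
      replaced : ⟦_⟧ᵗ W test s ≡ false → BestSoFar s T v → ∀ δ → val B δ < suc v → value T β ≼ value T δ
      replaced t best δ lt with new δ lt
      ... | inj₂ eq = ≼-reflexive eq
      ... | inj₁ lt′ with best
      ...   | inj₁ (refl , _) = contradiction lt′ λ ()
      ...   | inj₂ b = ≼-trans better (least b δ lt′)
        where
        not-better : does (wregs s 2 ≼? wregs s 1) ≡ false
        not-better = trans (cong (_∧ does (wregs s 2 ≼? wregs s 1)) (sym (dec-true (regs s rHave ≟ 1) (have b)))) t
        better : value T β ≼ value T (γ b)
        better with ≼-total (wregs s 1) (wregs s 2)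
        ... | inj₁ le = ≼-trans (≼-reflexive (≈-sym acc)) (≼-trans le (≼-reflexive (cost≡ b)))
        ... | inj₂ ge = contradiction ge (does-false (wregs s 2 ≼? wregs s 1) not-better)

    -- The carry loop preserves `val B β + 2 ^ a = suc v`: clearing bit `a` removes `2 ^ a` and
    -- doubles the pending carry. A free bit absorbs the carry; if it leaves the `B` bits, all
    -- choices have been seen.
    incrementᴿ : ∀ {s c v} β → regs s rB ≡ B → BitsAre (arrs s aBits) β → val B β ≡ v →
      Runs increment s (incrementCost B + c) (λ r s′ → c ≤ r ×
        ((∃ λ β′ → BitsAre (arrs s′ aBits) β′ × val B β′ ≡ suc v × regs s′ rGo ≡ regs s rGo) ⊎
         (2 ^ B ≤ suc v × regs s′ rGo ≡ 0)))
    incrementᴿ {s₀} {c} {v} β₀ sB₀ bits₀ v₀ = straight-then (rA := const 0) refl ≤-refl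
      (whileᴿ {p = clear} J loop (β₀ , 0 , B , refl , refl , refl , sB₀ , bits₀ , trans (cong (_+ 1) v₀) (+-comm v 1)
          , ≤-reflexive (cong (_+ c) (+-comm 8 (9 + B * 16))))
       ⨟ᴿ λ { {r} {s} (le , β , a , sA , sGo , sB , bits , inv , stop) → finish s le β a sA sGo sB bits inv stop })
      where
      test : Test
      test = reg rA <' reg rB && aBits at reg rA == const 1
      Post : ℕ → State W → Set
      Post r s′ = c ≤ r ×
        ((∃ λ β′ → BitsAre (arrs s′ aBits) β′ × val B β′ ≡ suc v × regs s′ rGo ≡ regs s₀ rGo) ⊎
         (2 ^ B ≤ suc v × regs s′ rGo ≡ 0))
      J : ℕ → State W → Set
      -- 16 units per carried bit, 9 for the test and 7 for `clear`; of the 17 others, 9 pay for the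
      -- final test and 8 for the branch.
      J r s = ∃₂ λ β a → ∃ λ j → a + j ≡ B × regs s rA ≡ a × regs s rGo ≡ regs s₀ rGo × regs s rB ≡ B ×
        BitsAre (arrs s aBits) β × val B β + 2 ^ a ≡ suc v × 17 + j * 16 + c ≤ r
      Mid : ℕ → State W → Set
      Mid r s = 8 + c ≤ r × ∃₂ λ β a → regs s rA ≡ a × regs s rGo ≡ regs s₀ rGo × regs s rB ≡ B ×
        BitsAre (arrs s aBits) β × val B β + 2 ^ a ≡ suc v × ((a < B × β a ≡ false) ⊎ a ≡ B)

      finish : ∀ s {r} → 8 + c ≤ r → ∀ β a → regs s rA ≡ a → regs s rGo ≡ regs s₀ rGo → regs s rB ≡ B →
        BitsAre (arrs s aBits) β → val B β + 2 ^ a ≡ suc v → (a < B × β a ≡ false) ⊎ a ≡ B →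
        Runs (branch (reg rA <' reg rB) (aBits [ reg rA ]:= const 1) (rGo := const 0)) s r Post
      finish s le β a sA sGo sB bits inv stop = more le (branchᴿ {c′ = 4 + c} ≤-refl
        (λ t → straight (aBits [ reg rA ]:= const 1) refl (n≤1+n _)
          (≤-refl , inj₁ (β [ a ↦ true ] , bits′ , val′ (subst₂ _<_ sA sB (does-true (regs s rA <? regs s rB) t)) stop , sGo)))
        (λ t → straight (rGo := const 0) refl (m≤n+m _ 2)
          (≤-refl , inj₂ (overflow (λ lt → does-false (regs s rA <? regs s rB) t (subst₂ _<_ (sym sA) (sym sB) lt)) stop , refl))))
        where
        bits′ : BitsAre (arrs s aBits [ regs s rA ↦ 1 ]) (β [ a ↦ true ])
        bits′ j j< with j ≟ a
        ... | yes refl = trans (trans (cong (arrs s aBits [ regs s rA ↦ 1 ]) (sym sA)) (update-at (arrs s aBits) _ _)) (cong bit (sym (update-at β j true)))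
        ... | no j≢ = trans (update-off (arrs s aBits) _ λ eq → j≢ (trans eq sA)) (trans (bits j j<) (cong bit (sym (update-off β true j≢))))
        val′ : a < B → (a < B × β a ≡ false) ⊎ a ≡ B → val B (β [ a ↦ true ]) ≡ suc v
        val′ lt (inj₂ refl) = contradiction lt (<-irrefl refl)
        val′ lt (inj₁ (_ , z)) = trans (sym (+-identityʳ _)) (trans (cong (λ b → val B (β [ a ↦ true ]) + bit b * 2 ^ a) (sym z))
          (trans (val-set B β a true lt) (trans (cong (val B β +_) (*-identityˡ _)) inv)))
        overflow : ¬ (a < B) → (a < B × β a ≡ false) ⊎ a ≡ B → 2 ^ B ≤ suc v
        overflow ≮ (inj₁ (lt , _)) = contradiction lt ≮
        overflow ≮ (inj₂ refl) = ≤-trans (m≤n+m (2 ^ B) (val B β)) (≤-reflexive inv)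

      loop : ∀ {r s} → J r s →
        (⟦_⟧ᵗ W test s ≡ false × ∃ λ r′ → 9 + r′ ≤ r × Mid r′ s) ⊎
        (⟦_⟧ᵗ W test s ≡ true × ∃ λ r′ → 9 + r′ ≤ r × Runs clear s r′ J)
      loop {r} {s} (β , a , zero , a+0 , sA , sGo , sB , bits , inv , le) = inj₁
        ( cong (_∧ does (arrs s aBits (regs s rA) ≟ 1)) (dec-false (regs s rA <? regs s rB) (<-irrefl (trans sA (trans (trans (sym (+-identityʳ a)) a+0) (sym sB)))))
        , 8 + c , le , ≤-refl , β , a , sA , sGo , sB , bits , inv , inj₂ (trans (sym (+-identityʳ a)) a+0))
      loop {r} {s} (β , a , suc j , a+j , sA , sGo , sB , bits , inv , le) = go (split (β a))
        where
        a<B : a < B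
        a<B = subst (a <_) a+j (m<m+n a z<s)
        at-a : arrs s aBits (regs s rA) ≡ bit (β a)
        at-a = trans (cong (arrs s aBits) sA) (bits a a<B)
        in-range : does (regs s rA <? regs s rB) ≡ true
        in-range = dec-true (regs s rA <? regs s rB) (subst₂ _<_ (sym sA) (sym sB) a<B)
        bits′ : BitsAre (arrs s aBits [ regs s rA ↦ 0 ]) (β [ a ↦ false ])
        bits′ i i< with i ≟ a
        ... | yes refl = trans (trans (cong (arrs s aBits [ regs s rA ↦ 0 ]) (sym sA)) (update-at (arrs s aBits) _ _)) (cong bit (sym (update-at β i false)))
        ... | no i≢ = trans (update-off (arrs s aBits) _ λ eq → i≢ (trans eq sA)) (trans (bits i i<) (cong bit (sym (update-off β false i≢))))
        inv′ : β a ≡ true → val B (β [ a ↦ false ]) + 2 ^ suc a ≡ suc v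
        inv′ one = trans (cong (val B (β [ a ↦ false ]) +_) (2^-double a)) (trans (sym (+-assoc _ (2 ^ a) (2 ^ a)))
          (trans (cong (_+ 2 ^ a) cleared) inv))
          where
          cleared : val B (β [ a ↦ false ]) + 2 ^ a ≡ val B β
          cleared = trans (cong (val B (β [ a ↦ false ]) +_) (sym (*-identityˡ _)))
            (trans (cong (λ b → val B (β [ a ↦ false ]) + bit b * 2 ^ a) (sym one)) (trans (val-set B β a false a<B) (+-identityʳ _)))
        go : β a ≡ true ⊎ β a ≡ false →
          (⟦_⟧ᵗ W test s ≡ false × ∃ λ r′ → 9 + r′ ≤ r × Mid r′ s) ⊎
          (⟦_⟧ᵗ W test s ≡ true × ∃ λ r′ → 9 + r′ ≤ r × Runs clear s r′ J)
        go (inj₂ z) = inj₁ (trans (cong (_∧ does (arrs s aBits (regs s rA) ≟ 1)) in-range)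
              (dec-false (arrs s aBits (regs s rA) ≟ 1) (λ eq → contradiction (trans (sym (trans at-a (cong bit z))) eq) λ ()))
            , 8 + c , ≤-trans (+-monoˡ-≤ c (m≤m+n 17 (suc j * 16))) le , ≤-refl , β , a , sA , sGo , sB , bits , inv , inj₁ (a<B , z))
        go (inj₁ one) = inj₂ (trans (cong (_∧ does (arrs s aBits (regs s rA) ≟ 1)) in-range)
              (dec-true (arrs s aBits (regs s rA) ≟ 1) (trans at-a (cong bit one)))
            , 7 + (17 + j * 16 + c) , le
            , straight clear refl ≤-refl
              (β [ a ↦ false ] , suc a , j , trans (sym (+-suc a j)) a+j , trans (cong (_+ 1) sA) (+-comm a 1) , sGo , sB
              , bits′ , inv′ one , ≤-refl))

    best-frame : ∀ p {s s′ T S} → writesReg rHave p ≡ false → writesArr aBest p ≡ false → writesWReg 2 p ≡ false →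
      Frame p s s′ → Best s T S → Best s′ T S
    best-frame p q₁ q₂ q₃ fr b = record
      { γ = γ b ; have = trans (regs≡ fr rHave q₁) (have b)
      ; stored = λ j j< → trans (cong-app (arrs≡ fr aBest q₂) j) (stored b j j<)
      ; cost≡ = ≈-trans (≈-reflexive (wregs≡ fr 2 q₃)) (cost≡ b) ; least = least b }

    so-far-frame : ∀ p {s s′ T v} → writesReg rHave p ≡ false → writesArr aBest p ≡ false → writesWReg 2 p ≡ false →
      Frame p s s′ → BestSoFar s T v → BestSoFar s′ T v
    so-far-frame p q₁ q₂ q₃ fr (inj₁ (v , h)) = inj₁ (v , trans (regs≡ fr rHave q₁) h)
    so-far-frame p q₁ q₂ q₃ fr (inj₂ b) = inj₂ (best-frame p q₁ q₂ q₃ fr b)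

    enumerateᴿ : ∀ {s c} → Core s → Offsets s → (∀ j → arrs s aBits j ≡ 0) →
      Runs enumerate s (2 + (2 + (4 + 2 ^ B * (4 + roundCost B) + c))) (λ r s′ → c ≤ r × Core s′ × Best s′ (warrs s aT) (λ _ → ⊤))
    enumerateᴿ {s₀} {c} C₀ O₀ zeros = straight-then (rGo := const 1) refl ≤-refl (straight-then (rHave := const 0) refl ≤-refl
      (whileᴿ {p = round} I loop
        (core-regs C₀ , O₀ , refl , inj₁ ((λ _ → false) , 0 , pred (2 ^ B) , 2^B≡ , refl , (λ j _ → zeros j) , val-zero B
          , inj₁ (refl , refl) , ≤-reflexive (cong (λ z → 4 + z * (4 + roundCost B) + c) 2^B≡)))))
      where
      T : ℕ → Carrier
      T = warrs s₀ aT
      core-regs : ∀ {s} → Core s → Core (record s { regs = (regs s [ rGo ↦ 1 ]) [ rHave ↦ 0 ] })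
      core-regs C = record { N≡ = Core.N≡ C ; B≡ = Core.B≡ C ; fst≡ = Core.fst≡ C ; m≡ = Core.m≡ C ; blk≡ = Core.blk≡ C
              ; arc≡ = Core.arc≡ C ; nil≡ = Core.nil≡ C }
      2^B≡ : suc (pred (2 ^ B)) ≡ 2 ^ B
      2^B≡ = suc-pred (2 ^ B) {{m^n≢0 2 B}}
      val-zero : ∀ k → val k (λ _ → false) ≡ 0
      val-zero zero = refl
      val-zero (suc k) = trans (+-identityʳ _) (val-zero k)
      Running Stopped I : ℕ → State W → Set
      Running r s = ∃₂ λ β v → ∃ λ j → v + suc j ≡ 2 ^ B × regs s rGo ≡ 1 × BitsAre (arrs s aBits) β × val B β ≡ v ×
        BestSoFar s T v × 4 + suc j * (4 + roundCost B) + c ≤ r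
      Stopped r s = regs s rGo ≡ 0 × Best s T (λ _ → ⊤) × 4 + c ≤ r
      I r s = Core s × Offsets s × warrs s aT ≡ T × (Running r s ⊎ Stopped r s)
      loop : ∀ {r s} → I r s →
        (⟦_⟧ᵗ W (reg rGo == const 1) s ≡ false × ∃ λ r′ → 4 + r′ ≤ r × (c ≤ r′ × Core s × Best s T (λ _ → ⊤))) ⊎
        (⟦_⟧ᵗ W (reg rGo == const 1) s ≡ true × ∃ λ r′ → 4 + r′ ≤ r × Runs round s r′ I)
      loop {r} {s} (C , O , T≡ , inj₂ (stop , b , le)) = inj₁ (dec-false (regs s rGo ≟ 1) (λ eq → contradiction (trans (sym stop) eq) λ ())
        , c , le , ≤-refl , C , b)
      loop {r} {s} (C , O , T≡ , inj₁ (β , v , j , v+j , go , bits , vβ , best , le)) = inj₂ (dec-true (regs s rGo ≟ 1) go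
        , roundCost B + rest , ≤-trans (≤-reflexive (lem (roundCost B) (j * (4 + roundCost B)) c)) le
        , more (≤-reflexive (sym (trans (+-assoc (evaluateCost B) (keepCost B + incrementCost B) rest) (cong (evaluateCost B +_) (+-assoc (keepCost B) (incrementCost B) rest)))))
          (framed {evaluate} (evaluateᴿ {c = keepCost B + (incrementCost B + rest)} β C O bits) ⨟ᴿ λ { {r₁} {s₁} (fr₁ , le₁ , acc) → more le₁
          (framed {keep} (keepᴿ {c = incrementCost B + rest} {T = T} {v = v} β
            (trans (regs≡ fr₁ rB refl) (Core.B≡ C)) (λ i i< → trans (cong-app (arrs≡ fr₁ aBits refl) i) (bits i i<)) vβ
            (≈-trans acc (≈-reflexive (cong (λ t → value t β) T≡)))
            (so-far-frame evaluate refl refl refl fr₁ best)) ⨟ᴿ λ { {r₂} {s₂} (fr₂ , le₂ , best₂) → more le₂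
          (weaken (framed {increment} (incrementᴿ {c = rest} β
              (trans (regs≡ fr₂ rB refl) (trans (regs≡ fr₁ rB refl) (Core.B≡ C)))
              (λ i i< → trans (cong-app (arrs≡ fr₂ aBits refl) i) (trans (cong-app (arrs≡ fr₁ aBits refl) i) (bits i i<))) vβ))
            λ { {r₃} {s₃} (fr₃ , le₃ , out) →
              core-frame increment refl fr₃ (core-frame keep refl fr₂ (core-frame evaluate refl fr₁ C))
              , (λ u u< → trans (cong-app (trans (arrs≡ fr₃ aOff refl) (trans (arrs≡ fr₂ aOff refl) (arrs≡ fr₁ aOff refl))) u) (O u u<))
              , trans (warrs≡ fr₃ aT refl) (trans (warrs≡ fr₂ aT refl) (trans (warrs≡ fr₁ aT refl) T≡))
              , next-state le₃ (best-frame increment refl refl refl fr₃ best₂)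
                  (trans (regs≡ fr₂ rGo refl) (trans (regs≡ fr₁ rGo refl) go)) out }) }) }))
        where
        rest : ℕ
        rest = 4 + j * (4 + roundCost B) + c
        lem : ∀ x y c → 4 + (x + (4 + y + c)) ≡ 4 + ((4 + x) + y) + c
        lem = solve-∀
        next-state : ∀ {r₃ s₃ g} → rest ≤ r₃ → Best s₃ T (λ δ → val B δ < suc v) → g ≡ 1 →
          (∃ λ β′ → BitsAre (arrs s₃ aBits) β′ × val B β′ ≡ suc v × regs s₃ rGo ≡ g) ⊎ (2 ^ B ≤ suc v × regs s₃ rGo ≡ 0) →
          Running r₃ s₃ ⊎ Stopped r₃ s₃
        next-state le₃ b _ (inj₂ (full , stop)) = inj₂ (stop
          , record { γ = γ b ; have = have b ; stored = stored b ; cost≡ = cost≡ b ; least = λ δ _ → least b δ (<-≤-trans (val<2^ B δ) full) }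
          , ≤-trans (+-monoˡ-≤ c (m≤m+n 4 _)) le₃)
        next-state le₃ b g≡ (inj₁ (β′ , bits′ , vβ′ , go′)) = inj₁ (continue j v+j le₃)
          where
          continue : ∀ j {r₃} → v + suc j ≡ 2 ^ B → 4 + j * (4 + roundCost B) + c ≤ r₃ → Running r₃ _
          -- With no round left the new counter value would be `2 ^ B`, which exceeds what `B` bits
          -- represent.
          continue zero eq _ = contradiction (val<2^ B β′) (≤⇒≯ (≤-reflexive (trans (sym eq) (trans (+-comm v 1) (sym vβ′)))))
          continue (suc j) eq le = β′ , suc v , j , trans (sym (+-suc v (suc j))) eq , trans go′ g≡ , bits′ , vβ′ , inj₂ b , le

    outputᴿ : ∀ {s c T S} → Core s → (b : Best s T S) →
      Runs output s (6 + n * (8 + 10) + c) (λ _ s′ → ∀ i → arrs s′ aOut (toℕ i) ≡ toℕ (m (γ b (blk i)) i))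
    outputᴿ {s₀} {c} C₀ b = forᴿ {body = outBody} {d = 10} I refl refl refl (Core.N≡ C₀)
      (core-rI C₀ , stored b , λ i ()) body (λ { _ (_ , _ , out) i → out i (toℕ<n i) })
      where
      I : ℕ → ℕ → State W → Set
      I k r s = Core s × BitsAre (arrs s aBest) (γ b) × (∀ i → toℕ i < k → arrs s aOut (toℕ i) ≡ toℕ (m (γ b (blk i)) i))
      body : ∀ {k r s} → k < n → regs s rI ≡ k → regs s rN ≡ n → I k r s →
        Runs outBody s (10 + r) (λ r′ s′ → I (suc k) r′ (record s′ { regs = regs s′ [ rI ↦ suc k ] }))
      body {k} {r} {s} k<n sI sN (C , st , out) with at-fin k<n
      ... | i , refl = branchᴿ {c′ = 4 + r} ≤-refl
          (λ t → straight (aOut [ reg rI ]:= aM₀ at reg rI) refl ≤-refl (after C , st , write false (pick-false (==-true t))))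
          (λ t → straight (aOut [ reg rI ]:= aM₁ at reg rI) refl ≤-refl (after C , st , write true (pick-true (==-false t))))
        where
        after : ∀ {a} → Core s → Core (record s { regs = regs s [ rI ↦ suc (toℕ i) ] ; arrs = arrs s [ aOut ↦ a ] })
        after C = record { N≡ = Core.N≡ C ; B≡ = Core.B≡ C ; fst≡ = Core.fst≡ C
          ; m≡ = λ { true → Core.m≡ C true ; false → Core.m≡ C false } ; blk≡ = Core.blk≡ C
          ; arc≡ = Core.arc≡ C ; nil≡ = Core.nil≡ C }
        flag : arrs s aBest (arrs s aBlk (regs s rI)) ≡ bit (γ b (blk i))
        flag = trans (cong (arrs s aBest) (trans (cong (arrs s aBlk) sI) (look (Core.blk≡ C) i))) (st (blk i) (blk<B i))
        pick-false : arrs s aBest (arrs s aBlk (regs s rI)) ≡ 0 → γ b (blk i) ≡ false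
        pick-false eq with γ b (blk i) | flag
        ... | false | _ = refl
        ... | true | f = contradiction (trans (sym f) eq) λ ()
        pick-true : arrs s aBest (arrs s aBlk (regs s rI)) ≢ 0 → γ b (blk i) ≡ true
        pick-true neq with γ b (blk i) | flag
        ... | true | _ = refl
        ... | false | f = contradiction f neq
        write : ∀ t → γ b (blk i) ≡ t → ∀ j → toℕ j < suc (toℕ i) →
          (arrs s aOut [ regs s rI ↦ arrs s (aM t) (regs s rI) ]) (toℕ j) ≡ toℕ (m (γ b (blk j)) j)
        write t eq j j≤i with toℕ j ≟ toℕ i
        ... | no j≢i = trans (update-off (arrs s aOut) _ λ e → j≢i (trans e sI)) (out j (≤∧≢⇒< (≤-pred j≤i) j≢i))
        ... | yes j≡i with toℕ-injective j≡i
        ...   | refl = trans (cong (arrs s aOut [ regs s rI ↦ arrs s (aM t) (regs s rI) ]) (sym sI))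
                (trans (update-at (arrs s aOut) _ _) (trans (cong (arrs s (aM t)) sI)
                  (trans (look (Core.m≡ C t) j) (cong (λ u → toℕ (m u j)) (sym eq)))))

    budget₂ : ℕ
    budget₂ = 4 + (2 + (6 + (B + B) * 15 + (6 + n * (8 + duration tableBody) +
      (2 + (2 + (4 + 2 ^ B * (4 + roundCost B) + (6 + n * 18 + 0)))))))

    phase₂ᴿ : ∀ {s} → Core s → (∀ k → warrs s aT k ≡ 0#) → (∀ j → arrs s aBits j ≡ 0) →
      Runs phase₂ s budget₂ (λ _ s′ → ∃ λ γ → (∀ i → arrs s′ aOut (toℕ i) ≡ toℕ (m (γ (blk i)) i)) ×
        (∀ β → cost W w (λ i → m (γ (blk i)) i) ≼ cost W w (λ i → m (β (blk i)) i)))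
    phase₂ᴿ {s} C T0 b0 =
      framed {offsets} (offsetsᴿ {c = c₁} C) ⨟ᴿ λ { {r₁} {s₁} (fr₁ , le₁ , C₁ , O₁ , T₁) → more le₁
      (framed {table} (tableᴿ {c = c₂} C₁ O₁ (λ k → trans (cong-app T₁ k) (T0 k))) ⨟ᴿ λ { {r₂} {s₂} (fr₂ , le₂ , C₂ , O₂ , V) → more le₂
      (enumerateᴿ {c = c₃} C₂ O₂ (λ j → trans (cong-app (trans (arrs≡ fr₂ aBits refl) (arrs≡ fr₁ aBits refl)) j) (b0 j)) ⨟ᴿ
        λ { (le₃ , C₃ , b) → more le₃ (weaken (outputᴿ {c = 0} C₃ b) λ out → γ b , out ,
          λ β → ≼-trans (≼-reflexive (≈-trans (≈-sym (sumᵂ-padded (λ i → Edge.arc i (γ b)))) (≈-sym (V (γ b)))))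
                  (≼-trans (least b β tt) (≼-reflexive (≈-trans (V β) (sumᵂ-padded (λ i → Edge.arc i β)))))) }) }) }
      where
      c₁ c₂ c₃ : ℕ
      c₃ = 6 + n * 18 + 0
      c₂ = 2 + (2 + (4 + 2 ^ B * (4 + roundCost B) + c₃))
      c₁ = 6 + n * (8 + duration tableBody) + c₂

-- The solver, its correctness and its running time.

module Solver where

  open Ram
  open Graph
  open Loads
  open Peel
  open Walk
  open Labelling
  open Encoding
  open Table
  open Enumerate
  import Algebra.Properties.CommutativeMonoid.Sum as Sum
  open import Function.Bundles using (Equivalence)
  open import Relation.Binary.Structures using (IsDecTotalOrder)

  solver : Program
  solver = phase₁ ⨟ phase₂

  module _ {n : ℕ} {G : BipartiteGraph n} (L : Listing G) where
    open Listing L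
    open Incidence fst snd

    feasible⇒matching : ∀ {f} → IsFeasibleSolution G f → Matching f
    feasible⇒matching {f} ((inj , _) , f∈) = inj , λ i → Equivalence.to (lists i (f i)) (f∈ i)

    matching⇒feasible : ∀ {f} → Matching f → IsFeasibleSolution G f
    matching⇒feasible {f} (inj , ends) =
      (inj , λ y → proj₁ (injective⇒hits f inj y) , λ { refl → proj₂ (injective⇒hits f inj y) }) ,
      λ i → Equivalence.from (lists i (f i)) (ends i)

  time : ℕ → ℕ → ℕ
  time n B = (6 + n * (8 + duration buildBody) + (6 + n * 15 + (n * (5 + duration peelStep) + (2 + (6 + n * 27 + (n * (5 + duration walkStep) + 0))))))
    + (4 + (2 + (6 + (B + B) * 15 + (6 + n * (8 + duration tableBody) +
      (2 + (2 + (4 + 2 ^ B * (4 + roundCost B) + (6 + n * 18 + 0))))))))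

  module Solving (W : WeightDomain) {n : ℕ} {G : BipartiteGraph n} (L : Listing G) (w : Weights W n)
    {f₀ : Fin n → Fin n} (f₀-feasible : IsFeasibleSolution G f₀) where
    open Logic W
    open Listing L
    open Incidence fst snd
    open Weights w
    open WeightDomain W using (_≈_; _≼_; 0#; commutativeMonoid; isDecTotalOrder)
    open WeightSums W using (≈-reflexive)
    open IsDecTotalOrder isDecTotalOrder using () renaming (trans to ≼-trans; reflexive to ≼-reflexive)
    open Build W fst snd using (Input; input)
    open Labels W fst snd (feasible⇒matching L f₀-feasible) using (budget; Labelled₁; phase₁ᴿ)

    s₀ : State W
    s₀ = initial W w L

    -- The certificate is returned together with the run, since it ties the number of labels in the
    -- time bound to the number of perfect matchings.
    Solved : Set
    Solved = ∃₂ λ B blk → ∃ λ m → Certificate fst snd B blk m × (∃ λ t → t ≤ time n B × SolvesInTime W w solver L t)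

    labelled⇒solved : Runs phase₁ s₀ budget (λ _ s₁ → Frame phase₁ s₀ s₁ × Labelled₁ s₁) → Solved
    labelled⇒solved (t₁ , s₁ , d₁ , r₁ , le₁ , fr , I , B , blk , m , cert , B≡ , blk≡ , m≡) = B , blk , m , cert , second
      where
      open Certificate cert
      m-end : ∀ t e → m t e ≡ fst e ⊎ m t e ≡ snd e
      m-end t e = proj₂ (sound (λ _ → t)) e
      open Enumeration W w fst snd B blk blk<B m m-end
      open Tables W w fst snd B blk blk<B m m-end using (Core; end; aW)
      arc≡ : ∀ p q i → warrs s₁ (aW p q) (toℕ i) ≡ ρ (end p i) (end q (next i))
      arc≡ false false i = trans (cong-app (warrs≡ fr 0 refl) (toℕ i)) (padded-toℕ 0# _ i)
      arc≡ false true i = trans (cong-app (warrs≡ fr 1 refl) (toℕ i)) (padded-toℕ 0# _ i)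
      arc≡ true false i = trans (cong-app (warrs≡ fr 2 refl) (toℕ i)) (padded-toℕ 0# _ i)
      arc≡ true true i = trans (cong-app (warrs≡ fr 3 refl) (toℕ i)) (padded-toℕ 0# _ i)
      core : Core s₁
      core = record { N≡ = Input.size≡ I ; B≡ = B≡ ; fst≡ = Input.fst≡ I ; m≡ = m≡ ; blk≡ = blk≡ ; arc≡ = arc≡
                    ; nil≡ = wregs≡ fr 0 refl }
      conclude : Runs phase₂ s₁ budget₂ (λ _ s′ → ∃ λ γ → (∀ i → arrs s′ aOut (toℕ i) ≡ toℕ (m (γ (blk i)) i)) ×
        (∀ β → cost W w (λ i → m (γ (blk i)) i) ≼ cost W w (λ i → m (β (blk i)) i))) →
        ∃ λ t → t ≤ time n B × SolvesInTime W w solver L t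
      conclude (t₂ , s₂ , d₂ , r₂ , le₂ , γ , out , least) =
        t₁ + t₂ , +-mono-≤ (≤-trans (m≤m+n t₁ r₁) le₁) (≤-trans (m≤m+n t₂ r₂) le₂)
        , s₂ , (λ i → m (γ (blk i)) i) , seq d₁ d₂ , out , matching⇒feasible L (sound γ) , optimal
        where
        optimal : ∀ g → IsFeasibleSolution G g → cost W w (λ i → m (γ (blk i)) i) ≼ cost W w g
        optimal g g-feasible with complete g (feasible⇒matching L g-feasible)
        ... | β , g≡ = ≼-trans (least β) (≼-reflexive (Sum.sum-cong-≋ commutativeMonoid {n} λ i →
          ≈-reflexive (cong₂ ρ (sym (g≡ i)) (sym (g≡ (next i))))))
      second : ∃ λ t → t ≤ time n B × SolvesInTime W w solver L t
      second = conclude (phase₂ᴿ core (λ k → cong-app (warrs≡ fr aT refl) k) (λ j → cong-app (arrs≡ fr aBits refl) j))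

    solve : Solved
    solve = labelled⇒solved (framed {phase₁} (phase₁ᴿ {s₀} (input refl (rep (padded-toℕ 0 _)) (rep (padded-toℕ 0 _))) zeros))
      where
      zeros : ∀ a k → 2 ≤ a → arrs s₀ a k ≡ 0
      zeros (suc zero) k (s≤s ())
      zeros (suc (suc a)) k _ = refl

-- Finite sums and products over lists.

module Sums where

  open import Data.List.Base using (cartesianProductWith)
  open import Data.List.Membership.Propositional using (_∈_)
  open import Data.List.Membership.Propositional.Properties using (∈-∃++; ∈-++⁻; ∈-++⁺ˡ; ∈-++⁺ʳ; ∈-cartesianProductWith⁺; ∈-cartesianProductWith⁻)
  open import Data.List.Properties using (length-tabulate)
  open import Data.List.Relation.Unary.Any using (here; there)
  open import Data.List.Relation.Unary.All using ([]; _∷_) renaming (lookup to All-lookup)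
  open import Data.List.Relation.Unary.AllPairs using ([]; _∷_)
  open import Data.List.Relation.Unary.Unique.Propositional using (Unique)
  import Data.List.Relation.Unary.Unique.Propositional.Properties as Unique
  open import Data.Vec.Base using (Vec; []; _∷_; lookup)
  open import Data.Vec.Properties using (∷-injective)
  open import Relation.Unary using (Pred; Decidable)

  module _ {A : Set} where

    ∑ : List A → (A → ℕ) → ℕ
    ∑ [] F = 0
    ∑ (x ∷ xs) F = F x + ∑ xs F

    ∑-mono : ∀ xs {F G : A → ℕ} → (∀ x → x ∈ xs → F x ≤ G x) → ∑ xs F ≤ ∑ xs G
    ∑-mono [] h = z≤n
    ∑-mono (x ∷ xs) h = +-mono-≤ (h x (here refl)) (∑-mono xs λ y y∈ → h y (there y∈))

    ∑-cong : ∀ xs {F G : A → ℕ} → (∀ x → x ∈ xs → F x ≡ G x) → ∑ xs F ≡ ∑ xs G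
    ∑-cong [] h = refl
    ∑-cong (x ∷ xs) h = cong₂ _+_ (h x (here refl)) (∑-cong xs λ y y∈ → h y (there y∈))

    ∑-++ : ∀ xs ys (F : A → ℕ) → ∑ (xs ++ ys) F ≡ ∑ xs F + ∑ ys F
    ∑-++ [] ys F = refl
    ∑-++ (x ∷ xs) ys F = trans (cong (F x +_) (∑-++ xs ys F)) (sym (+-assoc (F x) _ _))

    ∑-+ : ∀ xs (F G : A → ℕ) → ∑ xs (λ x → F x + G x) ≡ ∑ xs F + ∑ xs G
    ∑-+ [] F G = refl
    ∑-+ (x ∷ xs) F G = trans (cong (F x + G x +_) (∑-+ xs F G)) (lem (F x) (G x) (∑ xs F) (∑ xs G))
      where
      lem : ∀ a b c d → a + b + (c + d) ≡ a + c + (b + d)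
      lem = solve-∀

    ∑-*ˡ : ∀ c xs (F : A → ℕ) → ∑ xs (λ x → c * F x) ≡ c * ∑ xs F
    ∑-*ˡ c [] F = sym (*-zeroʳ c)
    ∑-*ˡ c (x ∷ xs) F = trans (cong (c * F x +_) (∑-*ˡ c xs F)) (sym (*-distribˡ-+ c (F x) _))

    ∑-const : ∀ xs c → ∑ xs (λ _ → c) ≡ length xs * c
    ∑-const [] c = refl
    ∑-const (x ∷ xs) c = cong (c +_) (∑-const xs c)

    -- Each element of `xs` is cut out of `ys` in turn; uniqueness ensures that the later ones
    -- survive the cut.
    ∑-⊆ : ∀ {xs ys} → Unique xs → (∀ {x} → x ∈ xs → x ∈ ys) → (F : A → ℕ) → ∑ xs F ≤ ∑ ys F
    ∑-⊆ {[]} _ _ F = z≤n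
    ∑-⊆ {x ∷ xs} {ys} (x∉ ∷ u) sub F with ∈-∃++ (sub (here refl))
    ... | as , bs , refl = begin
      F x + ∑ xs F              ≤⟨ +-monoʳ-≤ (F x) (∑-⊆ u rest F) ⟩
      F x + ∑ (as ++ bs) F      ≡⟨ cong (F x +_) (∑-++ as bs F) ⟩
      F x + (∑ as F + ∑ bs F)   ≡⟨ swap (F x) (∑ as F) (∑ bs F) ⟩
      ∑ as F + (F x + ∑ bs F)   ≡⟨ ∑-++ as (x ∷ bs) F ⟨
      ∑ (as ++ x ∷ bs) F        ∎
      where
      open ≤-Reasoning
      swap : ∀ a b c → a + (b + c) ≡ b + (a + c)
      swap = solve-∀
      rest : ∀ {y} → y ∈ xs → y ∈ as ++ bs
      rest {y} y∈ with ∈-++⁻ as (sub (there y∈))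
      ... | inj₁ p = ∈-++⁺ˡ p
      ... | inj₂ (here refl) = contradiction refl (All-lookup x∉ y∈)
      ... | inj₂ (there p) = ∈-++⁺ʳ as p

    length-∑ : ∀ xs → ∑ xs (λ _ → 1) ≡ length xs
    length-∑ xs = trans (∑-const xs 1) (*-identityʳ _)

    length-⊆ : ∀ {xs ys : List A} → Unique xs → (∀ {x} → x ∈ xs → x ∈ ys) → length xs ≤ length ys
    length-⊆ {xs} {ys} u sub = subst₂ _≤_ (length-∑ xs) (length-∑ ys) (∑-⊆ u sub (λ _ → 1))

    module _ {ℓ} {P : Pred A ℓ} (P? : Decidable P) where

      indicator : A → ℕ
      indicator x = if does (P? x) then 1 else 0

      ∑-filter : ∀ xs (F : A → ℕ) → ∑ (filter P? xs) F ≡ ∑ xs (λ x → indicator x * F x)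
      ∑-filter [] F = refl
      ∑-filter (x ∷ xs) F with does (P? x)
      ... | true = cong₂ _+_ (sym (+-identityʳ (F x))) (∑-filter xs F)
      ... | false = ∑-filter xs F

      length-filter-∑ : ∀ xs → length (filter P? xs) ≡ ∑ xs indicator
      length-filter-∑ xs = trans (sym (length-∑ (filter P? xs))) (trans (∑-filter xs (λ _ → 1)) (∑-cong xs λ x _ → *-identityʳ _))

  module _ {A B : Set} where

    ∑-map : ∀ (f : A → B) xs F → ∑ (map f xs) F ≡ ∑ xs (λ x → F (f x))
    ∑-map f [] F = refl
    ∑-map f (x ∷ xs) F = cong (F (f x) +_) (∑-map f xs F)

    ∑-swap : ∀ (xs : List A) (ys : List B) (F : A → B → ℕ) →
      ∑ xs (λ x → ∑ ys (F x)) ≡ ∑ ys (λ y → ∑ xs (λ x → F x y))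
    ∑-swap [] ys F = sym (trans (∑-const ys 0) (*-zeroʳ (length ys)))
    ∑-swap (x ∷ xs) ys F = trans (cong (∑ ys (F x) +_) (∑-swap xs ys F)) (sym (∑-+ ys (F x) _))

  ∑-cartesian : ∀ {A B C : Set} (f : A → B → C) xs ys (F : C → ℕ) →
    ∑ (cartesianProductWith f xs ys) F ≡ ∑ xs (λ x → ∑ ys (λ y → F (f x y)))
  ∑-cartesian f [] ys F = refl
  ∑-cartesian f (x ∷ xs) ys F = trans (∑-++ (map (f x) ys) _ F) (cong₂ _+_ (∑-map (f x) ys F) (∑-cartesian f xs ys F))

  module _ {A : Set} where

    vectors : List A → ∀ m → List (Vec A m)
    vectors xs zero = [ [] ]
    vectors xs (suc m) = cartesianProductWith _∷_ xs (vectors xs m)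

    vectors-unique : ∀ {xs} → Unique xs → ∀ m → Unique (vectors xs m)
    vectors-unique u zero = [] ∷ []
    vectors-unique u (suc m) = Unique.cartesianProductWith⁺ _∷_ ∷-injective u (vectors-unique u m)

    ∈-vectors⁺ : ∀ {xs m} (v : Vec A m) → (∀ i → lookup v i ∈ xs) → v ∈ vectors xs m
    ∈-vectors⁺ [] h = here refl
    ∈-vectors⁺ (x ∷ v) h = ∈-cartesianProductWith⁺ _∷_ (h zero) (∈-vectors⁺ v λ i → h (suc i))

    ∈-vectors⁻ : ∀ xs {m} {v : Vec A m} → v ∈ vectors xs m → ∀ i → lookup v i ∈ xs
    ∈-vectors⁻ xs {suc m} v∈ i with ∈-cartesianProductWith⁻ _∷_ xs (vectors xs m) v∈
    ∈-vectors⁻ xs {suc m} v∈ zero | _ , _ , x∈ , _ , refl = x∈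
    ∈-vectors⁻ xs {suc m} v∈ (suc i) | _ , _ , _ , t∈ , refl = ∈-vectors⁻ xs t∈ i

    length-vectors : ∀ xs m → length (vectors xs m) ≡ length xs ^ m
    length-vectors xs zero = refl
    length-vectors xs (suc m) = begin
      length (vectors xs (suc m))                    ≡⟨ length-∑ (vectors xs (suc m)) ⟨
      ∑ (vectors xs (suc m)) (λ _ → 1)               ≡⟨ ∑-cartesian _∷_ xs (vectors xs m) (λ _ → 1) ⟩
      ∑ xs (λ _ → ∑ (vectors xs m) (λ _ → 1))        ≡⟨ ∑-const xs _ ⟩
      length xs * ∑ (vectors xs m) (λ _ → 1)         ≡⟨ cong (length xs *_) (trans (length-∑ (vectors xs m)) (length-vectors xs m)) ⟩
      length xs * length xs ^ m                      ∎
      where open ≡-Reasoning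

  prod : ∀ {m} → (Fin m → ℕ) → ℕ
  prod {zero} c = 1
  prod {suc m} c = c zero * prod (λ i → c (suc i))

  prod-mono : ∀ {m} {c d : Fin m → ℕ} → (∀ i → c i ≤ d i) → prod c ≤ prod d
  prod-mono {zero} h = ≤-refl
  prod-mono {suc m} h = *-mono-≤ (h zero) (prod-mono λ i → h (suc i))

  prod-const : ∀ {m} {c : Fin m → ℕ} {k} → (∀ i → c i ≡ k) → prod c ≡ k ^ m
  prod-const {zero} h = refl
  prod-const {suc m} h = cong₂ _*_ (h zero) (prod-const λ i → h (suc i))

  prod-* : ∀ {m} (c d : Fin m → ℕ) → prod c * prod d ≡ prod (λ i → c i * d i)
  prod-* {zero} c d = refl
  prod-* {suc m} c d = trans (lem (c zero) (prod (λ i → c (suc i))) (d zero) (prod (λ i → d (suc i))))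
    (cong (c zero * d zero *_) (prod-* (λ i → c (suc i)) (λ i → d (suc i))))
    where
    lem : ∀ a b c d → a * b * (c * d) ≡ a * c * (b * d)
    lem = solve-∀

  -- The general distributive law: requisitions are chosen independently, so counting graphs splits
  -- into counting rows.
  ∑-prod : ∀ {A : Set} (xs : List A) {m} (c : Fin m → A → ℕ) →
    ∑ (vectors xs m) (λ v → prod (λ i → c i (lookup v i))) ≡ prod (λ i → ∑ xs (c i))
  ∑-prod xs {zero} c = refl
  ∑-prod xs {suc m} c = begin
    ∑ (vectors xs (suc m)) (λ v → prod (λ i → c i (lookup v i)))
      ≡⟨ ∑-cartesian _∷_ xs (vectors xs m) _ ⟩
    ∑ xs (λ x → ∑ (vectors xs m) (λ v → c zero x * prod (λ i → c (suc i) (lookup v i))))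
      ≡⟨ ∑-cong xs (λ x _ → trans (∑-*ˡ (c zero x) (vectors xs m) _) (trans (cong (c zero x *_) (∑-prod xs (λ i → c (suc i)))) (*-comm (c zero x) _))) ⟩
    ∑ xs (λ x → prod (λ i → ∑ xs (c (suc i))) * c zero x)
      ≡⟨ trans (∑-*ˡ (prod (λ i → ∑ xs (c (suc i)))) xs (c zero)) (*-comm _ (∑ xs (c zero))) ⟩
    ∑ xs (c zero) * prod (λ i → ∑ xs (c (suc i))) ∎
    where open ≡-Reasoning

  length-allFin : ∀ n → length (allFin n) ≡ n
  length-allFin n = length-tabulate (λ i → i)

  allFin-unique : ∀ n → Unique (allFin n)
  allFin-unique n = Unique.allFin⁺ n

-- Counting admissible requisitions.

module Rows where

  open Sums
  open import Data.Fin.Properties using (any?) renaming (_≟_ to _≟ᶠ_)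
  open import Data.Fin.Subset using (Subset; _∈_; ∣_∣; ⁅_⁆; _∪_)
  open import Data.Fin.Subset.Properties using (_∈?_; x∈⁅x⁆; x∈⁅y⁆⇒x≡y; ⊆-antisym; x∈p∪q⁻; x∈p∪q⁺; x∈p∧x≢y⇒x∈p-y; x∈p⇒∣p-x∣<∣p∣; ∣⁅x⁆∣≡1)
  import Data.List.Membership.Propositional as List
  open import Data.List.Membership.Propositional.Properties using (∈-filter⁺; ∈-filter⁻; ∈-map⁻; ∈-map⁺; ∈-allFin)
  open import Data.List.Properties using (length-map)
  open import Data.List.Relation.Unary.Any using (here; there)
  open import Data.List.Relation.Unary.All using ([]; _∷_)
  open import Data.List.Relation.Unary.AllPairs using ([]; _∷_)
  open import Data.List.Relation.Unary.Unique.Propositional using (Unique)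
  import Data.List.Relation.Unary.Unique.Propositional.Properties as Unique
  open import Data.Vec.Base using ([]; _∷_)
  open import Relation.Nullary.Decidable using (_×-dec_)

  mem : ∀ {n} → Fin n → Subset n → ℕ
  mem x A = indicator (x ∈?_) A

  mem-∈ : ∀ {n} {x : Fin n} {A} → x ∈ A → mem x A ≡ 1
  mem-∈ {x = x} {A} p rewrite dec-true (x ∈? A) p = refl

  mem⇒∈ : ∀ {n} {x : Fin n} {A} → mem x A ≢ 0 → x ∈ A
  mem⇒∈ {x = x} {A} nz with x ∈? A
  ... | yes p = p
  ... | no _ = contradiction refl nz

  ∣p∪q∣≤∣p∣+∣q∣ : ∀ {n} (p q : Subset n) → ∣ p ∪ q ∣ ≤ ∣ p ∣ + ∣ q ∣
  ∣p∪q∣≤∣p∣+∣q∣ [] [] = z≤n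
  ∣p∪q∣≤∣p∣+∣q∣ (true ∷ p) (true ∷ q) = s≤s (≤-trans (∣p∪q∣≤∣p∣+∣q∣ p q) (+-monoʳ-≤ ∣ p ∣ (n≤1+n _)))
  ∣p∪q∣≤∣p∣+∣q∣ (true ∷ p) (false ∷ q) = s≤s (∣p∪q∣≤∣p∣+∣q∣ p q)
  ∣p∪q∣≤∣p∣+∣q∣ (false ∷ p) (true ∷ q) = ≤-trans (s≤s (∣p∪q∣≤∣p∣+∣q∣ p q)) (≤-reflexive (sym (+-suc ∣ p ∣ _)))
  ∣p∪q∣≤∣p∣+∣q∣ (false ∷ p) (false ∷ q) = ∣p∪q∣≤∣p∣+∣q∣ p q

  module _ {n : ℕ} where

    Row : Subset n → Set
    Row A = 1 ≤ ∣ A ∣ × ∣ A ∣ ≤ 2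

    -- The singleton is included as `pair x x`. Thus `y ↦ pair x y` enumerates all rows through `x`
    -- without repetition, and there are `n` of them.
    pair : Fin n → Fin n → Subset n
    pair x y = ⁅ x ⁆ ∪ ⁅ y ⁆

    ∈-pair⁻ : ∀ {x y z : Fin n} → z ∈ pair x y → z ≡ x ⊎ z ≡ y
    ∈-pair⁻ {x} {y} z∈ with x∈p∪q⁻ ⁅ x ⁆ ⁅ y ⁆ z∈
    ... | inj₁ p = inj₁ (x∈⁅y⁆⇒x≡y x p)
    ... | inj₂ p = inj₂ (x∈⁅y⁆⇒x≡y y p)

    left∈pair : ∀ (x y : Fin n) → x ∈ pair x y
    left∈pair x y = x∈p∪q⁺ (inj₁ (x∈⁅x⁆ x))

    right∈pair : ∀ (x y : Fin n) → y ∈ pair x y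
    right∈pair x y = x∈p∪q⁺ {p = ⁅ x ⁆} (inj₂ (x∈⁅x⁆ y))

    member⇒nonempty : ∀ {A : Subset n} {x} → x ∈ A → 1 ≤ ∣ A ∣
    member⇒nonempty p = ≤-trans (s≤s z≤n) (x∈p⇒∣p-x∣<∣p∣ p)

    pair-row : ∀ x y → Row (pair x y)
    pair-row x y = member⇒nonempty (left∈pair x y) ,
      ≤-trans (∣p∪q∣≤∣p∣+∣q∣ ⁅ x ⁆ ⁅ y ⁆) (≤-reflexive (cong₂ _+_ (∣⁅x⁆∣≡1 x) (∣⁅x⁆∣≡1 y)))

    three-members : ∀ {A : Subset n} {x y z} → x ∈ A → y ∈ A → z ∈ A → y ≢ x → z ≢ x → z ≢ y → 3 ≤ ∣ A ∣
    three-members px py pz y≢x z≢x z≢y = ≤-trans (s≤s (≤-trans (s≤s (member⇒nonempty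
        (x∈p∧x≢y⇒x∈p-y (x∈p∧x≢y⇒x∈p-y pz z≢x) z≢y))) (x∈p⇒∣p-x∣<∣p∣ (x∈p∧x≢y⇒x∈p-y py y≢x)))) (x∈p⇒∣p-x∣<∣p∣ px)

    row-pair : ∀ {A x y} → Row A → x ∈ A → y ∈ A → x ≢ y → A ≡ pair x y
    row-pair {A} {x} {y} (_ , ≤2) px py x≢y = ⊆-antisym sub sup
      where
      sub : ∀ {z} → z ∈ A → z ∈ pair x y
      sub {z} pz with z ≟ᶠ x | z ≟ᶠ y
      ... | yes refl | _ = left∈pair x y
      ... | no _ | yes refl = right∈pair x y
      ... | no z≢x | no z≢y = contradiction (≤-trans (three-members px py pz (λ e → x≢y (sym e)) z≢x z≢y) ≤2) 1+n≰n
      sup : ∀ {z} → z ∈ pair x y → z ∈ A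
      sup z∈ with ∈-pair⁻ z∈
      ... | inj₁ refl = px
      ... | inj₂ refl = py

    row-is-pair : ∀ {A x} → Row A → x ∈ A → ∃ λ y → A ≡ pair x y
    row-is-pair {A} {x} R px with any? (λ y → (y ∈? A) ×-dec ¬? (x ≟ᶠ y))
    ... | yes (y , py , x≢y) = y , row-pair R px py x≢y
    ... | no none = x , ⊆-antisym sub λ z∈ → sup (∈-pair⁻ z∈)
      where
      sub : ∀ {z} → z ∈ A → z ∈ pair x x
      sub {z} pz with x ≟ᶠ z
      ... | yes refl = left∈pair x x
      ... | no x≢z = contradiction (z , pz , x≢z) none
      sup : ∀ {z} → z ≡ x ⊎ z ≡ x → z ∈ A
      sup (inj₁ refl) = px
      sup (inj₂ refl) = px

    pair-injective : ∀ {x y y′} → pair x y ≡ pair x y′ → y ≡ y′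
    pair-injective {x} {y} {y′} eq with ∈-pair⁻ (subst (y ∈_) eq (right∈pair x y))
    ... | inj₂ p = p
    ... | inj₁ refl with ∈-pair⁻ (subst (y′ ∈_) (sym eq) (right∈pair x y′))
    ...   | inj₁ p = sym p
    ...   | inj₂ p = sym p

    row? : ∀ A → Dec (Row A)
    row? A = (1 ≤? ∣ A ∣) ×-dec (∣ A ∣ ≤? 2)

    bools : List Bool
    bools = true ∷ false ∷ []

    bools-unique : Unique bools
    bools-unique = ((λ ()) ∷ []) ∷ [] ∷ []

    ∈-bools : ∀ b → b List.∈ bools
    ∈-bools true = here refl
    ∈-bools false = there (here refl)

    rows : List (Subset n)
    rows = filter row? (vectors bools n)

    rows-unique : Unique rows
    rows-unique = Unique.filter⁺ row? (vectors-unique bools-unique n)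

    ∈-rows⁺ : ∀ {A} → Row A → A List.∈ rows
    ∈-rows⁺ {A} R = ∈-filter⁺ row? (∈-vectors⁺ A λ i → ∈-bools _) R

    ∈-rows⁻ : ∀ {A} → A List.∈ rows → Row A
    ∈-rows⁻ A∈ = proj₂ (∈-filter⁻ row? {xs = vectors bools n} A∈)

    private
      rows∋ : Fin n → List (Subset n)
      rows∋ x = filter (x ∈?_) rows

      rows∋-unique : ∀ x → Unique (rows∋ x)
      rows∋-unique x = Unique.filter⁺ (x ∈?_) rows-unique

      pairs : Fin n → List (Subset n)
      pairs x = map (pair x) (allFin n)

      length-pairs : ∀ x → length (pairs x) ≡ n
      length-pairs x = trans (length-map (pair x) (allFin n)) (length-allFin n)

    rows-through : ∀ x → ∑ rows (mem x) ≡ n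
    rows-through x = trans (sym (length-filter-∑ (x ∈?_) rows)) (≤-antisym
      (≤-trans (length-⊆ (rows∋-unique x) sub) (≤-reflexive (length-pairs x)))
      (≤-trans (≤-reflexive (sym (length-pairs x))) (length-⊆ (Unique.map⁺ pair-injective (allFin-unique n)) sup)))
      where
      sub : ∀ {A} → A List.∈ rows∋ x → A List.∈ pairs x
      sub A∈ with ∈-filter⁻ (x ∈?_) {xs = rows} A∈
      ... | A∈rows , px with row-is-pair (∈-rows⁻ A∈rows) px
      ...   | y , refl = ∈-map⁺ (pair x) (∈-allFin y)
      sup : ∀ {A} → A List.∈ pairs x → A List.∈ rows∋ x
      sup A∈ with ∈-map⁻ (pair x) A∈
      ... | y , _ , refl = ∈-filter⁺ (x ∈?_) (∈-rows⁺ (pair-row x y)) (left∈pair x y)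

    rows-through-both : ∀ x y → ∑ rows (λ A → mem x A * mem y A) ≤ (if does (x ≟ᶠ y) then n else 1)
    rows-through-both x y with x ≟ᶠ y
    ... | yes refl = ≤-reflexive (trans (∑-cong rows λ A _ → idem A) (rows-through x))
      where
      idem : ∀ A → mem x A * mem x A ≡ mem x A
      idem A with does (x ∈? A)
      ... | true = refl
      ... | false = refl
    ... | no x≢y = begin
      ∑ rows (λ A → mem x A * mem y A) ≡⟨ ∑-filter (x ∈?_) rows (mem y) ⟨
      ∑ (rows∋ x) (mem y)              ≡⟨ length-filter-∑ (y ∈?_) (rows∋ x) ⟨
      length (filter (y ∈?_) (rows∋ x)) ≤⟨ length-⊆ {ys = [ pair x y ]} (Unique.filter⁺ (y ∈?_) (rows∋-unique x)) single ⟩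
      1                                ∎
      where
      open ≤-Reasoning
      single : ∀ {A} → A List.∈ filter (y ∈?_) (rows∋ x) → A List.∈ [ pair x y ]
      single A∈ with ∈-filter⁻ (y ∈?_) {xs = rows∋ x} A∈
      ... | A∈′ , py with ∈-filter⁻ (x ∈?_) {xs = rows} A∈′
      ...   | A∈rows , px = here (row-pair (∈-rows⁻ A∈rows) px py x≢y)

-- Encoding a bijection by the word of its deviations from a fixed one.

module Words where

  open Sums
  open Graph using (injective⇒hits)
  open import Data.Fin.Properties using (all?) renaming (_≟_ to _≟ᶠ_; suc-injective to suc-injectiveᶠ)
  open import Data.List.Base using (concatMap)
  open import Data.List.Membership.Propositional using (_∈_; _∉_)
  import Data.List.Membership.DecPropositional as DecMembership
  open import Data.List.Membership.Propositional.Properties using (∈-filter⁺; ∈-filter⁻; ∈-map⁻; ∈-map⁺; ∈-allFin; ∈-++⁻; ∈-++⁺ˡ; ∈-++⁺ʳ)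
  open import Data.List.Properties using (length-map; length-++; ∷-injective; ∷-injectiveʳ)
  open import Data.List.Relation.Unary.Any using (here; there)
  open import Data.List.Relation.Unary.All using ([]; _∷_) renaming (lookup to All-lookup; tabulate to All-tabulate)
  open import Data.List.Relation.Unary.AllPairs using ([]; _∷_)
  open import Data.List.Relation.Unary.Unique.Propositional using (Unique)
  import Data.List.Relation.Unary.Unique.Propositional.Properties as Unique
  open import Data.Vec.Base using (Vec; []; _∷_; lookup)
  open import Data.Vec.Properties using (tabulate∘lookup; tabulate-cong)
  open import Function.Definitions using (Injective)
  open import Relation.Nullary.Decidable using (_→-dec_)

  sumTo : ℕ → (ℕ → ℕ) → ℕ
  sumTo zero F = 0
  sumTo (suc k) F = sumTo k F + F k

  sumTo-mono : ∀ k {F G : ℕ → ℕ} → (∀ j → j < k → F j ≤ G j) → sumTo k F ≤ sumTo k G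
  sumTo-mono zero h = z≤n
  sumTo-mono (suc k) h = +-mono-≤ (sumTo-mono k λ j j< → h j (m<n⇒m<1+n j<)) (h k ≤-refl)

  sumTo-+ : ∀ k F G → sumTo k (λ j → F j + G j) ≡ sumTo k F + sumTo k G
  sumTo-+ zero F G = refl
  sumTo-+ (suc k) F G = trans (cong (_+ (F k + G k)) (sumTo-+ k F G)) (lem (sumTo k F) (sumTo k G) (F k) (G k))
    where
    lem : ∀ a b c d → a + b + (c + d) ≡ a + c + (b + d)
    lem = solve-∀

  sumTo-*ˡ : ∀ c k F → sumTo k (λ j → c * F j) ≡ c * sumTo k F
  sumTo-*ˡ c zero F = sym (*-zeroʳ c)
  sumTo-*ˡ c (suc k) F = trans (cong (_+ c * F k) (sumTo-*ˡ c k F)) (sym (*-distribˡ-+ c (sumTo k F) (F k)))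

  sumTo-first : ∀ k F → sumTo (suc k) F ≡ F 0 + sumTo k (λ j → F (suc j))
  sumTo-first zero F = +-comm 0 (F 0)
  sumTo-first (suc k) F = trans (cong (_+ F (suc k)) (sumTo-first k F)) (+-assoc (F 0) _ _)

  -- At most `M` terms are nonzero, and none exceeds `M`.
  sumTo-∸ : ∀ M k → sumTo k (M ∸_) ≤ M * M
  sumTo-∸ M zero = z≤n
  sumTo-∸ zero (suc k) = ≤-reflexive (trans (cong (sumTo k (0 ∸_) +_) (0∸n≡0 k)) (trans (+-identityʳ _) (n≤0⇒n≡0 (sumTo-∸ zero k))))
  sumTo-∸ (suc M) (suc k) = begin
    sumTo (suc k) (suc M ∸_)       ≡⟨ sumTo-first k (suc M ∸_) ⟩
    suc M + sumTo k (M ∸_)         ≤⟨ +-monoʳ-≤ (suc M) (sumTo-∸ M k) ⟩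
    suc M + M * M                  ≤⟨ +-monoʳ-≤ (suc M) (*-monoʳ-≤ M (n≤1+n M)) ⟩
    suc M + M * suc M              ∎
    where open ≤-Reasoning

  ∑-concatMap : ∀ {A B : Set} (h : A → List B) xs (F : B → ℕ) → ∑ (concatMap h xs) F ≡ ∑ xs (λ x → ∑ (h x) F)
  ∑-concatMap h [] F = refl
  ∑-concatMap h (x ∷ xs) F = trans (∑-++ (h x) (concatMap h xs) F) (cong (∑ (h x) F +_) (∑-concatMap h xs F))

  ∈-concatMap⁺′ : ∀ {A B : Set} (h : A → List B) {xs x y} → x ∈ xs → y ∈ h x → y ∈ concatMap h xs
  ∈-concatMap⁺′ h (here refl) y∈ = ∈-++⁺ˡ y∈
  ∈-concatMap⁺′ h {x′ ∷ xs} (there x∈) y∈ = ∈-++⁺ʳ (h x′) (∈-concatMap⁺′ h x∈ y∈)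

  ∈-concatMap⁻′ : ∀ {A B : Set} (h : A → List B) xs {y} → y ∈ concatMap h xs → ∃ λ x → x ∈ xs × y ∈ h x
  ∈-concatMap⁻′ h (x ∷ xs) y∈ with ∈-++⁻ (h x) y∈
  ... | inj₁ p = x , here refl , p
  ... | inj₂ p with ∈-concatMap⁻′ h xs p
  ...   | x′ , x′∈ , q = x′ , there x′∈ , q

  lookup-injective : ∀ {A : Set} {m} {v w : Vec A m} → (∀ i → lookup v i ≡ lookup w i) → v ≡ w
  lookup-injective {v = v} {w} h = trans (sym (tabulate∘lookup v)) (trans (tabulate-cong h) (tabulate∘lookup w))

  Unique-map : ∀ {A B : Set} (h : A → B) {xs} → Unique xs → (∀ {x y} → x ∈ xs → y ∈ xs → h x ≡ h y → x ≡ y) → Unique (map h xs)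
  Unique-map h {[]} [] inj = []
  Unique-map h {x ∷ xs} (x∉ ∷ u) inj = All-tabulate fresh ∷ Unique-map h u (λ p q → inj (there p) (there q))
    where
    fresh : ∀ {y} → y ∈ map h xs → h x ≢ y
    fresh y∈ eq with ∈-map⁻ h y∈
    ... | z , z∈ , refl = All-lookup x∉ z∈ (inj (here refl) (there z∈) eq)

  module _ {n : ℕ} where
    open DecMembership (_≟ᶠ_ {n}) using (_∈?_)

    unused : List (Fin n) → List (Fin n)
    unused w = filter (λ x → ¬? (x ∈? w)) (allFin n)

    -- The words of length `k` without repeated letters. Their number is the falling factorial (n)ₖ,
    -- of which only the upper estimate enters.
    words : ℕ → List (List (Fin n))
    words zero = [ [] ]
    words (suc k) = concatMap (λ w → map (_∷ w) (unused w)) (words k)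

    ∈-words⁻ : ∀ k {w} → w ∈ words k → Unique w × length w ≡ k
    ∈-words⁻ zero (here refl) = [] , refl
    ∈-words⁻ (suc k) w∈ with ∈-concatMap⁻′ (λ w → map (_∷ w) (unused w)) (words k) w∈
    ... | v , v∈ , w∈′ with ∈-map⁻ (_∷ v) w∈′ | ∈-words⁻ k v∈
    ...   | x , x∈ , refl | u , len with ∈-filter⁻ (λ x → ¬? (x ∈? v)) {xs = allFin n} x∈
    ...     | _ , x∉ = All-tabulate (λ { y∈ refl → x∉ y∈ }) ∷ u , cong suc len

    ∈-words⁺ : ∀ {w} → Unique w → w ∈ words (length w)
    ∈-words⁺ {[]} [] = here refl
    ∈-words⁺ {x ∷ w} (x∉ ∷ u) = ∈-concatMap⁺′ (λ w → map (_∷ w) (unused w)) (∈-words⁺ u)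
      (∈-map⁺ (_∷ w) (∈-filter⁺ (λ x → ¬? (x ∈? w)) (∈-allFin x) (λ x∈ → contradiction refl (All-lookup x∉ x∈))))

    unused-length : ∀ {w} → Unique w → length w + length (unused w) ≤ n
    unused-length {w} u = begin
      length w + length (unused w)   ≡⟨ length-++ w ⟨
      length (w ++ unused w)         ≤⟨ length-⊆ (Unique.++⁺ u (Unique.filter⁺ (λ x → ¬? (x ∈? w)) (allFin-unique n)) disjoint) (λ {x} _ → ∈-allFin x) ⟩
      length (allFin n)              ≡⟨ length-allFin n ⟩
      n                              ∎
      where
      open ≤-Reasoning
      disjoint : ∀ {x} → ¬ (x ∈ w × x ∈ unused w)
      disjoint (x∈ , x∈′) = proj₂ (∈-filter⁻ (λ x → ¬? (x ∈? w)) {xs = allFin n} x∈′) x∈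

    -- A word of length `k` leaves at most `n - k` letters to prepend; the product is written
    -- without subtraction.
    words-step : ∀ k → length (words (suc k)) + k * length (words k) ≤ n * length (words k)
    words-step k = begin
      length (words (suc k)) + k * length (words k)  ≡⟨ cong₂ _+_ grow shrink ⟩
      ∑ (words k) (λ w → length (unused w)) + ∑ (words k) length ≡⟨ ∑-+ (words k) (λ w → length (unused w)) length ⟨
      ∑ (words k) (λ w → length (unused w) + length w)
        ≤⟨ ∑-mono (words k) (λ w w∈ → ≤-trans (≤-reflexive (+-comm (length (unused w)) _)) (unused-length (proj₁ (∈-words⁻ k w∈)))) ⟩
      ∑ (words k) (λ _ → n)                          ≡⟨ trans (∑-const (words k) n) (*-comm _ n) ⟩
      n * length (words k)                           ∎
      where
      open ≤-Reasoning
      grow : length (words (suc k)) ≡ ∑ (words k) (λ w → length (unused w))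
      grow = trans (sym (length-∑ (words (suc k)))) (trans (∑-concatMap (λ w → map (_∷ w) (unused w)) (words k) (λ _ → 1))
        (∑-cong (words k) λ w _ → trans (length-∑ (map (_∷ w) (unused w))) (length-map (_∷ w) (unused w))))
      shrink : k * length (words k) ≡ ∑ (words k) length
      shrink = trans (*-comm k _) (trans (sym (∑-const (words k) k)) (∑-cong (words k) λ w w∈ → sym (proj₂ (∈-words⁻ k w∈))))

    weight : List (Fin n) → ℕ
    weight w = n ^ (n ∸ length w)

    -- Stands for (n)ₖ nⁿ⁻ᵏ, the weight of all words of length `k`.
    mass : ℕ → ℕ
    mass k = length (words k) * n ^ (n ∸ k)

    ∑-words-weight : ∀ k → ∑ (words k) weight ≡ mass k
    ∑-words-weight k = trans (∑-cong (words k) λ w w∈ → cong (λ l → n ^ (n ∸ l)) (proj₂ (∈-words⁻ k w∈)))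
      (∑-const (words k) (n ^ (n ∸ k)))

    mass-step : ∀ k → k < n → k * mass k + n * mass (suc k) ≤ n * mass k
    mass-step k k<n = begin
      k * (L k * n ^ (n ∸ k)) + n * (L (suc k) * n ^ (n ∸ suc k)) ≡⟨ cong (λ z → k * (L k * z) + n * (L (suc k) * n ^ (n ∸ suc k))) pow ⟩
      k * (L k * (n * p)) + n * (L (suc k) * p) ≡⟨ lem k (L k) n p (L (suc k)) ⟩
      (L (suc k) + k * L k) * (n * p)           ≤⟨ *-monoˡ-≤ (n * p) (words-step k) ⟩
      n * L k * (n * p)                         ≡⟨ *-assoc n (L k) (n * p) ⟩
      n * (L k * (n * p))                       ≡⟨ cong (λ z → n * (L k * z)) pow ⟨
      n * (L k * n ^ (n ∸ k))                   ∎
      where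
      open ≤-Reasoning
      L : ℕ → ℕ
      L k = length (words k)
      p : ℕ
      p = n ^ (n ∸ suc k)
      pow : n ^ (n ∸ k) ≡ n * p
      pow = cong (n ^_) (+-∸-assoc 1 k<n)
      lem : ∀ k l n p m → k * (l * (n * p)) + n * (m * p) ≡ (m + k * l) * (n * p)
      lem = solve-∀

    -- The sum of k (n)ₖ / nᵏ telescopes.
    mass-telescope : ∀ k → k ≤ n → sumTo k (λ j → j * mass j) + n * mass k ≤ n * n ^ n
    mass-telescope zero _ = ≤-reflexive (cong (n *_) (+-identityʳ _))
    mass-telescope (suc k) k<n = begin
      sumTo k (λ j → j * mass j) + k * mass k + n * mass (suc k)   ≡⟨ +-assoc (sumTo k (λ j → j * mass j)) (k * mass k) (n * mass (suc k)) ⟩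
      sumTo k (λ j → j * mass j) + (k * mass k + n * mass (suc k)) ≤⟨ +-monoʳ-≤ (sumTo k (λ j → j * mass j)) (mass-step k k<n) ⟩
      sumTo k (λ j → j * mass j) + n * mass k                      ≤⟨ mass-telescope k (<⇒≤ k<n) ⟩
      n * n ^ n                                                    ∎
      where open ≤-Reasoning

    mass≤ : ∀ k → k ≤ n → .{{NonZero n}} → mass k ≤ n ^ n
    mass≤ k k≤n = *-cancelˡ-≤ n (≤-trans (m≤n+m (n * mass k) (sumTo k (λ j → j * mass j))) (mass-telescope k k≤n))

    -- By `M ≤ k + (M ∸ k)`, the sum splits into a part that telescopes to at most `n * n ^ n` and a
    -- part supported on `k < M`, which costs at most `M * M * n ^ n`. For `M` near √n both have the
    -- same order, and division by `M` leaves O(√n nⁿ).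
    total-mass : ∀ M → .{{NonZero n}} → M * sumTo (suc n) mass ≤ (n + M * M) * n ^ n
    total-mass M = begin
      M * sumTo (suc n) mass                                ≡⟨ sumTo-*ˡ M (suc n) mass ⟨
      sumTo (suc n) (λ k → M * mass k)                      ≤⟨ sumTo-mono (suc n) (λ k k≤ → pointwise k (≤-pred k≤)) ⟩
      sumTo (suc n) (λ k → k * mass k + n ^ n * (M ∸ k))    ≡⟨ sumTo-+ (suc n) (λ k → k * mass k) _ ⟩
      sumTo (suc n) (λ k → k * mass k) + sumTo (suc n) (λ k → n ^ n * (M ∸ k))
        ≤⟨ +-mono-≤ (mass-telescope n ≤-refl) (≤-reflexive (sumTo-*ˡ (n ^ n) (suc n) (M ∸_))) ⟩
      n * n ^ n + n ^ n * sumTo (suc n) (M ∸_)              ≤⟨ +-monoʳ-≤ (n * n ^ n) (*-monoʳ-≤ (n ^ n) (sumTo-∸ M (suc n))) ⟩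
      n * n ^ n + n ^ n * (M * M)                           ≡⟨ lem n (n ^ n) (M * M) ⟩
      (n + M * M) * n ^ n                                   ∎
      where
      open ≤-Reasoning
      lem : ∀ n p q → n * p + p * q ≡ (n + q) * p
      lem = solve-∀
      pointwise : ∀ k → k ≤ n → M * mass k ≤ k * mass k + n ^ n * (M ∸ k)
      pointwise k k≤n = begin
        M * mass k                       ≤⟨ *-monoˡ-≤ (mass k) (m≤n+m∸n M k) ⟩
        (k + (M ∸ k)) * mass k           ≡⟨ *-distribʳ-+ (mass k) k (M ∸ k) ⟩
        k * mass k + (M ∸ k) * mass k    ≤⟨ +-monoʳ-≤ (k * mass k) (*-monoʳ-≤ (M ∸ k) (mass≤ k k≤n)) ⟩
        k * mass k + (M ∸ k) * n ^ n     ≡⟨ cong (k * mass k +_) (*-comm (M ∸ k) (n ^ n)) ⟩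
        k * mass k + n ^ n * (M ∸ k)     ∎

    word : ∀ {m} → (Fin m → Fin n) → (Fin m → Fin n) → List (Fin n)
    word {zero} f f′ = []
    word {suc m} f f′ = if does (f zero ≟ᶠ f′ zero) then rest else f′ zero ∷ rest
      where rest = word (λ i → f (suc i)) (λ i → f′ (suc i))

    -- Bounds the number of graphs containing both functions: where they agree `n` rows are
    -- possible, and where they differ only the pair of the two values.
    agreement : ∀ {m} → (Fin m → Fin n) → (Fin m → Fin n) → ℕ
    agreement f f′ = prod (λ i → if does (f i ≟ᶠ f′ i) then n else 1)

    word-length : ∀ {m} (f f′ : Fin m → Fin n) → length (word f f′) ≤ m
    word-length {zero} f f′ = z≤n
    word-length {suc m} f f′ with does (f zero ≟ᶠ f′ zero)
    ... | true = m≤n⇒m≤1+n (word-length (λ i → f (suc i)) (λ i → f′ (suc i)))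
    ... | false = s≤s (word-length (λ i → f (suc i)) (λ i → f′ (suc i)))

    agreement-weight : ∀ {m} (f f′ : Fin m → Fin n) → agreement f f′ ≡ n ^ (m ∸ length (word f f′))
    agreement-weight {zero} f f′ = refl
    agreement-weight {suc m} f f′ with does (f zero ≟ᶠ f′ zero)
    ... | true = trans (cong (n *_) (agreement-weight (λ i → f (suc i)) (λ i → f′ (suc i))))
      (cong (n ^_) (sym (+-∸-assoc 1 (word-length (λ i → f (suc i)) (λ i → f′ (suc i))))))
    ... | false = trans (+-identityʳ _) (agreement-weight (λ i → f (suc i)) (λ i → f′ (suc i)))

    ∈-word⁻ : ∀ {m} (f f′ : Fin m → Fin n) {x} → x ∈ word f f′ → ∃ λ i → x ≡ f′ i × f i ≢ f′ i
    ∈-word⁻ {suc m} f f′ x∈ with f zero ≟ᶠ f′ zero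
    ... | yes _ with ∈-word⁻ (λ i → f (suc i)) (λ i → f′ (suc i)) x∈
    ...   | i , p , q = suc i , p , q
    ∈-word⁻ {suc m} f f′ (here refl) | no neq = zero , refl , neq
    ∈-word⁻ {suc m} f f′ (there x∈) | no neq with ∈-word⁻ (λ i → f (suc i)) (λ i → f′ (suc i)) x∈
    ...   | i , p , q = suc i , p , q

    ∈-word⁺ : ∀ {m} (f f′ : Fin m → Fin n) i → f i ≢ f′ i → f′ i ∈ word f f′
    ∈-word⁺ {suc m} f f′ i neq with f zero ≟ᶠ f′ zero
    ∈-word⁺ {suc m} f f′ zero neq | yes eq = contradiction eq neq
    ∈-word⁺ {suc m} f f′ zero neq | no _ = here refl
    ∈-word⁺ {suc m} f f′ (suc i) neq | yes _ = ∈-word⁺ (λ i → f (suc i)) (λ i → f′ (suc i)) i neq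
    ∈-word⁺ {suc m} f f′ (suc i) neq | no _ = there (∈-word⁺ (λ i → f (suc i)) (λ i → f′ (suc i)) i neq)

    word-unique : ∀ {m} (f f′ : Fin m → Fin n) → Injective _≡_ _≡_ f′ → Unique (word f f′)
    word-unique {zero} f f′ inj = []
    word-unique {suc m} f f′ inj with f zero ≟ᶠ f′ zero
    ... | yes _ = word-unique (λ i → f (suc i)) (λ i → f′ (suc i)) (λ eq → suc-injectiveᶠ (inj eq))
    ... | no _ = All-tabulate fresh ∷ word-unique (λ i → f (suc i)) (λ i → f′ (suc i)) (λ eq → suc-injectiveᶠ (inj eq))
      where
      fresh : ∀ {x} → x ∈ word (λ i → f (suc i)) (λ i → f′ (suc i)) → f′ zero ≢ x
      fresh x∈ eq with ∈-word⁻ (λ i → f (suc i)) (λ i → f′ (suc i)) x∈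
      ... | i , refl , _ = contradiction (inj eq) λ ()

    -- When both functions deviate from `f` at the same positions, the two words can be read in
    -- parallel, letter by letter.
    word-determines : ∀ {m} (f f′ f″ : Fin m → Fin n) →
      (∀ i → f i ≡ f′ i → f i ≡ f″ i) → (∀ i → f i ≡ f″ i → f i ≡ f′ i) →
      word f f′ ≡ word f f″ → ∀ i → f′ i ≡ f″ i
    word-determines {suc m} f f′ f″ to from eq i with f zero ≟ᶠ f′ zero | f zero ≟ᶠ f″ zero
    ... | yes p | no q = contradiction (to zero p) q
    ... | no p | yes q = contradiction (from zero q) p
    word-determines {suc m} f f′ f″ to from eq zero | yes p | yes q = trans (sym p) q
    word-determines {suc m} f f′ f″ to from eq zero | no p | no q = proj₁ (∷-injective eq)
    word-determines {suc m} f f′ f″ to from eq (suc i) | yes p | yes q =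
      word-determines (λ i → f (suc i)) (λ i → f′ (suc i)) (λ i → f″ (suc i)) (λ i → to (suc i)) (λ i → from (suc i)) eq i
    word-determines {suc m} f f′ f″ to from eq (suc i) | no p | no q =
      word-determines (λ i → f (suc i)) (λ i → f′ (suc i)) (λ i → f″ (suc i)) (λ i → to (suc i)) (λ i → from (suc i)) (∷-injectiveʳ eq) i

    -- f i occurs in the word exactly when f i ≢ f′ i, so the word shows where f and f′ agree.
    module _ {f f′ : Fin n → Fin n} (inj : Injective _≡_ _≡_ f) (inj′ : Injective _≡_ _≡_ f′) where

      agree⇒∉word : ∀ i → f i ≡ f′ i → f i ∉ word f f′
      agree⇒∉word i eq fi∈ with ∈-word⁻ f f′ fi∈
      ... | j , p , q = q (trans (cong f (sym i≡j)) p)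
        where
        i≡j : i ≡ j
        i≡j = inj′ (trans (sym eq) p)

      ∉word⇒agree : ∀ i → f i ∉ word f f′ → f i ≡ f′ i
      ∉word⇒agree i fi∉ with f i ≟ᶠ f′ i
      ... | yes p = p
      ... | no neq with injective⇒hits f′ inj′ (f i)
      -- `f′` takes the value `f i` at some `j`, and there it deviates from `f`, since otherwise
      -- `i = j`. So `f i` would be a letter of the word.
      ...   | j , eq = contradiction (subst (_∈ word f f′) eq (∈-word⁺ f f′ j λ fj≡ → neq (trans (sym eq) (cong f′ (inj (trans fj≡ eq))))))
                         fi∉

    word-injective : ∀ {f f′ f″ : Fin n → Fin n} → Injective _≡_ _≡_ f → Injective _≡_ _≡_ f′ → Injective _≡_ _≡_ f″ →
      word f f′ ≡ word f f″ → ∀ i → f′ i ≡ f″ i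
    word-injective {f} {f′} {f″} inj inj′ inj″ eq = word-determines f f′ f″
      (λ i p → ∉word⇒agree inj inj″ i (subst (f i ∉_) eq (agree⇒∉word inj inj′ i p)))
      (λ i p → ∉word⇒agree inj inj′ i (subst (f i ∉_) (sym eq) (agree⇒∉word inj inj″ i p))) eq

    Inj : Vec (Fin n) n → Set
    Inj f = ∀ i j → lookup f i ≡ lookup f j → i ≡ j

    inj? : ∀ f → Dec (Inj f)
    inj? f = all? λ i → all? λ j → (lookup f i ≟ᶠ lookup f j) →-dec (i ≟ᶠ j)

    bijections : List (Vec (Fin n) n)
    bijections = filter inj? (vectors (allFin n) n)

    bijections-unique : Unique bijections
    bijections-unique = Unique.filter⁺ inj? (vectors-unique (allFin-unique n) n)

    ∈-bijections⁺ : ∀ {f} → Inj f → f ∈ bijections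
    ∈-bijections⁺ {f} inj = ∈-filter⁺ inj? (∈-vectors⁺ f λ i → ∈-allFin (lookup f i)) inj

    ∈-bijections⁻ : ∀ {f} → f ∈ bijections → Inj f
    ∈-bijections⁻ f∈ = proj₂ (∈-filter⁻ inj? {xs = vectors (allFin n) n} f∈)

    wordsTo : ℕ → List (List (Fin n))
    wordsTo zero = []
    wordsTo (suc k) = wordsTo k ++ words k

    ∈-wordsTo : ∀ {k j w} → j < k → w ∈ words j → w ∈ wordsTo k
    ∈-wordsTo {suc k} {j} j<sk w∈ with j ≟ k
    ... | yes refl = ∈-++⁺ʳ (wordsTo k) w∈
    ... | no j≢k = ∈-++⁺ˡ (∈-wordsTo (≤∧≢⇒< (≤-pred j<sk) j≢k) w∈)

    ∑-wordsTo : ∀ k → ∑ (wordsTo k) weight ≡ sumTo k mass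
    ∑-wordsTo zero = refl
    ∑-wordsTo (suc k) = trans (∑-++ (wordsTo k) (words k) weight) (cong₂ _+_ (∑-wordsTo k) (∑-words-weight k))

    ∑-agreement : ∀ {f} → f ∈ bijections → .{{NonZero n}} → ∀ M →
      M * ∑ bijections (λ f′ → agreement (lookup f) (lookup f′)) ≤ (n + M * M) * n ^ n
    ∑-agreement {f} f∈ M = ≤-trans (*-monoʳ-≤ M bound) (total-mass M)
      where
      open ≤-Reasoning
      w : Vec (Fin n) n → List (Fin n)
      w f′ = word (lookup f) (lookup f′)
      inj : ∀ {f} → f ∈ bijections → Injective _≡_ _≡_ (lookup f)
      inj f∈ {i} {j} = ∈-bijections⁻ f∈ i j
      unique : Unique (map w bijections)
      unique = Unique-map w bijections-unique λ p q eq → lookup-injective (word-injective (inj f∈) (inj p) (inj q) eq)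
      sub : ∀ {v} → v ∈ map w bijections → v ∈ wordsTo (suc n)
      sub v∈ with ∈-map⁻ w v∈
      ... | f′ , f′∈ , refl = ∈-wordsTo (s≤s (word-length (lookup f) (lookup f′))) (∈-words⁺ (word-unique (lookup f) (lookup f′) (inj f′∈)))
      bound : ∑ bijections (λ f′ → agreement (lookup f) (lookup f′)) ≤ sumTo (suc n) mass
      bound = begin
        ∑ bijections (λ f′ → agreement (lookup f) (lookup f′)) ≡⟨ ∑-cong bijections (λ f′ _ → agreement-weight (lookup f) (lookup f′)) ⟩
        ∑ bijections (λ f′ → weight (w f′))                    ≡⟨ ∑-map w bijections weight ⟨
        ∑ (map w bijections) weight                            ≤⟨ ∑-⊆ unique sub weight ⟩
        ∑ (wordsTo (suc n)) weight                             ≡⟨ ∑-wordsTo (suc n) ⟩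
        sumTo (suc n) mass                                     ∎

-- First and second moments of the number of perfect matchings.

module Count where

  open Sums
  open Rows
  open Words
  open Graph using (injective⇒hits)
  import Data.Fin.Subset as Subset
  open import Data.List.Membership.Propositional using (_∈_)
  open import Data.List.Membership.Propositional.Properties using (∈-filter⁺; ∈-filter⁻)
  open import Data.List.Relation.Unary.Any using (here; there)
  open import Data.List.Relation.Unary.Unique.Propositional using (Unique)
  import Data.List.Relation.Unary.Unique.Propositional.Properties as Unique
  open import Data.Vec.Base using (Vec; []; _∷_; lookup; tabulate)
  open import Data.Vec.Properties using (lookup∘tabulate)
  open import Function.Bundles using (_⇔_; mk⇔)

  prod-one : ∀ {m} {c : Fin m → ℕ} → (∀ i → c i ≡ 1) → prod c ≡ 1
  prod-one {m} h = trans (prod-const h) (^-zeroˡ m)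

  prod-nonzero : ∀ {m} {c : Fin m → ℕ} → prod c ≢ 0 → ∀ i → c i ≢ 0
  prod-nonzero {suc m} {c} nz zero eq = nz (cong (_* prod (λ i → c (suc i))) eq)
  prod-nonzero {suc m} {c} nz (suc i) eq = prod-nonzero (λ z → nz (trans (cong (c zero *_) z) (*-zeroʳ (c zero)))) i eq

  ∑-positive : ∀ {A : Set} {xs : List A} {F : A → ℕ} → ∑ xs F ≢ 0 → ∃ λ x → x ∈ xs × F x ≢ 0
  ∑-positive {xs = []} nz = contradiction refl nz
  ∑-positive {xs = x ∷ xs} {F} nz with F x ≟ 0
  ... | no p = x , here refl , p
  ... | yes p with ∑-positive {xs = xs} {F} (λ z → nz (cong₂ _+_ p z))
  ...   | y , y∈ , q = y , there y∈ , q

  member≤∑ : ∀ {A : Set} {xs : List A} (F : A → ℕ) {x} → x ∈ xs → F x ≤ ∑ xs F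
  member≤∑ F (here refl) = m≤m+n _ _
  member≤∑ {xs = y ∷ xs} F (there x∈) = ≤-trans (member≤∑ F x∈) (m≤n+m _ (F y))

  2κm≤κ²+m² : ∀ κ m → 2 * κ * m ≤ κ * κ + m * m
  2κm≤κ²+m² κ m with ≤-total κ m
  ... | inj₁ κ≤m with m ∸ κ | m+[n∸m]≡n κ≤m
  ...   | d | refl = ≤-trans (m≤m+n _ (d * d)) (≤-reflexive (lem κ d))
    where
    lem : ∀ κ d → 2 * κ * (κ + d) + d * d ≡ κ * κ + (κ + d) * (κ + d)
    lem = solve-∀
  2κm≤κ²+m² κ m | inj₂ m≤κ with κ ∸ m | m+[n∸m]≡n m≤κ
  ... | d | refl = ≤-trans (m≤m+n _ (d * d)) (≤-reflexive (lem m d))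
    where
    lem : ∀ m d → 2 * (m + d) * m + d * d ≡ (m + d) * (m + d) + m * m
    lem = solve-∀

  module _ (n : ℕ) where

    private
      𝔖 : List (Vec (Fin n) n)
      𝔖 = bijections

    graphs : List (BipartiteGraph n)
    graphs = vectors rows n

    -- The indicator of containment, written as a product over the rows so that its sum over all
    -- graphs factorises.
    matches : Vec (Fin n) n → BipartiteGraph n → ℕ
    matches f G = prod (λ i → mem (lookup f i) (lookup G i))

    matchings : BipartiteGraph n → ℕ
    matchings G = ∑ 𝔖 (λ f → matches f G)

    pairsTotal : ℕ
    pairsTotal = ∑ graphs matchings

    pairsTotal≡ : pairsTotal ≡ length 𝔖 * n ^ n
    pairsTotal≡ = begin
      ∑ graphs (λ G → ∑ 𝔖 (λ f → matches f G)) ≡⟨ ∑-swap graphs 𝔖 (λ G f → matches f G) ⟩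
      ∑ 𝔖 (λ f → ∑ graphs (matches f))
        ≡⟨ ∑-cong 𝔖 (λ f _ → trans (∑-prod rows (λ i → mem (lookup f i))) (prod-const λ i → rows-through (lookup f i))) ⟩
      ∑ 𝔖 (λ _ → n ^ n)                  ≡⟨ ∑-const 𝔖 (n ^ n) ⟩
      length 𝔖 * n ^ n                   ∎
      where open ≡-Reasoning

    -- Counts the graphs together with an ordered pair of their perfect matchings.
    squares : ℕ
    squares = ∑ graphs (λ G → matchings G * matchings G)

    squares≤ : squares ≤ ∑ 𝔖 (λ f → ∑ 𝔖 (λ f′ → agreement (lookup f) (lookup f′)))
    squares≤ = begin
      ∑ graphs (λ G → matchings G * matchings G)
        ≡⟨ ∑-cong graphs (λ G _ → trans (sym (∑-*ˡ (matchings G) 𝔖 (λ f → matches f G)))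
             (∑-cong 𝔖 λ f _ → trans (*-comm (matchings G) (matches f G)) (sym (∑-*ˡ (matches f G) 𝔖 (λ f′ → matches f′ G))))) ⟩
      ∑ graphs (λ G → ∑ 𝔖 (λ f → ∑ 𝔖 (λ f′ → matches f G * matches f′ G)))
        ≡⟨ ∑-swap graphs 𝔖 (λ G f → ∑ 𝔖 (λ f′ → matches f G * matches f′ G)) ⟩
      ∑ 𝔖 (λ f → ∑ graphs (λ G → ∑ 𝔖 (λ f′ → matches f G * matches f′ G)))
        ≡⟨ ∑-cong 𝔖 (λ f _ → ∑-swap graphs 𝔖 (λ G f′ → matches f G * matches f′ G)) ⟩
      ∑ 𝔖 (λ f → ∑ 𝔖 (λ f′ → ∑ graphs (λ G → matches f G * matches f′ G)))
        ≤⟨ ∑-mono 𝔖 (λ f _ → ∑-mono 𝔖 λ f′ _ → common f f′) ⟩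
      ∑ 𝔖 (λ f → ∑ 𝔖 (λ f′ → agreement (lookup f) (lookup f′))) ∎
      where
      open ≤-Reasoning
      common : ∀ f f′ → ∑ graphs (λ G → matches f G * matches f′ G) ≤ agreement (lookup f) (lookup f′)
      common f f′ = begin
        ∑ graphs (λ G → matches f G * matches f′ G)
          ≡⟨ ∑-cong graphs (λ G _ → prod-* (λ i → mem (lookup f i) (lookup G i)) (λ i → mem (lookup f′ i) (lookup G i))) ⟩
        ∑ graphs (λ G → prod (λ i → mem (lookup f i) (lookup G i) * mem (lookup f′ i) (lookup G i)))
          ≡⟨ ∑-prod rows (λ i A → mem (lookup f i) A * mem (lookup f′ i) A) ⟩
        prod (λ i → ∑ rows (λ A → mem (lookup f i) A * mem (lookup f′ i) A))
          ≤⟨ prod-mono (λ i → rows-through-both (lookup f i) (lookup f′ i)) ⟩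
        agreement (lookup f) (lookup f′) ∎

    squares-bound : .{{NonZero n}} → ∀ M → M * squares ≤ (n + M * M) * pairsTotal
    squares-bound M = begin
      M * squares ≤⟨ *-monoʳ-≤ M squares≤ ⟩
      M * ∑ 𝔖 (λ f → ∑ 𝔖 (λ f′ → agreement (lookup f) (lookup f′))) ≡⟨ ∑-*ˡ M 𝔖 (λ f → ∑ 𝔖 (λ f′ → agreement (lookup f) (lookup f′))) ⟨
      ∑ 𝔖 (λ f → M * ∑ 𝔖 (λ f′ → agreement (lookup f) (lookup f′)))
        ≤⟨ ∑-mono 𝔖 (λ f f∈ → ∑-agreement f∈ M) ⟩
      ∑ 𝔖 (λ _ → (n + M * M) * n ^ n)  ≡⟨ ∑-const 𝔖 ((n + M * M) * n ^ n) ⟩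
      length 𝔖 * ((n + M * M) * n ^ n) ≡⟨ lem (length 𝔖) (n + M * M) (n ^ n) ⟩
      (n + M * M) * (length 𝔖 * n ^ n) ≡⟨ cong ((n + M * M) *_) pairsTotal≡ ⟨
      (n + M * M) * pairsTotal                        ∎
      where
      open ≤-Reasoning
      lem : ∀ a b c → a * (b * c) ≡ b * (a * c)
      lem = solve-∀

    feasible : List (BipartiteGraph n)
    feasible = filter (λ G → 1 ≤? matchings G) graphs

    feasible-unique : Unique feasible
    feasible-unique = Unique.filter⁺ (λ G → 1 ≤? matchings G) (vectors-unique rows-unique n)

    matches⁺ : ∀ f G → (∀ i → lookup f i Subset.∈ lookup G i) → matches f G ≡ 1
    matches⁺ f G h = prod-one λ i → mem-∈ (h i)

    matches⁻ : ∀ f G → matches f G ≢ 0 → ∀ i → lookup f i Subset.∈ lookup G i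
    matches⁻ f G nz i = mem⇒∈ (prod-nonzero nz i)

    as-vector : ∀ G (f : Fin n → Fin n) → IsFeasibleSolution G f → tabulate f ∈ 𝔖 × matches (tabulate f) G ≡ 1
    as-vector G f ((inj , _) , f∈) =
      ∈-bijections⁺ (λ i j eq → inj (trans (sym (lookup∘tabulate f i)) (trans eq (lookup∘tabulate f j))))
      , matches⁺ (tabulate f) G λ i → subst (Subset._∈ lookup G i) (sym (lookup∘tabulate f i)) (f∈ i)

    ∈-feasible : ∀ G → G ∈ feasible ⇔ χ n G
    ∈-feasible G = mk⇔ to from
      where
      to : G ∈ feasible → χ n G
      to G∈ with ∈-filter⁻ (λ G → 1 ≤? matchings G) {xs = graphs} G∈
      ... | G∈graphs , pos with ∑-positive {xs = 𝔖} {λ f → matches f G} (λ z → 1+n≰n (subst (1 ≤_) z pos))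
      ...   | f , f∈ , nz = (λ i → ∈-rows⁻ (∈-vectors⁻ rows G∈graphs i)) , lookup f ,
        (((λ {i} {j} → inj i j) , λ y → proj₁ (injective⇒hits (lookup f) (λ {i} {j} → inj i j) y)
          , λ { refl → proj₂ (injective⇒hits (lookup f) (λ {i} {j} → inj i j) y) })
        , matches⁻ f G nz)
        where
        inj = ∈-bijections⁻ f∈
      from : χ n G → G ∈ feasible
      from (row , f , f-feasible) = ∈-filter⁺ (λ G → 1 ≤? matchings G) (∈-vectors⁺ G λ i → ∈-rows⁺ (row i))
        (≤-trans (≤-reflexive (sym (proj₂ (as-vector G f f-feasible)))) (member≤∑ (λ f → matches f G) (proj₁ (as-vector G f f-feasible))))

    length-feasible : length feasible ≡ ∑ graphs (indicator (λ G → 1 ≤? matchings G))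
    length-feasible = length-filter-∑ (λ G → 1 ≤? matchings G) graphs

    -- By summing 2κm ≤ κ² + m² over χ.
    pairsTotal≤ : ∀ κ .{{_ : NonZero κ}} → squares ≤ κ * pairsTotal → pairsTotal ≤ κ * length feasible
    pairsTotal≤ κ sq = *-cancelˡ-≤ κ (+-cancelʳ-≤ (κ * pairsTotal) _ _ (begin
      κ * pairsTotal + κ * pairsTotal             ≡⟨ double κ pairsTotal ⟩
      2 * κ * pairsTotal                          ≡⟨ ∑-*ˡ (2 * κ) graphs matchings ⟨
      ∑ graphs (λ G → 2 * κ * matchings G)        ≤⟨ ∑-mono graphs (λ G _ → pointwise G) ⟩
      ∑ graphs (λ G → κ * κ * I G + matchings G * matchings G) ≡⟨ ∑-+ graphs (λ G → κ * κ * I G) _ ⟩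
      ∑ graphs (λ G → κ * κ * I G) + squares      ≡⟨ cong (_+ squares) (∑-*ˡ (κ * κ) graphs I) ⟩
      κ * κ * ∑ graphs I + squares                ≡⟨ cong (λ z → κ * κ * z + squares) length-feasible ⟨
      κ * κ * length feasible + squares           ≤⟨ +-mono-≤ (≤-reflexive (*-assoc κ κ _)) sq ⟩
      κ * (κ * length feasible) + κ * pairsTotal  ∎))
      where
      open ≤-Reasoning
      I : BipartiteGraph n → ℕ
      I = indicator (λ G → 1 ≤? matchings G)
      double : ∀ a b → a * b + a * b ≡ 2 * a * b
      double = solve-∀
      -- A graph without a perfect matching contributes 0 on the left, so κ² is charged to feasible
      -- graphs only; this makes |χ| appear instead of the number of all graphs.
      pointwise : ∀ G → 2 * κ * matchings G ≤ κ * κ * I G + matchings G * matchings G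
      pointwise G = by (split (1 ≤? matchings G))
        where
        split : (d : Dec (1 ≤ matchings G)) → (1 ≤ matchings G) ⊎ (matchings G ≡ 0)
        split (yes p) = inj₁ p
        split (no p) = inj₂ (n<1⇒n≡0 (≰⇒> p))
        by : (1 ≤ matchings G) ⊎ (matchings G ≡ 0) → 2 * κ * matchings G ≤ κ * κ * I G + matchings G * matchings G
        by (inj₁ p) = ≤-trans (2κm≤κ²+m² κ (matchings G)) (≤-reflexive (cong (_+ matchings G * matchings G)
          (trans (sym (*-identityʳ (κ * κ))) (cong (λ b → κ * κ * (if b then 1 else 0)) (sym (dec-true (1 ≤? matchings G) p))))))
        by (inj₂ z) = ≤-trans (≤-reflexive (trans (cong (2 * κ *_) z) (*-zeroʳ (2 * κ)))) z≤n

    good bad : ℕ → List (BipartiteGraph n)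
    good K = filter (λ G → matchings G ≤? K) feasible
    bad K = filter (λ G → ¬? (matchings G ≤? K)) feasible

    good+bad : ∀ K → length (good K) + length (bad K) ≡ length feasible
    good+bad K = go feasible
      where
      go : ∀ xs → length (filter (λ G → matchings G ≤? K) xs) + length (filter (λ G → ¬? (matchings G ≤? K)) xs) ≡ length xs
      go [] = refl
      go (G ∷ xs) with does (matchings G ≤? K)
      ... | true = cong suc (go xs)
      ... | false = trans (+-suc _ _) (cong suc (go xs))

    good-unique : ∀ K → Unique (good K)
    good-unique K = Unique.filter⁺ (λ G → matchings G ≤? K) feasible-unique

    -- Markov's inequality.
    bad-bound : ∀ K → length (bad K) * K ≤ pairsTotal
    bad-bound K = begin
      length (bad K) * K             ≡⟨ ∑-const (bad K) K ⟨
      ∑ (bad K) (λ _ → K)            ≤⟨ ∑-mono (bad K) (λ G G∈ → <⇒≤ (≰⇒> (proj₂ (∈-filter⁻ (λ G → ¬? (matchings G ≤? K)) {xs = feasible} G∈)))) ⟩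
      ∑ (bad K) matchings            ≤⟨ ∑-⊆ (Unique.filter⁺ (λ G → ¬? (matchings G ≤? K)) feasible-unique) sub matchings ⟩
      ∑ graphs matchings             ∎
      where
      open ≤-Reasoning
      sub : ∀ {G} → G ∈ bad K → G ∈ graphs
      sub G∈ = proj₁ (∈-filter⁻ (λ G → 1 ≤? matchings G) {xs = graphs}
        (proj₁ (∈-filter⁻ (λ G → ¬? (matchings G ≤? K)) {xs = feasible} G∈)))

    -- The identity already lies in `n ^ n` graphs. This is what excludes a zero denominator in the
    -- ratio.
    pairsTotal-positive : .{{NonZero n}} → 1 ≤ pairsTotal
    pairsTotal-positive = ≤-trans (*-mono-≤ (member≤∑ {xs = 𝔖} (λ _ → 1) {tabulate (λ i → i)} identity) (>-nonZero⁻¹ (n ^ n) {{m^n≢0 n n}}))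
      (≤-reflexive (trans (cong (_* n ^ n) (length-∑ 𝔖)) (sym pairsTotal≡)))
      where
      identity : tabulate (λ i → i) ∈ 𝔖
      identity = ∈-bijections⁺ λ i j eq → trans (sym (lookup∘tabulate (λ i → i) i)) (trans eq (lookup∘tabulate (λ i → i) j))

-- Linear time on graphs with few perfect matchings.

module Limit where

  open Sums
  open Rows
  open Words
  open Count
  open Walk using (Certificate)
  open Encoding using (padded-toℕ)
  open Solver
  open import Data.Fin.Properties using (toℕ<n)
  open import Data.Integer.Base as ℤ using (+_)
  open import Data.List.Membership.Propositional using (_∈_)
  open import Data.List.Membership.Propositional.Properties using (∈-filter⁻; ∈-map⁻)
  open import Data.List.Properties using (length-map)
  open import Data.List.Relation.Unary.Unique.Propositional using (Unique)
  import Data.List.Relation.Unary.Unique.Propositional.Properties as Unique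
  open import Data.Vec.Base using (Vec; lookup; tabulate)
  open import Data.Vec.Properties using (lookup∘tabulate)
  open import Function.Bundles using (Equivalence)

  module _ {n : ℕ} {G : BipartiteGraph n} (L : Listing G) {B : ℕ} {blk : Fin n → ℕ} {m : Bool → Fin n → Fin n}
    (cert : Certificate (Listing.fst L) (Listing.snd L) (suc B) blk m) where
    open Certificate cert

    private
      choice : Vec Bool B → ℕ → Bool
      choice v zero = false
      choice v (suc b) = padded false (lookup v) b

      chosen : Vec Bool B → Vec (Fin n) n
      chosen v = tabulate (λ e → m (choice v (blk e)) e)

      chosen-injective : ∀ {v w} → chosen v ≡ chosen w → v ≡ w
      chosen-injective {v} {w} eq = lookup-injective same
        where
        pointwise : ∀ e → m (choice v (blk e)) e ≡ m (choice w (blk e)) e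
        pointwise e = trans (sym (lookup∘tabulate (λ e → m (choice v (blk e)) e) e))
          (trans (cong (λ f → lookup f e) eq) (lookup∘tabulate (λ e → m (choice w (blk e)) e) e))
        same : ∀ b → lookup v b ≡ lookup w b
        same b with distinct (suc (toℕ b)) (s≤s z≤n) (s≤s (toℕ<n b))
        ... | ℓ , blk≡ , m≢ = decide (lookup v b) (lookup w b)
          (subst₂ (λ x y → m x ℓ ≡ m y ℓ)
            (trans (cong (choice v) blk≡) (padded-toℕ false (lookup v) b))
            (trans (cong (choice w) blk≡) (padded-toℕ false (lookup w) b)) (pointwise ℓ))
          where
          decide : ∀ x y → m x ℓ ≡ m y ℓ → x ≡ y
          decide true true _ = refl
          decide false false _ = refl
          decide true false p = contradiction (sym p) m≢
          decide false true p = contradiction p m≢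

    -- Free bits are given to the labels from 1 to `B`, and label 0 is fixed. Distinct bit vectors
    -- give distinct matchings, as each of these labels has an edge on which its two ways differ.
    2^labels≤matchings : 2 ^ B ≤ matchings n G
    2^labels≤matchings = begin
      2 ^ B                              ≡⟨ length-vectors (bools {n}) B ⟨
      length vs                          ≡⟨ length-map chosen vs ⟨
      length (map chosen vs)             ≡⟨ length-∑ (map chosen vs) ⟨
      ∑ (map chosen vs) (λ _ → 1)        ≡⟨ ∑-cong (map chosen vs) (λ f f∈ → sym (one f∈)) ⟩
      ∑ (map chosen vs) (λ f → matches n f G)
        ≤⟨ ∑-⊆ (Unique.map⁺ chosen-injective (vectors-unique (bools-unique {n}) B)) sub (λ f → matches n f G) ⟩
      matchings n G                      ∎
      where
      open ≤-Reasoning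
      vs : List (Vec Bool B)
      vs = vectors (bools {n}) B
      good-choice : ∀ v → chosen v ∈ bijections × matches n (chosen v) G ≡ 1
      good-choice v = as-vector n G (λ e → m (choice v (blk e)) e) (matching⇒feasible L (sound (choice v)))
      one : ∀ {f} → f ∈ map chosen vs → matches n f G ≡ 1
      one f∈ with ∈-map⁻ chosen f∈
      ... | v , _ , refl = proj₂ (good-choice v)
      sub : ∀ {f} → f ∈ map chosen vs → f ∈ bijections
      sub f∈ with ∈-map⁻ chosen f∈
      ... | v , _ , refl = proj₁ (good-choice v)

  -- Arithmetic of the time bound

  -- Absorbs the quadratic factor of the enumeration: with at most `3 * e` cycles, its square root
  -- is at most `3 * e + 2`.
  square≤2^ : ∀ e → (3 * e + 2) * (3 * e + 2) ≤ 32 * 2 ^ e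
  -- Doubling outgrows the square only from `e = 2` on: 121 ≤ 2 * 64, but 64 > 2 * 25. Hence three
  -- base cases.
  square≤2^ 0 = m≤m+n 4 28
  square≤2^ 1 = m≤m+n 25 39
  square≤2^ 2 = m≤m+n 64 64
  square≤2^ (suc (suc (suc k))) = begin
    (3 * (3 + k) + 2) * (3 * (3 + k) + 2)                                ≤⟨ m≤m+n _ (7 + 30 * k + 9 * (k * k)) ⟩
    (3 * (3 + k) + 2) * (3 * (3 + k) + 2) + (7 + 30 * k + 9 * (k * k))   ≡⟨ lem k ⟩
    2 * ((3 * (2 + k) + 2) * (3 * (2 + k) + 2))                          ≤⟨ *-monoʳ-≤ 2 (square≤2^ (suc (suc k))) ⟩
    2 * (32 * 2 ^ (2 + k))                                               ≡⟨ swap (2 ^ (2 + k)) ⟩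
    32 * (2 * 2 ^ (2 + k))                                               ∎
    where
    open ≤-Reasoning
    lem : ∀ k → (3 * (3 + k) + 2) * (3 * (3 + k) + 2) + (7 + 30 * k + 9 * (k * k)) ≡ 2 * ((3 * (2 + k) + 2) * (3 * (2 + k) + 2))
    lem = solve-∀
    swap : ∀ x → 2 * (32 * x) ≡ 32 * (2 * x)
    swap = solve-∀

  time≤ : ∀ n B → time n B ≤ 52 + 349 * n + 80 * (2 ^ B * ((B + 1) * (B + 1)))
  time≤ n B = begin
    time n B                                                         ≡⟨ expand n B (2 ^ B) ⟩
    52 + 349 * n + 30 * B + 2 ^ B * (49 + 50 * B + 20 * (B * B))
      ≤⟨ +-mono-≤ (+-monoʳ-≤ (52 + 349 * n) (*-monoʳ-≤ 30 B≤)) (*-monoʳ-≤ (2 ^ B) poly) ⟩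
    52 + 349 * n + 30 * (2 ^ B * Q) + 2 ^ B * (50 * Q)               ≡⟨ collect (52 + 349 * n) (2 ^ B) Q ⟩
    52 + 349 * n + 80 * (2 ^ B * Q)                                  ∎
    where
    open ≤-Reasoning
    Q : ℕ
    Q = (B + 1) * (B + 1)
    -- The numerals are the durations of the loop bodies, to which `time n B` reduces.
    expand : ∀ n B p → (6 + n * 42 + (6 + n * 15 + (n * 45 + (2 + (6 + n * 27 + (n * 32 + 0))))))
      + (4 + (2 + (6 + (B + B) * 15 + (6 + n * 170 + (2 + (2 + (4 + p * (4 +
        ((2 + (6 + B * (8 + (8 + (6 + B * 20))))) + ((8 + (2 + (2 + (6 + B * 12)))) + (2 + (9 + B * 16 + 8))))) + (6 + n * 18 + 0))))))))
      ≡ 52 + 349 * n + 30 * B + p * (49 + 50 * B + 20 * (B * B))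
    expand = solve-∀
    collect : ∀ a p q → a + 30 * (p * q) + p * (50 * q) ≡ a + 80 * (p * q)
    collect = solve-∀
    square : ∀ B → (B + 1) * (B + 1) ≡ B + (1 + B + B * B)
    square = solve-∀
    B≤ : B ≤ 2 ^ B * Q
    B≤ = ≤-trans (≤-trans (m≤m+n B (1 + B + B * B)) (≤-reflexive (sym (square B))))
      (m≤n*m Q (2 ^ B) {{m^n≢0 2 B}})
    slack : ∀ B → 49 + 50 * B + 20 * (B * B) + (1 + 50 * B + 30 * (B * B)) ≡ 50 * ((B + 1) * (B + 1))
    slack = solve-∀
    poly : 49 + 50 * B + 20 * (B * B) ≤ 50 * Q
    poly = ≤-trans (m≤m+n _ (1 + 50 * B + 30 * (B * B))) (≤-reflexive (slack B))

  -- n lies between s⁴ and 16 s⁴, where s is a power of two.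
  scale : ∀ n → 1 ≤ n → ∃ λ e → 16 ^ e ≤ n × n < 16 ^ suc e
  scale (suc zero) _ = 0 , ≤-refl , m≤m+n 2 14
  scale (suc n@(suc _)) _ with scale n (s≤s z≤n)
  ... | e , lo , hi with suc n <? 16 ^ suc e
  ...   | yes lt = e , m≤n⇒m≤1+n lo , lt
  ...   | no ≮ = suc e , ≮⇒≥ ≮ , ≤-<-trans hi (^-monoʳ-< 16 (s≤s (s≤s z≤n)) (n<1+n (suc e)))

  module Scale {n e : ℕ} (lo : 16 ^ e ≤ n) (hi : n < 16 ^ suc e) where

    s : ℕ
    s = 2 ^ e

    16^≡ : ∀ e → 16 ^ e ≡ 2 ^ e * 2 ^ e * (2 ^ e * 2 ^ e)
    16^≡ zero = refl
    16^≡ (suc e) = trans (cong (16 *_) (16^≡ e)) (lem (2 ^ e))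
      where
      lem : ∀ x → 16 * (x * x * (x * x)) ≡ 2 * x * (2 * x) * (2 * x * (2 * x))
      lem = solve-∀

    instance
      s≢0 : NonZero s
      s≢0 = m^n≢0 2 e

      ss≢0 : NonZero (s * s)
      ss≢0 = m*n≢0 s s

      n≢0 : NonZero n
      n≢0 = >-nonZero (≤-trans (>-nonZero⁻¹ (16 ^ e) {{m^n≢0 16 e}}) lo)

    threshold : ℕ
    threshold = s * (s * s)

    threshold≡ : threshold ≡ 2 ^ (3 * e)
    threshold≡ = trans (lem s) (^-*-assoc′ e)
      where
      lem : ∀ x → x * (x * x) ≡ x ^ 3
      lem x = cong (λ z → x * (x * z)) (sym (*-identityʳ x))
      ^-*-assoc′ : ∀ e → (2 ^ e) ^ 3 ≡ 2 ^ (3 * e)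
      ^-*-assoc′ e = trans (^-*-assoc 2 e 3) (cong (2 ^_) (*-comm e 3))

    -- `squares-bound` with `M = s * s`, the order of √n: from n < 16 s⁴ follows n + M² ≤ (16 + 1)
    -- s⁴.
    squares≤17s² : s * s * squares n ≤ s * s * (17 * (s * s) * pairsTotal n)
    squares≤17s² = begin
      s * s * squares n                          ≤⟨ squares-bound n (s * s) ⟩
      (n + s * s * (s * s)) * pairsTotal n       ≤⟨ *-monoˡ-≤ (pairsTotal n) (+-monoˡ-≤ (s * s * (s * s)) (<⇒≤ hi)) ⟩
      (16 * 16 ^ e + s * s * (s * s)) * pairsTotal n ≡⟨ cong (λ z → (16 * z + s * s * (s * s)) * pairsTotal n) (16^≡ e) ⟩
      (16 * (s * s * (s * s)) + s * s * (s * s)) * pairsTotal n ≡⟨ lem₂ (s * s) (pairsTotal n) ⟩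
      s * s * (17 * (s * s) * pairsTotal n)      ∎
      where
      open ≤-Reasoning
      lem₂ : ∀ q p → (16 * (q * q) + q * q) * p ≡ q * (17 * q * p)
      lem₂ = solve-∀

    -- Markov gives s³ |bad| ≤ ∑ m, and the second moment gives ∑ m ≤ 17 s² |χ|; dividing by s²
    -- leaves a fraction of at most 17 / s.
    few-bad : length (bad n threshold) * s ≤ 17 * length (feasible n)
    few-bad = *-cancelʳ-≤ _ _ (s * s) (begin
      length (bad n threshold) * s * (s * s)   ≡⟨ *-assoc (length (bad n threshold)) s (s * s) ⟩
      length (bad n threshold) * threshold     ≤⟨ bad-bound n threshold ⟩
      pairsTotal n                             ≤⟨ pairsTotal≤ n (17 * (s * s)) {{m*n≢0 17 (s * s)}} (*-cancelˡ-≤ (s * s) squares≤17s²) ⟩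
      17 * (s * s) * length (feasible n)       ≡⟨ lem (s * s) (length (feasible n)) ⟩
      17 * length (feasible n) * (s * s)       ∎)
      where
      open ≤-Reasoning
      lem : ∀ a b → 17 * a * b ≡ 17 * b * a
      lem = solve-∀

    feasible-nonempty : 1 ≤ length (feasible n)
    feasible-nonempty = nonzero _ (pairsTotal≤ n (17 * (s * s)) {{m*n≢0 17 (s * s)}} (*-cancelˡ-≤ (s * s) squares≤17s²))
      where
      nonzero : ∀ k → pairsTotal n ≤ 17 * (s * s) * k → 1 ≤ k
      nonzero (suc k) _ = s≤s z≤n
      nonzero zero le = contradiction (≤-trans (pairsTotal-positive n) (≤-trans le (≤-reflexive (*-zeroʳ (17 * (s * s)))))) λ ()

    -- 5521 = 52 + 349 + 80 * 64. In 64 = 2 * 32, the 2 comes from label 0, which doubles the number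
    -- of choices, and the 32 from `square≤2^`.
    linear-time : ∀ {B} → 2 ^ B ≤ threshold → time n (suc B) ≤ 5521 * n
    linear-time {B} 2^B≤ = begin
      time n (suc B)                                                    ≤⟨ time≤ n (suc B) ⟩
      52 + 349 * n + 80 * (2 ^ suc B * ((suc B + 1) * (suc B + 1)))     ≤⟨ +-mono-≤ (+-monoˡ-≤ (349 * n) (≤-trans (≤-reflexive (sym (*-identityʳ 52))) (*-monoʳ-≤ 52 (>-nonZero⁻¹ n)))) (*-monoʳ-≤ 80 work) ⟩
      52 * n + 349 * n + 80 * (64 * n)                                  ≡⟨ lem n ⟩
      5521 * n                                                          ∎
      where
      open ≤-Reasoning
      lem : ∀ n → 52 * n + 349 * n + 80 * (64 * n) ≡ 5521 * n
      lem = solve-∀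
      B≤3e : B ≤ 3 * e
      B≤3e = ≮⇒≥ λ lt → contradiction (≤-trans 2^B≤ (≤-reflexive threshold≡)) (<⇒≱ (^-monoʳ-< 2 (s≤s (s≤s z≤n)) lt))
      side : suc B + 1 ≤ 3 * e + 2
      side = ≤-trans (≤-reflexive (trans (+-comm (suc B) 1) (+-comm 2 B))) (+-monoˡ-≤ 2 B≤3e)
      work : 2 ^ suc B * ((suc B + 1) * (suc B + 1)) ≤ 64 * n
      work = begin
        2 * 2 ^ B * ((suc B + 1) * (suc B + 1))   ≤⟨ *-mono-≤ (*-monoʳ-≤ 2 2^B≤) (≤-trans (*-mono-≤ side side) (square≤2^ e)) ⟩
        2 * (s * (s * s)) * (32 * s)              ≡⟨ lem₂ s ⟩
        64 * (s * s * (s * s))                    ≡⟨ cong (64 *_) (16^≡ e) ⟨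
        64 * 16 ^ e                               ≤⟨ *-monoʳ-≤ 64 lo ⟩
        64 * n                                    ∎
        where
        lem₂ : ∀ s → 2 * (s * (s * s)) * (32 * s) ≡ 64 * (s * s * (s * s))
        lem₂ = solve-∀

    good-fast : ∀ {G} → G ∈ good n threshold → χ* solver 5521 n G
    good-fast {G} G∈ = G-feasible , λ W L w → fast W L w (Solving.solve W L w (proj₂ (proj₂ G-feasible)))
      where
      G∈feasible,few : G ∈ feasible n × matchings n G ≤ threshold
      G∈feasible,few = ∈-filter⁻ (λ G → matchings n G ≤? threshold) {xs = feasible n} G∈
      G-feasible : χ n G
      G-feasible = Equivalence.to (∈-feasible n G) (proj₁ G∈feasible,few)
      fast : ∀ (W : WeightDomain) (L : Listing G) (w : Weights W n) → Solving.Solved W L w (proj₂ (proj₂ G-feasible)) →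
        ∃ λ t → t ≤ 5521 * n × SolvesInTime W w solver L t
      fast W L w (zero , blk , m , cert , _) = contradiction (Certificate.B≥1 cert) λ ()
      fast W L w (suc B , blk , m , cert , t , t≤ , sol) =
        t , ≤-trans t≤ (linear-time {B} (≤-trans (2^labels≤matchings L cert) (proj₂ G∈feasible,few))) , sol

  solves : Solves2TSPVR solver
  solves W n G G-feasible L w = let (_ , _ , _ , _ , t , _ , sol) = Solving.solve W L w (proj₂ (proj₂ G-feasible)) in t , sol

-- The ratio tends to 1.

open Count
open Limit
open Solver
open import Data.Integer.Base as ℤ using (ℤ; +_; +[1+_]; -[1+_]; +<+)
import Data.Integer.Properties as ℤ
open import Data.Integer.Tactic.RingSolver using () renaming (solve-∀ to solve-∀ᶻ)
open import Data.List.Relation.Unary.All using () renaming (tabulate to All-tabulate)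
open import Data.Product.Base using (Σ)
import Data.Rational.Base as ℚ
import Data.Rational.Properties as ℚ
import Data.Rational.Unnormalised.Base as ℚᵘ
import Data.Rational.Unnormalised.Properties as ℚᵘ

-- The difference `k / m - 1` is `- b / m`, and a positive rational is at least the inverse of its
-- denominator.
ratio-close : ∀ ε → ℚ.0ℚ ℚ.< ε → ∀ k b m-1 → k + b ≡ suc m-1 → b * ℚ.ℚ.denominatorℕ ε < suc m-1 →
  ℚ.∣ (+ k ℚ./ suc m-1) ℚ.- ℚ.1ℚ ∣ ℚ.< ε
ratio-close (ℚ.mkℚ (+ 0) d c) 0<ε = contradiction (ℚ.positive 0<ε) λ ()
ratio-close (ℚ.mkℚ -[1+ p ] d c) 0<ε = contradiction (ℚ.positive 0<ε) λ ()
ratio-close (ℚ.mkℚ +[1+ p ] d c) 0<ε k b m-1 k+b≡m bd<m =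
  ℚ.toℚᵘ-cancel-< (ℚᵘ.<-respˡ-≃ (ℚᵘ.≃-sym unnormalise) (ℚᵘ.*<* num<ε))
  where
  q : ℚᵘ.ℚᵘ
  q = ℚᵘ.mkℚᵘ (+ k) m-1
  one : ℚᵘ.ℚᵘ
  one = ℚᵘ.- ℚᵘ.1ℚᵘ
  unnormalise : ℚ.toℚᵘ ℚ.∣ (+ k ℚ./ suc m-1) ℚ.- ℚ.1ℚ ∣ ℚᵘ.≃ ℚᵘ.∣ q ℚᵘ.+ one ∣
  unnormalise = ℚᵘ.≃-trans (ℚ.toℚᵘ-homo-∣-∣ ((+ k ℚ./ suc m-1) ℚ.- ℚ.1ℚ))
    (ℚᵘ.∣-∣-cong (ℚᵘ.≃-trans (ℚ.toℚᵘ-homo-+ (+ k ℚ./ suc m-1) (ℚ.- ℚ.1ℚ)) (ℚᵘ.+-cong (ℚ.toℚᵘ-fromℚᵘ q) ℚᵘ.≃-refl)))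
  numerator : + k ℤ.* + 1 ℤ.+ -[1+ 0 ] ℤ.* + suc m-1 ≡ ℤ.- (+ b)
  numerator = trans (cong (λ m → + k ℤ.* + 1 ℤ.+ -[1+ 0 ] ℤ.* + m) (sym k+b≡m)) (trans (cong (λ z → + k ℤ.* + 1 ℤ.+ -[1+ 0 ] ℤ.* z) (ℤ.pos-+ k b)) (lem (+ k) (+ b)))
    where
    lem : ∀ x y → x ℤ.* + 1 ℤ.+ -[1+ 0 ] ℤ.* (x ℤ.+ y) ≡ ℤ.- y
    lem = solve-∀ᶻ
  num<ε : + ℤ.∣ + k ℤ.* + 1 ℤ.+ -[1+ 0 ] ℤ.* + suc m-1 ∣ ℤ.* + suc d ℤ.< +[1+ p ] ℤ.* + (suc m-1 * 1)
  num<ε = subst (λ z → + ℤ.∣ z ∣ ℤ.* + suc d ℤ.< +[1+ p ] ℤ.* + (suc m-1 * 1)) (sym numerator)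
    (subst (λ z → + z ℤ.* + suc d ℤ.< +[1+ p ] ℤ.* + (suc m-1 * 1)) (sym (ℤ.∣-i∣≡∣i∣ (+ b)))
    (subst₂ ℤ._<_ (ℤ.pos-* b (suc d)) (ℤ.pos-* (suc p) (suc m-1 * 1))
      (+<+ (<-≤-trans bd<m (≤-trans (≤-reflexive (sym (*-identityʳ (suc m-1)))) (m≤m+n (suc m-1 * 1) _))))))

n<2^n : ∀ n → n < 2 ^ n
n<2^n zero = s≤s z≤n
n<2^n (suc n) = ≤-trans (+-mono-≤ (>-nonZero⁻¹ (2 ^ n) {{m^n≢0 2 n}}) (n<2^n n)) (≤-reflexive (cong (λ z → 2 ^ n + z) (sym (+-identityʳ (2 ^ n)))))

ratio : RatioTendsTo1 (χ* solver 5521) χ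
-- From `n ≥ 16 ^ (17 * d)` follows `17 * d ≤ e`, hence `17 * d < 2 ^ (17 * d) ≤ s`. Together with
-- `few-bad` this yields `b * d < m`.
ratio ε 0<ε = 16 ^ (17 * d) , close
  where
  d : ℕ
  d = ℚ.ℚ.denominatorℕ ε
  close : ∀ n → 16 ^ (17 * d) ≤ n → ∃₂ λ k m → HasSizeAtLeast (χ* solver 5521 n) k × HasSize (χ n) m ×
    Σ (NonZero m) λ m≢0 → ℚ.∣ (ℚ._/_ (+ k) m {{m≢0}}) ℚ.- ℚ.1ℚ ∣ ℚ.< ε
  close n N≤n with scale n (≤-trans (>-nonZero⁻¹ (16 ^ (17 * d)) {{m^n≢0 16 (17 * d)}}) N≤n)
  ... | e , lo , hi = finish (length (feasible n)) refl feasible-nonempty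
    where
    open Scale {n} {e} lo hi
    17d<s : 17 * d < s
    17d<s = <-≤-trans (n<2^n (17 * d)) (^-monoʳ-≤ 2 (≤-pred (^-cancelʳ-<′ {17 * d} {suc e} (≤-<-trans N≤n hi))))
      where
      ^-cancelʳ-<′ : ∀ {a b} → 16 ^ a < 16 ^ b → a < b
      ^-cancelʳ-<′ {a} {b} lt = ≰⇒> λ b≤a → <⇒≱ lt (^-monoʳ-≤ 16 b≤a)
    K : ℕ
    K = threshold
    b : ℕ
    b = length (bad n K)
    bd<m : ∀ {m} → 1 ≤ m → b * s ≤ 17 * m → b * d < m
    bd<m {m} 1≤m le = *-cancelˡ-< 17 _ _ (go b refl)
      where
      open ≤-Reasoning
      lem : ∀ x y → 17 * (x * y) ≡ x * (17 * y)
      lem = solve-∀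
      go : ∀ b′ → b ≡ b′ → 17 * (b * d) < 17 * m
      -- Without bad graphs the factor `b` destroys the strict inequality `17 * d < s`, and `1 ≤ m`
      -- supplies the strictness.
      go zero eq = subst (λ z → 17 * (z * d) < 17 * m) (sym eq) (*-monoʳ-< 17 1≤m)
      go (suc b′) eq = begin-strict
        17 * (b * d)   ≡⟨ lem b (d) ⟩
        b * (17 * d)   <⟨ *-monoʳ-< b {{subst NonZero (sym eq) _}} 17d<s ⟩
        b * s              ≤⟨ le ⟩
        17 * m             ∎
    finish : ∀ m → m ≡ length (feasible n) → 1 ≤ m → ∃₂ λ k m → HasSizeAtLeast (χ* solver 5521 n) k × HasSize (χ n) m ×
      Σ (NonZero m) λ m≢0 → ℚ.∣ (ℚ._/_ (+ k) m {{m≢0}}) ℚ.- ℚ.1ℚ ∣ ℚ.< ε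
    finish m@(suc m-1) m≡ 1≤m = length (good n K) , m
      , (good n K , good-unique n K , refl , All-tabulate good-fast)
      , (feasible n , feasible-unique n , sym m≡ , ∈-feasible n)
      , _ , ratio-close ε 0<ε (length (good n K)) b m-1 (trans (good+bad n K) (sym m≡))
              (bd<m 1≤m (subst (λ z → b * s ≤ 17 * z) (sym m≡) few-bad))

mainTheorem2 : ∃ λ (A : Program) → Solves2TSPVR A × (∃ λ (C : ℕ) → RatioTendsTo1 (χ* A C) χ)
mainTheorem2 = solver , solves , 5521 , ratio
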